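{- Let $\Delta\ge 3$, $c\in[0,\Delta-2]$, $\kappa=\Delta+c$. In the incremental model for general (unrooted) forests of maximum degree at most $\Delta$, {\textsc{DistMaint}} has expected amortized recourse $\Theta(1/\Delta)$: for every insertion sequence (fixed in advance) its expected amortized recourse is $O(1/\Delta)$, and there are insertion sequences for which it is $\Omega(1/\Delta)$.
   Context: A dynamic forest on a fixed vertex set starts empty; each update inserts an edge joining two distinct trees; maximum degree stays at most $\Delta$. The palette is $[\kappa]$; $A(x)$ denotes the colors not used on edges incident to $x$. Recourse of an update = number of previously colored edges whose color changes; expected amortized recourse = expectation of total recourse divided by number of updates; the adversary is oblivious (sequence fixed in advance). {\textsc{DistMaint}} keeps a designated root in every tree (initially every vertex is a root; rerooting changes only the designation, not colors). Insertion of $(u,v)$ with $T_u,T_v$ the trees of $u,v$: if both $T_u$ and $T_v$ have at most $\Delta$ edges, name the endpoints so that $\deg(v)\le\deg(u)$; otherwise so that $|E(T_v)|\le|E(T_u)|$. Reroot $T_v$ at $v$, make $v$ a child of $u$, choose the color $\beta$ of $(u,v)$ uniformly at random from $A(u)$, and call RootToChild$(v,\beta)$. RootToChild$(r,\beta)$: if no child edge of $r$ has color $\beta$, stop; else let $(r,w)$ be that edge, choose $\alpha$ uniformly from $A(r)$, recolor $(r,w)$ to $\alpha$, call FixForbidden$(w,\beta,\alpha)$. FixForbidden$(v,\alpha,\beta)$: if no child edge of $v$ has color $\beta$, stop; else recolor that child edge $(v,w)$ to $\alpha$ and call FixForbidden$(w,\beta,\alpha)$. Random choices are independent. -}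

module Defs where

open import Data.Nat using (ℕ; zero; suc; _≤_)
open import Data.Bool using (Bool; true; false; _∨_; _∧_; not; if_then_else_)
open import Data.Fin using (Fin; zero; suc)
import Data.Fin as Fin
open import Data.List using (List; []; _∷_; _++_; length; lookup; allFin; zip)
open import Data.Bool.ListAction using (any)
open import Data.List.Membership.Propositional using (_∈_)
open import Data.Maybe using (Maybe; just; nothing)
open import Data.Product using (_×_; _,_; proj₁; proj₂)
open import Data.Unit using (⊤)
open import Data.Integer using (+_)
open import Data.Rational using (ℚ; 0ℚ; _/_)
import Data.Rational as Q
open import Relation.Nullary using (¬_)
open import Relation.Nullary.Decidable using (⌊_⌋)
open import Function using (_∘_)

data Rand (A : Set) : Set where
  ret  : A → Rand A
  -- uniform choice among suc k outcomes
  pick : (k : ℕ) → (Fin (suc k) → Rand A) → Rand A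

_>>=_ : {A B : Set} → Rand A → (A → Rand B) → Rand B
ret a    >>= f = f a
pick k g >>= f = pick k (λ i → g i >>= f)

uniformFrom : {C : Set} → List C → Rand (Maybe C)
uniformFrom []       = ret nothing
uniformFrom (x ∷ xs) = pick (length xs) (λ i → ret (just (lookup (x ∷ xs) i)))

sumFin : (k : ℕ) → (Fin k → ℚ) → ℚ
sumFin zero    f = 0ℚ
sumFin (suc k) f = f zero Q.+ sumFin k (f ∘ suc)

𝔼 : {A : Set} → Rand A → (A → ℚ) → ℚ
𝔼 (ret a)    f = f a
𝔼 (pick k g) f = ((+ 1) / suc k) Q.* sumFin (suc k) (λ i → 𝔼 (g i) f)

ℕtoℚ : ℕ → ℚ
ℕtoℚ m = (+ m) / 1

countᵇ : {A : Set} → (A → Bool) → List A → ℕ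
countᵇ p []       = 0
countᵇ p (x ∷ xs) = if p x then suc (countᵇ p xs) else countᵇ p xs

_==_ : {n : ℕ} → Fin n → Fin n → Bool
x == y = ⌊ x Fin.≟ y ⌋

data Reach {n : ℕ} (es : List (Fin n × Fin n)) : Fin n → Fin n → Set where
  here : ∀ {x} → Reach es x x
  fwd  : ∀ {a b y} → (a , b) ∈ es → Reach es b y → Reach es a y
  bwd  : ∀ {a b y} → (a , b) ∈ es → Reach es a y → Reach es b y

degE : {n : ℕ} → List (Fin n × Fin n) → Fin n → ℕ
degE es x = countᵇ (λ e → (proj₁ e == x) ∨ (proj₂ e == x)) es

JoinsTrees : {n : ℕ} → List (Fin n × Fin n) → List (Fin n × Fin n) → Set
JoinsTrees acc []             = ⊤
JoinsTrees acc ((u , v) ∷ rest) = ¬ Reach acc u v × JoinsTrees ((u , v) ∷ acc) rest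

Valid : (n Δ : ℕ) → List (Fin n × Fin n) → Set
Valid n Δ seq = JoinsTrees [] seq × (∀ x → degE seq x ≤ Δ)

CEdge : ℕ → ℕ → Set
CEdge n κ = Fin n × Fin n × Fin κ

module DistMaint (n κ Δ : ℕ) where

  St : Set
  St = List (CEdge n κ)

  incident : Fin n → CEdge n κ → Bool
  incident x (a , b , _) = (a == x) ∨ (b == x)

  deg : St → Fin n → ℕ
  deg st x = countᵇ (incident x) st

  stepC : St → (Fin n → Bool) → Fin n → Bool
  stepC st S y = S y ∨ any (λ { (a , b , _) → (S a ∧ (b == y)) ∨ (S b ∧ (a == y)) }) st

  iter : ℕ → ((Fin n → Bool) → Fin n → Bool) → (Fin n → Bool) → Fin n → Bool
  iter zero    f S = S
  iter (suc k) f S = f (iter k f S)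

  inTree : St → Fin n → Fin n → Bool
  inTree st x = iter n (stepC st) (λ y → x == y)

  treeSize : St → Fin n → ℕ
  treeSize st x = countᵇ (λ { (a , _ , _) → inTree st x a }) st

  usedAt : St → Fin n → Fin κ → Bool
  usedAt st x col = any (λ { (a , b , c') → ((a == x) ∨ (b == x)) ∧ (c' == col) }) st

  avail : St → Fin n → List (Fin κ)
  avail st x = Data.List.filterᵇ (λ col → not (usedAt st x col)) (allFin κ)

  -- the child edge of v (i.e. edge at v not leading to its parent p) of color β
  childWith : St → (p v : Fin n) → Fin κ → Maybe (Fin n)
  childWith [] p v β = nothing
  childWith ((a , b , col) ∷ st) p v β =
    if (a == v) ∧ not (b == p) ∧ (col == β) then just b
    else if (b == v) ∧ not (a == p) ∧ (col == β) then just a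
    else childWith st p v β

  recolor : St → (x y : Fin n) → Fin κ → St
  recolor [] x y γ = []
  recolor ((a , b , col) ∷ st) x y γ =
    if ((a == x) ∧ (b == y)) ∨ ((a == y) ∧ (b == x))
    then (a , b , γ) ∷ st
    else (a , b , col) ∷ recolor st x y γ

  fixForbidden : ℕ → St → (p v : Fin n) → (α β : Fin κ) → St
  fixForbidden zero    st p v α β = st
  fixForbidden (suc k) st p v α β with childWith st p v β
  ... | nothing = st
  ... | just w  = fixForbidden k (recolor st v w α) v w β α

  rootToChild : St → (p r : Fin n) → Fin κ → Rand St
  rootToChild st p r β with childWith st p r β
  ... | nothing = ret st
  ... | just w  = uniformFrom (avail st r) >>= λ
      { nothing  → ret st
      ; (just α) → ret (fixForbidden n (recolor st r w α) r w β α) }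

  -- orientation of an inserted edge: returns (u , v), v becomes child of u
  orient : St → Fin n → Fin n → Fin n × Fin n
  orient st x y =
    if (treeSize st x Data.Nat.≤ᵇ Δ) ∧ (treeSize st y Data.Nat.≤ᵇ Δ)
    then (if deg st y Data.Nat.≤ᵇ deg st x then (x , y) else (y , x))
    else (if treeSize st y Data.Nat.≤ᵇ treeSize st x then (x , y) else (y , x))

  insert : St → Fin n → Fin n → Rand St
  insert st x y with orient st x y
  ... | (u , v) = uniformFrom (avail st u) >>= λ
      { nothing  → ret st
      ; (just β) → rootToChild (st ++ ((u , v , β) ∷ [])) u v β }

  recourse : St → St → ℕ
  recourse old new = countᵇ (λ { ((_ , _ , c₁) , (_ , _ , c₂)) → not (c₁ == c₂) }) (zip old new)

  run : St → List (Fin n × Fin n) → Rand (St × ℕ)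
  run st []             = ret (st , 0)
  run st ((x , y) ∷ rest) = insert st x y >>= λ st' →
    run st' rest >>= λ { (fin , r) → ret (fin , recourse st st' Data.Nat.+ r) }

expTotalRecourse : (Δ c n : ℕ) → List (Fin n × Fin n) → ℚ
expTotalRecourse Δ c n seq =
  𝔼 (DistMaint.run n (Δ Data.Nat.+ c) Δ [] seq) (λ p → ℕtoℚ (proj₂ p))

{-# OPTIONS --safe #-}
-- Since the adversary is oblivious, the shape and the orientation of the forest are deterministic. After every insertion
-- the colouring is uniform among the proper colourings of the current forest: inserting (u , v) with a colour β that is
-- used at v swaps β and α along a Kempe chain, and for fixed β and α this swap is a bijection between the colourings with
-- β used and α free at v and those with α used and β free at v. By uniformity an edge at distance d below v is recoloured
-- with probability 1 / (κ (κ - 1) ^ d) (exchanging two colours inside a subtree shows that the colour of an edge is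
-- uniform given its parent edge), so an insertion has expected recourse B / κ, where B is the number of edges of the tree
-- of v weighted by (κ - 1) ^ - d.
--
-- Write q = Δ - 1 and let s be the number of edges of the tree of v. A tree has at most q ^ (d + 1) edges at distance d,
-- so B ≤ q * (number of digits of s in base q), and B ≤ s and, if s ≤ Δ, B ≤ deg v + 1. For two small trees the smaller of
-- two degrees is charged to a vertex that stops being a representative of its tree, in total at most the sum of all
-- degrees. The other merges are paid for by a superadditive potential of the tree sizes, because at most m / t merges
-- involve two trees with at least t edges. Altogether the values B add up to at most 8 m.
--
-- Conversely every insertion between two non-isolated vertices has expected recourse at least 1 / κ ≥ 1 / (2 Δ); building
-- a path by inserting every other edge first makes about half of the insertions of this kind.
module Submission where

open import Defs
open import Data.Nat using (ℕ; _≤_; _∸_)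
open import Data.Fin using (Fin)
open import Data.List using (List; length)
open import Data.Product using (Σ; _×_; _,_)

-- Uniformity is never stated as a property of a distribution. `uniform` is an identity, valid for
-- every function `g` of the state, between unnormalised sums over the proper colourings before and
-- after an insertion. Applied to the expected recourse of the remaining run it drives the induction
-- of `bounds`; applied to a constant it relates the numbers of proper colourings. The obstacle in
-- the amortisation is the merging of two trees with at most `Δ` edges. Charging the size of the
-- smaller tree each time can cost a factor logarithmic in `Δ`. The degree rule avoids this, because
-- all edges not incident to `v` together weigh at most as much as one edge at `v`. The degree
-- charged is the final one, `f`, which does not change in time, so a representative of largest
-- final degree stays largest until its tree is merged. The surviving representative may come from
-- either side, whichever end becomes the child. The constant `8 = 2 + 1 + 5` collects the degree
-- sum, one unit per insertion and the potential per edge; `1 / 6` comes from a third of the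
-- insertions and `κ ≤ 2 Δ`.

-- Finite sums over lists, and sums over all colourings

module FiniteSums where

  open import Data.Nat using (zero; suc)
  open import Data.Bool using (Bool; true; false; _∧_; not; if_then_else_)
  open import Data.Fin using (zero; suc)
  import Data.Fin as Fin
  import Data.Fin.Properties as Fin
  open import Data.List using ([]; _∷_; _++_; map; concatMap; allFin; filterᵇ)
  open import Data.List.Properties using (map-tabulate)
  open import Data.Vec using (Vec; []; _∷_)
  open import Data.Product using (proj₁; proj₂)
  open import Data.Empty using (⊥-elim)
  open import Function using (_∘_; id)
  open import Relation.Nullary using (yes; no; ¬_)
  open import Relation.Binary.PropositionalEquality
  open import Algebra.Structures using (IsCommutativeMonoid)

  bool-ext : ∀ {a b} → (a ≡ true → b ≡ true) → (b ≡ true → a ≡ true) → a ≡ b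
  bool-ext {true}  {b}     f g = sym (f refl)
  bool-ext {false} {true}  f g = g refl
  bool-ext {false} {false} f g = refl

  ∧-true : ∀ {a b} → a ∧ b ≡ true → a ≡ true × b ≡ true
  ∧-true {true} eq = refl , eq

  ∧-intro : ∀ {a b} → a ≡ true → b ≡ true → a ∧ b ≡ true
  ∧-intro refl refl = refl

  not-true : ∀ {a} → not a ≡ true → a ≡ false
  not-true {false} _ = refl

  true≢false : ∀ {a} → a ≡ true → ¬ (a ≡ false)
  true≢false refl ()

  ==-true : ∀ {k} {i j : Fin k} → (i == j) ≡ true → i ≡ j
  ==-true {i = i} {j} eq with i Fin.≟ j
  ... | yes p = p

  ==-refl : ∀ {k} (i : Fin k) → (i == i) ≡ true
  ==-refl i with i Fin.≟ i
  ... | yes _ = refl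
  ... | no q = ⊥-elim (q refl)

  ==-complete : ∀ {k} {i j : Fin k} → i ≡ j → (i == j) ≡ true
  ==-complete {i = i} refl = ==-refl i

  ==-false : ∀ {k} {i j : Fin k} → ¬ (i ≡ j) → (i == j) ≡ false
  ==-false {i = i} {j} i≢j with i Fin.≟ j
  ... | yes p = ⊥-elim (i≢j p)
  ... | no _ = refl

  ==-false⁻¹ : ∀ {k} {i j : Fin k} → (i == j) ≡ false → ¬ (i ≡ j)
  ==-false⁻¹ {i = i} eq refl = true≢false (==-refl i) eq

  ==-suc : ∀ {k} (i j : Fin k) → (suc i == suc j) ≡ (i == j)
  ==-suc i j = bool-ext (λ e → ==-complete (Fin.suc-injective (==-true e))) (λ e → ==-complete (cong suc (==-true e)))

  colourings : ∀ {κ} m → List (Vec (Fin κ) m)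
  colourings {κ} zero    = [] ∷ []
  colourings {κ} (suc m) = concatMap (λ c → map (c ∷_) (colourings m)) (allFin κ)

  eqV : ∀ {κ m} → Vec (Fin κ) m → Vec (Fin κ) m → Bool
  eqV []      []      = true
  eqV (c ∷ χ) (d ∷ ψ) = (c == d) ∧ eqV χ ψ

  eqV-sound : ∀ {κ m} (χ ψ : Vec (Fin κ) m) → eqV χ ψ ≡ true → χ ≡ ψ
  eqV-sound []      []      _  = refl
  eqV-sound (c ∷ χ) (d ∷ ψ) eq = cong₂ _∷_ (==-true (proj₁ (∧-true eq))) (eqV-sound χ ψ (proj₂ (∧-true {c == d} eq)))

  eqV-refl : ∀ {κ m} (χ : Vec (Fin κ) m) → eqV χ χ ≡ true
  eqV-refl []      = refl
  eqV-refl (c ∷ χ) = ∧-intro (==-refl c) (eqV-refl χ)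

  -- Generic in the monoid, since colourings are counted in `ℕ` and expectations are computed in
  -- `ℚ`.
  module Summation {A : Set} (_⊕_ : A → A → A) (𝟘 : A)
                   (isCommutativeMonoid : IsCommutativeMonoid _≡_ _⊕_ 𝟘) where
    open IsCommutativeMonoid isCommutativeMonoid using (assoc; comm; identityˡ; identityʳ)

    ∑ : {X : Set} → List X → (X → A) → A
    ∑ []       f = 𝟘
    ∑ (x ∷ xs) f = f x ⊕ ∑ xs f

    when : Bool → A → A
    when b a = if b then a else 𝟘

    interchange : ∀ a b c d → (a ⊕ b) ⊕ (c ⊕ d) ≡ (a ⊕ c) ⊕ (b ⊕ d)
    interchange a b c d = begin
      (a ⊕ b) ⊕ (c ⊕ d) ≡⟨ assoc a b (c ⊕ d) ⟩
      a ⊕ (b ⊕ (c ⊕ d)) ≡⟨ cong (a ⊕_) (sym (assoc b c d)) ⟩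
      a ⊕ ((b ⊕ c) ⊕ d) ≡⟨ cong (λ z → a ⊕ (z ⊕ d)) (comm b c) ⟩
      a ⊕ ((c ⊕ b) ⊕ d) ≡⟨ cong (a ⊕_) (assoc c b d) ⟩
      a ⊕ (c ⊕ (b ⊕ d)) ≡⟨ sym (assoc a c (b ⊕ d)) ⟩
      (a ⊕ c) ⊕ (b ⊕ d) ∎
      where open ≡-Reasoning

    module _ {X : Set} where

      ∑-cong : (xs : List X) {f g : X → A} → (∀ x → f x ≡ g x) → ∑ xs f ≡ ∑ xs g
      ∑-cong []       eq = refl
      ∑-cong (x ∷ xs) eq = cong₂ _⊕_ (eq x) (∑-cong xs eq)

      ∑-𝟘 : (xs : List X) → ∑ xs (λ _ → 𝟘) ≡ 𝟘
      ∑-𝟘 []       = refl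
      ∑-𝟘 (x ∷ xs) = trans (identityˡ _) (∑-𝟘 xs)

      ∑-⊕ : (xs : List X) (f g : X → A) → ∑ xs (λ x → f x ⊕ g x) ≡ ∑ xs f ⊕ ∑ xs g
      ∑-⊕ []       f g = sym (identityˡ 𝟘)
      ∑-⊕ (x ∷ xs) f g = trans (cong ((f x ⊕ g x) ⊕_) (∑-⊕ xs f g)) (interchange (f x) (g x) (∑ xs f) (∑ xs g))

      ∑-++ : (xs ys : List X) (f : X → A) → ∑ (xs ++ ys) f ≡ ∑ xs f ⊕ ∑ ys f
      ∑-++ []       ys f = sym (identityˡ _)
      ∑-++ (x ∷ xs) ys f = trans (cong (f x ⊕_) (∑-++ xs ys f)) (sym (assoc _ _ _))

      ∑-when : (b : Bool) (xs : List X) (f : X → A) → when b (∑ xs f) ≡ ∑ xs (λ x → when b (f x))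
      ∑-when true  xs f = refl
      ∑-when false xs f = sym (∑-𝟘 xs)

      ∑-filterᵇ : (p : X → Bool) (xs : List X) (f : X → A) → ∑ (filterᵇ p xs) f ≡ ∑ xs (λ x → when (p x) (f x))
      ∑-filterᵇ p []       f = refl
      ∑-filterᵇ p (x ∷ xs) f with p x
      ... | true  = cong (f x ⊕_) (∑-filterᵇ p xs f)
      ... | false = trans (∑-filterᵇ p xs f) (sym (identityˡ _))

    ∑-map : {X Y : Set} (h : X → Y) (xs : List X) (f : Y → A) → ∑ (map h xs) f ≡ ∑ xs (f ∘ h)
    ∑-map h []       f = refl
    ∑-map h (x ∷ xs) f = cong (f (h x) ⊕_) (∑-map h xs f)

    ∑-concatMap : {X Y : Set} (h : X → List Y) (xs : List X) (f : Y → A) →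
                  ∑ (concatMap h xs) f ≡ ∑ xs (λ x → ∑ (h x) f)
    ∑-concatMap h []       f = refl
    ∑-concatMap h (x ∷ xs) f = trans (∑-++ (h x) _ f) (cong (∑ (h x) f ⊕_) (∑-concatMap h xs f))

    ∑-swap : {X Y : Set} (xs : List X) (ys : List Y) (f : X → Y → A) →
             ∑ xs (λ x → ∑ ys (f x)) ≡ ∑ ys (λ y → ∑ xs (λ x → f x y))
    ∑-swap []       ys f = sym (∑-𝟘 ys)
    ∑-swap (x ∷ xs) ys f = trans (cong (∑ ys (f x) ⊕_) (∑-swap xs ys f)) (sym (∑-⊕ ys (f x) _))

    ∑-allFin-suc : ∀ k (f : Fin (suc k) → A) → ∑ (allFin (suc k)) f ≡ f zero ⊕ ∑ (allFin k) (f ∘ suc)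
    ∑-allFin-suc k f = cong (f zero ⊕_)
      (trans (cong (λ l → ∑ l f) (sym (map-tabulate {n = k} id suc))) (∑-map suc (allFin k) f))

    ∑-colourings-suc : ∀ {κ} m (f : Vec (Fin κ) (suc m) → A) →
                       ∑ (colourings (suc m)) f ≡ ∑ (allFin κ) (λ c → ∑ (colourings m) (λ χ → f (c ∷ χ)))
    ∑-colourings-suc {κ} m f = trans (∑-concatMap _ (allFin κ) f) (∑-cong (allFin κ) λ c → ∑-map (c ∷_) (colourings m) f)

    when-∧ : ∀ a b x → when (a ∧ b) x ≡ when a (when b x)
    when-∧ true  b x = refl
    when-∧ false b x = refl

    when-cong : ∀ b {x y} → (b ≡ true → x ≡ y) → when b x ≡ when b y
    when-cong true  eq = eq refl
    when-cong false eq = refl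

    when-⊕ : ∀ b x y → when b (x ⊕ y) ≡ when b x ⊕ when b y
    when-⊕ true  x y = refl
    when-⊕ false x y = sym (identityˡ 𝟘)

    ∑-δ : ∀ {k} (i : Fin k) (f : Fin k → A) → ∑ (allFin k) (λ j → when (i == j) (f j)) ≡ f i
    ∑-δ {suc k} zero f = trans (∑-allFin-suc k _)
      (trans (cong (f zero ⊕_) (∑-𝟘 (allFin k))) (identityʳ _))
    ∑-δ {suc k} (suc i) f = trans (∑-allFin-suc k _)
      (trans (identityˡ _)
        (trans (∑-cong (allFin k) (λ j → cong (λ b → when b (f (suc j))) (==-suc i j))) (∑-δ i (f ∘ suc))))

    -- `colourings` lists every vector exactly once; `reindex` uses this fact in the form of a delta
    -- function.
    ∑-δV : ∀ {κ m} (χ : Vec (Fin κ) m) (f : Vec (Fin κ) m → A) →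
           ∑ (colourings m) (λ ψ → when (eqV χ ψ) (f ψ)) ≡ f χ
    ∑-δV []      f = identityʳ _
    ∑-δV {κ} {suc m} (c ∷ χ) f = begin
      ∑ (colourings (suc m)) (λ ψ → when (eqV (c ∷ χ) ψ) (f ψ))
        ≡⟨ ∑-colourings-suc m (λ ψ → when (eqV (c ∷ χ) ψ) (f ψ)) ⟩
      ∑ (allFin κ) (λ d → ∑ (colourings m) (λ ψ → when ((c == d) ∧ eqV χ ψ) (f (d ∷ ψ))))
        ≡⟨ ∑-cong (allFin κ) (λ d → trans (∑-cong (colourings m) λ ψ → when-∧ (c == d) _ _)
             (sym (∑-when (c == d) (colourings m) _))) ⟩
      ∑ (allFin κ) (λ d → when (c == d) (∑ (colourings m) (λ ψ → when (eqV χ ψ) (f (d ∷ ψ)))))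
        ≡⟨ ∑-δ c _ ⟩
      ∑ (colourings m) (λ ψ → when (eqV χ ψ) (f (c ∷ ψ)))
        ≡⟨ ∑-δV χ (λ ψ → f (c ∷ ψ)) ⟩
      f (c ∷ χ) ∎
      where open ≡-Reasoning

    -- Both sides are the sum of f ψ over the pairs (χ , ψ) with P χ, Q ψ and ψ = T χ.
    reindex : ∀ {κ m} (T T⁻¹ : Vec (Fin κ) m → Vec (Fin κ) m) (P Q : Vec (Fin κ) m → Bool) →
              (∀ χ → P χ ≡ true → Q (T χ) ≡ true × T⁻¹ (T χ) ≡ χ) →
              (∀ ψ → Q ψ ≡ true → P (T⁻¹ ψ) ≡ true × T (T⁻¹ ψ) ≡ ψ) →
              (f : Vec (Fin κ) m → A) →
              ∑ (colourings m) (λ χ → when (P χ) (f (T χ))) ≡ ∑ (colourings m) (λ ψ → when (Q ψ) (f ψ))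
    reindex {κ} {m} T T⁻¹ P Q there back f = begin
      ∑ cs (λ χ → when (P χ) (f (T χ)))
        ≡⟨ ∑-cong cs (λ χ → trans (cong (when (P χ)) (sym (∑-δV (T χ) f))) (∑-when (P χ) cs _)) ⟩
      ∑ cs (λ χ → ∑ cs (λ ψ → when (P χ) (when (eqV (T χ) ψ) (f ψ))))
        ≡⟨ ∑-swap cs cs _ ⟩
      ∑ cs (λ ψ → ∑ cs (λ χ → when (P χ) (when (eqV (T χ) ψ) (f ψ))))
        ≡⟨ ∑-cong cs (λ ψ → trans (∑-cong cs (λ χ → pointwise χ ψ)) (sym (∑-when (Q ψ) cs _))) ⟩
      ∑ cs (λ ψ → when (Q ψ) (∑ cs (λ χ → when (eqV (T⁻¹ ψ) χ) (f ψ))))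
        ≡⟨ ∑-cong cs (λ ψ → cong (when (Q ψ)) (∑-δV (T⁻¹ ψ) (λ _ → f ψ))) ⟩
      ∑ cs (λ ψ → when (Q ψ) (f ψ)) ∎
      where
      open ≡-Reasoning
      cs : List (Vec (Fin κ) m)
      cs = colourings m
      iff : ∀ χ ψ → P χ ∧ eqV (T χ) ψ ≡ Q ψ ∧ eqV (T⁻¹ ψ) χ
      iff χ ψ = bool-ext
        (λ e → let (p , q) = ∧-true {P χ} e ; (r , s) = there χ p ; Tχ≡ψ = eqV-sound _ _ q in
               ∧-intro (subst (λ z → Q z ≡ true) Tχ≡ψ r)
                 (subst (λ z → eqV (T⁻¹ z) χ ≡ true) Tχ≡ψ (subst (λ z → eqV z χ ≡ true) (sym s) (eqV-refl χ))))
        (λ e → let (p , q) = ∧-true {Q ψ} e ; (r , s) = back ψ p ; eq = eqV-sound _ _ q in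
               ∧-intro (subst (λ z → P z ≡ true) eq r)
                 (subst (λ z → eqV (T z) ψ ≡ true) eq (subst (λ z → eqV z ψ ≡ true) (sym s) (eqV-refl ψ))))
      pointwise : ∀ χ ψ → when (P χ) (when (eqV (T χ) ψ) (f ψ)) ≡ when (Q ψ) (when (eqV (T⁻¹ ψ) χ) (f ψ))
      pointwise χ ψ = trans (sym (when-∧ (P χ) _ _)) (trans (cong (λ b → when b (f ψ)) (iff χ ψ)) (when-∧ (Q ψ) _ _))

-- Expectations as finite rational sums

module Expectation where

  open FiniteSums
  open import Data.Nat as ℕ using (zero; suc; z≤n)
  open import Data.Nat.Properties
  open import Data.Integer as ℤ using (+_)
  import Data.Integer.Properties as ℤ
  open import Data.Bool using (Bool; true; false)
  open import Data.Fin using (zero; suc)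
  open import Data.List using ([]; _∷_; allFin; lookup; filterᵇ)
  open import Data.Maybe using (Maybe; just)
  open import Data.Rational as ℚ using (ℚ; 0ℚ; 1ℚ; _/_)
  import Data.Rational.Properties as ℚ
  import Data.Rational.Unnormalised as ℚᵘ
  import Data.Rational.Unnormalised.Properties as ℚᵘ
  open import Function using (_∘_)
  open import Relation.Binary.PropositionalEquality

  module ℚ∑ = Summation ℚ._+_ 0ℚ ℚ.+-0-isCommutativeMonoid
  open ℚ∑ public using () renaming (∑ to ∑ℚ; when to whenℚ)
  open Summation ℕ._+_ 0 +-0-isCommutativeMonoid public

  ℕtoℚ-≃ : ∀ m → ℚ.toℚᵘ (ℕtoℚ m) ℚᵘ.≃ ℚᵘ.mkℚᵘ (+ m) 0
  ℕtoℚ-≃ m = ℚ.toℚᵘ-fromℚᵘ (ℚᵘ.mkℚᵘ (+ m) 0)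

  ℕtoℚ-+ : ∀ a b → ℕtoℚ (a ℕ.+ b) ≡ ℕtoℚ a ℚ.+ ℕtoℚ b
  ℕtoℚ-+ a b = ℚ.toℚᵘ-injective (begin
    ℚ.toℚᵘ (ℕtoℚ (a ℕ.+ b))                       ≈⟨ ℕtoℚ-≃ (a ℕ.+ b) ⟩
    ℚᵘ.mkℚᵘ (+ (a ℕ.+ b)) 0                       ≈⟨ ℚᵘ.*≡* (cong (λ z → z ℤ.* + 1) (cong₂ ℤ._+_ (sym (ℤ.*-identityʳ (+ a))) (sym (ℤ.*-identityʳ (+ b))))) ⟩
    ℚᵘ.mkℚᵘ (+ a) 0 ℚᵘ.+ ℚᵘ.mkℚᵘ (+ b) 0          ≈⟨ ℚᵘ.+-cong (ℚᵘ.≃-sym (ℕtoℚ-≃ a)) (ℚᵘ.≃-sym (ℕtoℚ-≃ b)) ⟩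
    ℚ.toℚᵘ (ℕtoℚ a) ℚᵘ.+ ℚ.toℚᵘ (ℕtoℚ b)          ≈⟨ ℚᵘ.≃-sym (ℚ.toℚᵘ-homo-+ (ℕtoℚ a) (ℕtoℚ b)) ⟩
    ℚ.toℚᵘ (ℕtoℚ a ℚ.+ ℕtoℚ b) ∎)
    where open import Relation.Binary.Reasoning.Setoid ℚᵘ.≃-setoid

  ℕtoℚ-* : ∀ a b → ℕtoℚ (a ℕ.* b) ≡ ℕtoℚ a ℚ.* ℕtoℚ b
  ℕtoℚ-* a b = ℚ.toℚᵘ-injective (begin
    ℚ.toℚᵘ (ℕtoℚ (a ℕ.* b))                       ≈⟨ ℕtoℚ-≃ (a ℕ.* b) ⟩
    ℚᵘ.mkℚᵘ (+ (a ℕ.* b)) 0                       ≈⟨ ℚᵘ.*≡* (cong (λ z → z ℤ.* + 1) (ℤ.pos-* a b)) ⟩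
    ℚᵘ.mkℚᵘ (+ a) 0 ℚᵘ.* ℚᵘ.mkℚᵘ (+ b) 0          ≈⟨ ℚᵘ.*-cong (ℚᵘ.≃-sym (ℕtoℚ-≃ a)) (ℚᵘ.≃-sym (ℕtoℚ-≃ b)) ⟩
    ℚ.toℚᵘ (ℕtoℚ a) ℚᵘ.* ℚ.toℚᵘ (ℕtoℚ b)          ≈⟨ ℚᵘ.≃-sym (ℚ.toℚᵘ-homo-* (ℕtoℚ a) (ℕtoℚ b)) ⟩
    ℚ.toℚᵘ (ℕtoℚ a ℚ.* ℕtoℚ b) ∎)
    where open import Relation.Binary.Reasoning.Setoid ℚᵘ.≃-setoid

  1/suc-inverse : ∀ k → ℕtoℚ (suc k) ℚ.* ((+ 1) / suc k) ≡ 1ℚ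
  1/suc-inverse k = ℚ.toℚᵘ-injective (begin
    ℚ.toℚᵘ (ℕtoℚ (suc k) ℚ.* ((+ 1) / suc k))     ≈⟨ ℚ.toℚᵘ-homo-* (ℕtoℚ (suc k)) ((+ 1) / suc k) ⟩
    ℚ.toℚᵘ (ℕtoℚ (suc k)) ℚᵘ.* ℚ.toℚᵘ ((+ 1) / suc k) ≈⟨ ℚᵘ.*-cong (ℕtoℚ-≃ (suc k)) (ℚ.toℚᵘ-fromℚᵘ (ℚᵘ.mkℚᵘ (+ 1) k)) ⟩
    ℚᵘ.mkℚᵘ (+ suc k) 0 ℚᵘ.* ℚᵘ.mkℚᵘ (+ 1) k      ≈⟨ ℚᵘ.*≡* (cong (λ z → + suc z) (trans (*-identityʳ _) (trans (*-identityʳ k) (sym (trans (+-identityʳ _) (+-identityʳ k)))))) ⟩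
    ℚᵘ.1ℚᵘ ∎)
    where open import Relation.Binary.Reasoning.Setoid ℚᵘ.≃-setoid

  -- Abstract, so that the gcd computation inside ℕtoℚ never unfolds.
  abstract
    toℚ : ℕ → ℚ
    toℚ = ℕtoℚ

    toℚ-def : ∀ m → toℚ m ≡ ℕtoℚ m
    toℚ-def m = refl

    toℚ-+ : ∀ a b → toℚ (a ℕ.+ b) ≡ toℚ a ℚ.+ toℚ b
    toℚ-+ = ℕtoℚ-+

    toℚ-* : ∀ a b → toℚ (a ℕ.* b) ≡ toℚ a ℚ.* toℚ b
    toℚ-* = ℕtoℚ-*

    toℚ-0 : toℚ 0 ≡ 0ℚ
    toℚ-0 = refl

    toℚ-1 : toℚ 1 ≡ 1ℚ
    toℚ-1 = refl

    toℚ-nonNeg : ∀ m → ℚ.NonNegative (toℚ m)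
    toℚ-nonNeg m = ℚ.normalize-nonNeg m 1

    toℚ-pos : ∀ m → .{{ℕ.NonZero m}} → ℚ.Positive (toℚ m)
    toℚ-pos m = ℚ.normalize-pos m 1

    toℚ-inverse : ∀ k → toℚ (suc k) ℚ.* ((+ 1) / suc k) ≡ 1ℚ
    toℚ-inverse = 1/suc-inverse

  toℚ-mono : ∀ {a b} → a ℕ.≤ b → toℚ a ℚ.≤ toℚ b
  toℚ-mono {a} {b} a≤b = subst (toℚ a ℚ.≤_) (trans (sym (toℚ-+ a (b ℕ.∸ a))) (cong toℚ (m+[n∸m]≡n a≤b)))
    (subst (ℚ._≤ toℚ a ℚ.+ toℚ (b ℕ.∸ a)) (ℚ.+-identityʳ (toℚ a))
      (ℚ.+-monoʳ-≤ (toℚ a) (ℚ.nonNegative⁻¹ (toℚ (b ℕ.∸ a)) {{toℚ-nonNeg (b ℕ.∸ a)}})))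

  toℚ-when : ∀ b a → toℚ (when b a) ≡ whenℚ b (toℚ a)
  toℚ-when true  a = refl
  toℚ-when false a = toℚ-0

  when-*ℚ : ∀ b (a x : ℚ) → a ℚ.* whenℚ b x ≡ whenℚ b (a ℚ.* x)
  when-*ℚ true  a x = refl
  when-*ℚ false a x = ℚ.*-zeroʳ a

  when-* : ∀ b (a x : ℕ) → a ℕ.* when b x ≡ when b (a ℕ.* x)
  when-* true  a x = refl
  when-* false a x = *-zeroʳ a

  module _ {X : Set} where

    toℚ-∑ : (xs : List X) (f : X → ℕ) → toℚ (∑ xs f) ≡ ∑ℚ xs (toℚ ∘ f)
    toℚ-∑ []       f = toℚ-0
    toℚ-∑ (x ∷ xs) f = trans (toℚ-+ (f x) (∑ xs f)) (cong (toℚ (f x) ℚ.+_) (toℚ-∑ xs f))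

    ∑ℚ-*ˡ : (a : ℚ) (xs : List X) (f : X → ℚ) → a ℚ.* ∑ℚ xs f ≡ ∑ℚ xs (λ x → a ℚ.* f x)
    ∑ℚ-*ˡ a []       f = ℚ.*-zeroʳ a
    ∑ℚ-*ˡ a (x ∷ xs) f = trans (ℚ.*-distribˡ-+ a (f x) _) (cong (a ℚ.* f x ℚ.+_) (∑ℚ-*ˡ a xs f))

    ∑-*ˡ : (a : ℕ) (xs : List X) (f : X → ℕ) → a ℕ.* ∑ xs f ≡ ∑ xs (λ x → a ℕ.* f x)
    ∑-*ˡ a []       f = *-zeroʳ a
    ∑-*ˡ a (x ∷ xs) f = trans (*-distribˡ-+ a (f x) _) (cong (a ℕ.* f x ℕ.+_) (∑-*ˡ a xs f))

    ∑-mono : (xs : List X) {f g : X → ℕ} → (∀ x → f x ℕ.≤ g x) → ∑ xs f ℕ.≤ ∑ xs g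
    ∑-mono []       le = z≤n
    ∑-mono (x ∷ xs) le = +-mono-≤ (le x) (∑-mono xs le)

  ∑-1-allFin : ∀ k → ∑ (allFin k) (λ _ → 1) ≡ k
  ∑-1-allFin zero    = refl
  ∑-1-allFin (suc k) = trans (∑-allFin-suc k (λ _ → 1)) (cong suc (∑-1-allFin k))

  ∑-single : ∀ {k} (i : Fin k) (f : Fin k → ℕ) → f i ℕ.≤ ∑ (allFin k) f
  ∑-single {suc k} zero    f rewrite ∑-allFin-suc k f = m≤m+n _ _
  ∑-single {suc k} (suc i) f rewrite ∑-allFin-suc k f = ≤-trans (∑-single i (f ∘ suc)) (m≤n+m _ _)

  ∑-length : {X : Set} (xs : List X) → ∑ xs (λ _ → 1) ≡ length xs
  ∑-length []       = refl
  ∑-length (x ∷ xs) = cong suc (∑-length xs)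

  length-filterᵇ-allFin : ∀ {k} (p : Fin k → Bool) → length (filterᵇ p (allFin k)) ≡ ∑ (allFin k) (λ i → when (p i) 1)
  length-filterᵇ-allFin {k} p = trans (sym (∑-length (filterᵇ p (allFin k)))) (∑-filterᵇ p (allFin k) _)

  countᵇ-∑ : {X : Set} (p : X → Bool) (xs : List X) → countᵇ p xs ≡ ∑ xs (λ x → when (p x) 1)
  countᵇ-∑ p []       = refl
  countᵇ-∑ p (x ∷ xs) with p x
  ... | true  = cong suc (countᵇ-∑ p xs)
  ... | false = countᵇ-∑ p xs

  sumFin-lookup : {X : Set} (xs : List X) (f : X → ℚ) → sumFin (length xs) (f ∘ lookup xs) ≡ ∑ℚ xs f
  sumFin-lookup []       f = refl
  sumFin-lookup (x ∷ xs) f = cong (f x ℚ.+_) (sumFin-lookup xs f)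

  sumFin-cong : ∀ k {f g : Fin k → ℚ} → (∀ i → f i ≡ g i) → sumFin k f ≡ sumFin k g
  sumFin-cong zero    eq = refl
  sumFin-cong (suc k) eq = cong₂ ℚ._+_ (eq zero) (sumFin-cong k (eq ∘ suc))

  sumFin-+ : ∀ k (f g : Fin k → ℚ) → sumFin k (λ i → f i ℚ.+ g i) ≡ sumFin k f ℚ.+ sumFin k g
  sumFin-+ zero    f g = refl
  sumFin-+ (suc k) f g = trans (cong (f zero ℚ.+ g zero ℚ.+_) (sumFin-+ k (f ∘ suc) (g ∘ suc)))
    (ℚ∑.interchange (f zero) (g zero) (sumFin k (f ∘ suc)) (sumFin k (g ∘ suc)))

  sumFin-const : ∀ k (a : ℚ) → sumFin k (λ _ → a) ≡ toℚ k ℚ.* a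
  sumFin-const zero    a = sym (trans (cong (ℚ._* a) toℚ-0) (ℚ.*-zeroˡ a))
  sumFin-const (suc k) a = begin
    a ℚ.+ sumFin k (λ _ → a)          ≡⟨ cong₂ ℚ._+_ (sym (ℚ.*-identityˡ a)) (sumFin-const k a) ⟩
    1ℚ ℚ.* a ℚ.+ toℚ k ℚ.* a         ≡⟨ sym (ℚ.*-distribʳ-+ a 1ℚ (toℚ k)) ⟩
    (1ℚ ℚ.+ toℚ k) ℚ.* a             ≡⟨ cong (ℚ._* a) (sym (trans (toℚ-+ 1 k) (cong (ℚ._+ toℚ k) toℚ-1))) ⟩
    toℚ (suc k) ℚ.* a ∎
    where open ≡-Reasoning

  sumFin-nonNeg : ∀ k (f : Fin k → ℚ) → (∀ i → 0ℚ ℚ.≤ f i) → 0ℚ ℚ.≤ sumFin k f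
  sumFin-nonNeg zero    f le = ℚ.≤-refl
  sumFin-nonNeg (suc k) f le = ℚ.+-mono-≤ (le zero) (sumFin-nonNeg k (f ∘ suc) (le ∘ suc))

  𝔼-bind : {A B : Set} (m : Rand A) (f : A → Rand B) (h : B → ℚ) → 𝔼 (m >>= f) h ≡ 𝔼 m (λ a → 𝔼 (f a) h)
  𝔼-bind (ret a)    f h = refl
  𝔼-bind (pick k g) f h = cong ((+ 1) / suc k ℚ.*_) (sumFin-cong (suc k) (λ i → 𝔼-bind (g i) f h))

  module _ {A : Set} where

    𝔼-cong : (m : Rand A) {f g : A → ℚ} → (∀ a → f a ≡ g a) → 𝔼 m f ≡ 𝔼 m g
    𝔼-cong (ret a)    eq = eq a
    𝔼-cong (pick k g) eq = cong ((+ 1) / suc k ℚ.*_) (sumFin-cong (suc k) (λ i → 𝔼-cong (g i) eq))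

    𝔼-+ : (m : Rand A) (f g : A → ℚ) → 𝔼 m (λ a → f a ℚ.+ g a) ≡ 𝔼 m f ℚ.+ 𝔼 m g
    𝔼-+ (ret a)    f g = refl
    𝔼-+ (pick k m) f g = trans (cong ((+ 1) / suc k ℚ.*_)
        (trans (sumFin-cong (suc k) (λ i → 𝔼-+ (m i) f g)) (sumFin-+ (suc k) (λ i → 𝔼 (m i) f) (λ i → 𝔼 (m i) g))))
      (ℚ.*-distribˡ-+ ((+ 1) / suc k) _ _)

    𝔼-const : (m : Rand A) (a : ℚ) → 𝔼 m (λ _ → a) ≡ a
    𝔼-const (ret x)    a = refl
    𝔼-const (pick k m) a = begin
      r ℚ.* sumFin (suc k) (λ i → 𝔼 (m i) (λ _ → a)) ≡⟨ cong (r ℚ.*_) (trans (sumFin-cong (suc k) (λ i → 𝔼-const (m i) a)) (sumFin-const (suc k) a)) ⟩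
      r ℚ.* (toℚ (suc k) ℚ.* a)                     ≡⟨ sym (ℚ.*-assoc r (toℚ (suc k)) a) ⟩
      (r ℚ.* toℚ (suc k)) ℚ.* a                     ≡⟨ cong (ℚ._* a) (trans (ℚ.*-comm r (toℚ (suc k))) (toℚ-inverse k)) ⟩
      1ℚ ℚ.* a                                       ≡⟨ ℚ.*-identityˡ a ⟩
      a ∎
      where
      open ≡-Reasoning
      r : ℚ
      r = (+ 1) / suc k

    𝔼-nonNeg : (m : Rand A) (f : A → ℚ) → (∀ a → 0ℚ ℚ.≤ f a) → 0ℚ ℚ.≤ 𝔼 m f
    𝔼-nonNeg (ret a)    f le = le a
    𝔼-nonNeg (pick k m) f le = subst (ℚ._≤ 𝔼 (pick k m) f) (ℚ.*-zeroʳ ((+ 1) / suc k))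
      (ℚ.*-monoˡ-≤-nonNeg ((+ 1) / suc k) {{ℚ.normalize-nonNeg 1 (suc k)}} {0ℚ} {sumFin (suc k) (λ i → 𝔼 (m i) f)}
        (sumFin-nonNeg (suc k) _ (λ i → 𝔼-nonNeg (m i) f le)))

  -- Multiplying by the number of choices removes the weight `1 / N`, so that later identities
  -- contain no division. `0 < N` rules out the branch `nothing`.
  𝔼-uniformFrom : {C B : Set} (xs : List C) (f : Maybe C → Rand B) (h : B → ℚ) → ∀ {N} → length xs ≡ N → 0 ℕ.< N →
                  toℚ N ℚ.* 𝔼 (uniformFrom xs >>= f) h ≡ ∑ℚ xs (λ x → 𝔼 (f (just x)) h)
  𝔼-uniformFrom []       f h refl ()
  𝔼-uniformFrom (x ∷ xs) f h refl _ = begin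
    toℚ (suc (length xs)) ℚ.* (r ℚ.* s) ≡⟨ sym (ℚ.*-assoc (toℚ (suc (length xs))) r s) ⟩
    (toℚ (suc (length xs)) ℚ.* r) ℚ.* s ≡⟨ cong (ℚ._* s) (toℚ-inverse (length xs)) ⟩
    1ℚ ℚ.* s                             ≡⟨ ℚ.*-identityˡ s ⟩
    s                                    ≡⟨ sumFin-lookup (x ∷ xs) (λ x → 𝔼 (f (just x)) h) ⟩
    ∑ℚ (x ∷ xs) (λ x → 𝔼 (f (just x)) h) ∎
    where
    open ≡-Reasoning
    r s : ℚ
    r = (+ 1) / suc (length xs)
    s = sumFin (suc (length xs)) (λ i → 𝔼 (f (just (lookup (x ∷ xs) i))) h)

-- The insertion process on edge vectors

module Process (n κ Δ : ℕ) where

  open FiniteSums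
  open Expectation
  open import Data.Nat as ℕ using (zero; suc; _<_; z≤n; s≤s; _+_; _*_; _^_)
  open import Data.Nat.Properties
  open import Data.Bool using (Bool; true; false; _∨_; _∧_; not; if_then_else_)
  open import Data.Bool.ListAction using (any)
  open import Data.Bool.Properties using (∨-zeroʳ; ∨-identityʳ; ∧-zeroʳ)
  open import Data.Fin using (zero; suc; toℕ)
  import Data.Fin as Fin
  import Data.Fin.Properties as Fin
  open import Data.Fin.Permutation.Components using (transpose; transpose-inverse)
  open import Data.List using ([]; _∷_; _++_; [_]; allFin; zip)
  open import Data.List.Properties using (++-assoc; ++-identityʳ)
  open import Data.List.Relation.Unary.Any using (Any; here; there)
  import Data.List.Relation.Unary.Any.Properties as Any
  open import Data.Vec using (Vec; []; _∷_; lookup; tabulate; _[_]≔_)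
  open import Data.Vec.Properties using (lookup∘tabulate; tabulate∘lookup; tabulate-cong; lookup∘update; lookup∘update′)
  open import Data.Maybe using (just; nothing)
  open import Data.Product using (∃; proj₁; proj₂)
  import Data.Sum as Sum
  open import Data.Sum using (_⊎_; inj₁; inj₂)
  open import Data.Empty using (⊥; ⊥-elim)
  open import Data.Rational as ℚ using (ℚ; 0ℚ; 1ℚ)
  import Data.Rational.Properties as ℚ
  open import Function using (_∘_)
  open import Relation.Nullary using (¬_; Dec; yes; no)
  open import Relation.Nullary.Decidable using (⌊_⌋)
  open import Relation.Binary.PropositionalEquality hiding ([_])
  open DistMaint n κ Δ public

  -- States as edge vectors with a colouring

  Edges Colouring : ℕ → Set
  Edges m     = Vec (Fin n × Fin n) m
  Colouring m = Vec (Fin κ) m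

  -- Vectors list the newest edge first, whereas states list it last.
  mk : ∀ {m} → Edges m → Colouring m → St
  mk []             []      = []
  mk ((a , b) ∷ es) (c ∷ χ) = mk es χ ++ [ (a , b , c) ]

  at : ∀ {m} → Edges m → Colouring m → Fin m → CEdge n κ
  at es χ i = proj₁ (lookup es i) , proj₂ (lookup es i) , lookup χ i

  Joins : ∀ {m} → Edges m → Fin m → Fin n → Fin n → Set
  Joins es i x y = lookup es i ≡ (x , y) ⊎ lookup es i ≡ (y , x)

  Inc : ∀ {m} → Edges m → Fin m → Fin n → Set
  Inc es i x = ∃ λ y → Joins es i x y

  incB : ∀ {m} → Edges m → Fin m → Fin n → Bool
  incB es i x = (proj₁ (lookup es i) == x) ∨ (proj₂ (lookup es i) == x)

  used : ∀ {m} → Edges m → Colouring m → Fin n → Fin κ → Bool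
  used es χ x c = usedAt (mk es χ) x c

  degV : ∀ {m} → Edges m → Fin n → ℕ
  degV {m} es x = ∑ (allFin m) (λ i → when (incB es i x) 1)

  ∑-mk : ∀ {m} (es : Edges m) (χ : Colouring m) (F : CEdge n κ → ℕ) →
         ∑ (mk es χ) F ≡ ∑ (allFin m) (λ i → F (at es χ i))
  ∑-mk []             []      F = refl
  ∑-mk {suc m} ((a , b) ∷ es) (c ∷ χ) F = begin
    ∑ (mk es χ ++ [ (a , b , c) ]) F                            ≡⟨ ∑-++ (mk es χ) _ F ⟩
    ∑ (mk es χ) F ℕ.+ (F (a , b , c) ℕ.+ 0)                     ≡⟨ cong₂ ℕ._+_ (∑-mk es χ F) (+-identityʳ _) ⟩
    ∑ (allFin m) (λ i → F (at es χ i)) ℕ.+ F (a , b , c)        ≡⟨ +-comm _ (F (a , b , c)) ⟩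
    F (a , b , c) ℕ.+ ∑ (allFin m) (λ i → F (at es χ i))        ≡⟨ sym (∑-allFin-suc m (λ i → F (at ((a , b) ∷ es) (c ∷ χ) i))) ⟩
    ∑ (allFin (suc m)) (λ i → F (at ((a , b) ∷ es) (c ∷ χ) i))  ∎
    where open ≡-Reasoning

  deg-mk : ∀ {m} (es : Edges m) (χ : Colouring m) x → deg (mk es χ) x ≡ degV es x
  deg-mk es χ x = trans (countᵇ-∑ (incident x) (mk es χ)) (∑-mk es χ _)

  Any-mk⁻ : ∀ {m} {P : CEdge n κ → Set} (es : Edges m) (χ : Colouring m) → Any P (mk es χ) → ∃ λ i → P (at es χ i)
  Any-mk⁻ [] [] ()
  Any-mk⁻ ((a , b) ∷ es) (c ∷ χ) p with Any.++⁻ (mk es χ) p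
  ... | inj₁ q        = let (i , r) = Any-mk⁻ es χ q in suc i , r
  ... | inj₂ (here q) = zero , q

  Any-mk⁺ : ∀ {m} {P : CEdge n κ → Set} (es : Edges m) (χ : Colouring m) i → P (at es χ i) → Any P (mk es χ)
  Any-mk⁺ ((a , b) ∷ es) (c ∷ χ) zero    p = Any.++⁺ʳ (mk es χ) (here p)
  Any-mk⁺ ((a , b) ∷ es) (c ∷ χ) (suc i) p = Any.++⁺ˡ (Any-mk⁺ es χ i p)

  any-true⁻ : ∀ {A : Set} (p : A → Bool) xs → any p xs ≡ true → Any (λ x → p x ≡ true) xs
  any-true⁻ p (x ∷ xs) eq with p x in px
  ... | true  = here px
  ... | false = there (any-true⁻ p xs eq)

  any-true⁺ : ∀ {A : Set} (p : A → Bool) {xs} → Any (λ x → p x ≡ true) xs → any p xs ≡ true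
  any-true⁺ p (here px) rewrite px = refl
  any-true⁺ p {x ∷ xs} (there a) rewrite any-true⁺ p a = ∨-zeroʳ (p x)

  ∨-true : ∀ {a b} → a ∨ b ≡ true → a ≡ true ⊎ b ≡ true
  ∨-true {true}  eq = inj₁ refl
  ∨-true {false} eq = inj₂ eq

  ∨-introˡ : ∀ {a b} → a ≡ true → a ∨ b ≡ true
  ∨-introˡ refl = refl

  ∨-introʳ : ∀ a {b} → b ≡ true → a ∨ b ≡ true
  ∨-introʳ a refl = ∨-zeroʳ a

  incB-sound : ∀ {m} (es : Edges m) i x → incB es i x ≡ true → Inc es i x
  incB-sound es i x eq with ∨-true {proj₁ (lookup es i) == x} eq
  ... | inj₁ p = proj₂ (lookup es i) , inj₁ (cong (_, _) (==-true p))
  ... | inj₂ p = proj₁ (lookup es i) , inj₂ (cong (_ ,_) (==-true p))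

  incB-complete : ∀ {m} (es : Edges m) i x → Inc es i x → incB es i x ≡ true
  incB-complete es i x (y , inj₁ p) = ∨-introˡ (==-complete (cong proj₁ p))
  incB-complete es i x (y , inj₂ p) = ∨-introʳ (proj₁ (lookup es i) == x) (==-complete (cong proj₂ p))

  used-sound : ∀ {m} (es : Edges m) (χ : Colouring m) x c → used es χ x c ≡ true → ∃ λ i → Inc es i x × lookup χ i ≡ c
  used-sound es χ x c eq with Any-mk⁻ es χ (any-true⁻ _ (mk es χ) eq)
  ... | i , p = let (q , r) = ∧-true {incB es i x} p in i , incB-sound es i x q , ==-true r

  used-complete : ∀ {m} (es : Edges m) (χ : Colouring m) x c i → Inc es i x → lookup χ i ≡ c → used es χ x c ≡ true
  used-complete es χ x c i p q = any-true⁺ _ (Any-mk⁺ es χ i (∧-intro (incB-complete es i x p) (==-complete q)))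

  any-snoc : ∀ {A : Set} (p : A → Bool) xs y → any p (xs ++ [ y ]) ≡ any p xs ∨ p y
  any-snoc p []       y = ∨-identityʳ (p y)
  any-snoc p (x ∷ xs) y with p x
  ... | true  = refl
  ... | false = any-snoc p xs y

  ChildEdge : (p v : Fin n) → Fin κ → Fin n → CEdge n κ → Set
  ChildEdge p v β w (a , b , c) = ((a ≡ v × b ≡ w) ⊎ (b ≡ v × a ≡ w)) × ¬ (w ≡ p) × c ≡ β

  childTest-sound : ∀ {a v b p : Fin n} {c β : Fin κ} → (a == v) ∧ not (b == p) ∧ (c == β) ≡ true → a ≡ v × ¬ (b ≡ p) × c ≡ β
  childTest-sound {a} {v} {b} {p} eq = let (q , r) = ∧-true {a == v} eq ; (s , t) = ∧-true {not (b == p)} r in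
    ==-true q , ==-false⁻¹ (not-true s) , ==-true t

  childTest-complete : ∀ {a v b p : Fin n} {c β : Fin κ} → a ≡ v → ¬ (b ≡ p) → c ≡ β → (a == v) ∧ not (b == p) ∧ (c == β) ≡ true
  childTest-complete a≡v b≢p c≡β = ∧-intro (==-complete a≡v) (∧-intro (cong not (==-false b≢p)) (==-complete c≡β))

  childWith-just : ∀ st p v β w → childWith st p v β ≡ just w → Any (ChildEdge p v β w) st
  childWith-just ((a , b , c) ∷ st) p v β w eq with (a == v) ∧ not (b == p) ∧ (c == β) in e₁
  ... | true with refl ← eq = let (q , r , s) = childTest-sound {a} e₁ in here (inj₁ (q , refl) , r , s)
  ... | false with (b == v) ∧ not (a == p) ∧ (c == β) in e₂
  ...   | true with refl ← eq = let (q , r , s) = childTest-sound {b} e₂ in here (inj₂ (q , refl) , r , s)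
  ...   | false = there (childWith-just st p v β w eq)

  childWith-nothing : ∀ st p v β w → childWith st p v β ≡ nothing → ¬ Any (ChildEdge p v β w) st
  childWith-nothing ((a , b , c) ∷ st) p v β w eq child with (a == v) ∧ not (b == p) ∧ (c == β) in e₁
  ... | true with () ← eq
  ... | false with (b == v) ∧ not (a == p) ∧ (c == β) in e₂
  ...   | true with () ← eq
  ...   | false with child
  ...     | here (inj₁ (q , refl) , r , s) = true≢false (childTest-complete q r s) e₁
  ...     | here (inj₂ (q , refl) , r , s) = true≢false (childTest-complete q r s) e₂
  ...     | there t = childWith-nothing st p v β w eq t

  -- Lets the search ignore the freshly inserted edge, which stands last in the state.
  childWith-++ : ∀ st tl p v β → childWith tl p v β ≡ nothing → childWith (st ++ tl) p v β ≡ childWith st p v β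
  childWith-++ []                  tl p v β eq = eq
  childWith-++ ((a , b , c) ∷ st) tl p v β eq with (a == v) ∧ not (b == p) ∧ (c == β)
  ... | true = refl
  ... | false with (b == v) ∧ not (a == p) ∧ (c == β)
  ...   | true  = refl
  ...   | false = childWith-++ st tl p v β eq

  EdgeOf : Fin n → Fin n → CEdge n κ → Set
  EdgeOf x y (a , b , _) = (a ≡ x × b ≡ y) ⊎ (a ≡ y × b ≡ x)

  edgeTest-sound : ∀ {a b x y : Fin n} {c : Fin κ} → ((a == x) ∧ (b == y)) ∨ ((a == y) ∧ (b == x)) ≡ true → EdgeOf x y (a , b , c)
  edgeTest-sound {a} {b} {x} {y} eq with ∨-true {(a == x) ∧ (b == y)} eq
  ... | inj₁ p = let (q , r) = ∧-true {a == x} p in inj₁ (==-true q , ==-true r)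
  ... | inj₂ p = let (q , r) = ∧-true {a == y} p in inj₂ (==-true q , ==-true r)

  edgeTest-complete : ∀ {a b x y : Fin n} {c : Fin κ} → EdgeOf x y (a , b , c) → ((a == x) ∧ (b == y)) ∨ ((a == y) ∧ (b == x)) ≡ true
  edgeTest-complete (inj₁ (p , q)) = ∨-introˡ (∧-intro (==-complete p) (==-complete q))
  edgeTest-complete {a} {b} {x} {y} (inj₂ (p , q)) = ∨-introʳ ((a == x) ∧ (b == y)) (∧-intro (==-complete p) (==-complete q))

  recolor-++ˡ : ∀ st tl x y γ → Any (EdgeOf x y) st → recolor (st ++ tl) x y γ ≡ recolor st x y γ ++ tl
  recolor-++ˡ ((a , b , c) ∷ st) tl x y γ e with ((a == x) ∧ (b == y)) ∨ ((a == y) ∧ (b == x)) in eq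
  ... | true = refl
  ... | false with e
  ...   | here h  = ⊥-elim (true≢false (edgeTest-complete {c = c} h) eq)
  ...   | there t = cong ((a , b , c) ∷_) (recolor-++ˡ st tl x y γ t)

  recolor-++ʳ : ∀ st tl x y γ → ¬ Any (EdgeOf x y) st → recolor (st ++ tl) x y γ ≡ st ++ recolor tl x y γ
  recolor-++ʳ []                 tl x y γ e = refl
  recolor-++ʳ ((a , b , c) ∷ st) tl x y γ e with ((a == x) ∧ (b == y)) ∨ ((a == y) ∧ (b == x)) in eq
  ... | true  = ⊥-elim (e (here (edgeTest-sound {c = c} eq)))
  ... | false = cong ((a , b , c) ∷_) (recolor-++ʳ st tl x y γ (e ∘ there))

  EdgeOf⇒Joins : ∀ {m} (es : Edges m) (χ : Colouring m) i x y → EdgeOf x y (at es χ i) → Joins es i x y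
  EdgeOf⇒Joins es χ i x y (inj₁ (p , q)) = inj₁ (cong₂ _,_ p q)
  EdgeOf⇒Joins es χ i x y (inj₂ (p , q)) = inj₂ (cong₂ _,_ p q)

  Joins⇒EdgeOf : ∀ {m} (es : Edges m) (χ : Colouring m) i x y → Joins es i x y → EdgeOf x y (at es χ i)
  Joins⇒EdgeOf es χ i x y (inj₁ p) = inj₁ (cong proj₁ p , cong proj₂ p)
  Joins⇒EdgeOf es χ i x y (inj₂ p) = inj₂ (cong proj₁ p , cong proj₂ p)

  ChildEdge⇒Joins : ∀ {m} (es : Edges m) (χ : Colouring m) i {p v β w} → ChildEdge p v β w (at es χ i) →
                    Joins es i v w × ¬ (w ≡ p) × lookup χ i ≡ β
  ChildEdge⇒Joins es χ i (inj₁ (p , q) , r) = inj₁ (cong₂ _,_ p q) , r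
  ChildEdge⇒Joins es χ i (inj₂ (p , q) , r) = inj₂ (cong₂ _,_ q p) , r

  Joins⇒ChildEdge : ∀ {m} (es : Edges m) (χ : Colouring m) i {p v β w} → Joins es i v w → ¬ (w ≡ p) → lookup χ i ≡ β →
                    ChildEdge p v β w (at es χ i)
  Joins⇒ChildEdge es χ i (inj₁ p) w≢p c≡β = inj₁ (cong proj₁ p , cong proj₂ p) , w≢p , c≡β
  Joins⇒ChildEdge es χ i (inj₂ p) w≢p c≡β = inj₂ (cong proj₂ p , cong proj₁ p) , w≢p , c≡β

  -- `recolor` changes the first matching entry only; as the matching edge is unique, this is the
  -- update of one coordinate.
  recolor-mk : ∀ {m} (es : Edges m) (χ : Colouring m) i x y γ → Joins es i x y → (∀ j → Joins es j x y → j ≡ i) →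
               recolor (mk es χ) x y γ ≡ mk es (χ [ i ]≔ γ)
  recolor-mk ((a , b) ∷ es) (c ∷ χ) zero x y γ joins unique =
    trans (recolor-++ʳ (mk es χ) _ x y γ none) (cong (mk es χ ++_) recolor-last)
    where
    none : ¬ Any (EdgeOf x y) (mk es χ)
    none e with Any-mk⁻ es χ e
    ... | j , q with () ← unique (suc j) (EdgeOf⇒Joins es χ j x y q)
    recolor-last : recolor [ (a , b , c) ] x y γ ≡ [ (a , b , γ) ]
    recolor-last rewrite edgeTest-complete {c = c} (Joins⇒EdgeOf ((a , b) ∷ es) (c ∷ χ) zero x y joins) = refl
  recolor-mk ((a , b) ∷ es) (c ∷ χ) (suc i) x y γ joins unique =
    trans (recolor-++ˡ (mk es χ) _ x y γ (Any-mk⁺ es χ i (Joins⇒EdgeOf es χ i x y joins)))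
      (cong (_++ [ (a , b , c) ]) (recolor-mk es χ i x y γ joins (λ j q → Fin.suc-injective (unique (suc j) q))))

  zip-mk : ∀ {m} (es : Edges m) (χ ψ : Colouring m) tl (F : CEdge n κ × CEdge n κ → ℕ) →
           ∑ (zip (mk es χ) (mk es ψ ++ tl)) F ≡ ∑ (allFin m) (λ i → F (at es χ i , at es ψ i))
  zip-mk {m} es χ ψ tl F = trans (cong (λ s → ∑ (zip s (mk es ψ ++ tl)) F) (sym (++-identityʳ (mk es χ)))) (trans (extend es χ ψ [] tl) (+-identityʳ _))
    where
    extend : ∀ {m} (es : Edges m) (χ ψ : Colouring m) t₁ t₂ →
             ∑ (zip (mk es χ ++ t₁) (mk es ψ ++ t₂)) F ≡ ∑ (allFin m) (λ i → F (at es χ i , at es ψ i)) ℕ.+ ∑ (zip t₁ t₂) F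
    extend []             []      []      t₁ t₂ = refl
    extend {suc m} ((a , b) ∷ es) (c ∷ χ) (d ∷ ψ) t₁ t₂ = begin
      ∑ (zip ((mk es χ ++ [ (a , b , c) ]) ++ t₁) ((mk es ψ ++ [ (a , b , d) ]) ++ t₂)) F
        ≡⟨ cong₂ (λ s t → ∑ (zip s t) F) (++-assoc (mk es χ) _ t₁) (++-assoc (mk es ψ) _ t₂) ⟩
      ∑ (zip (mk es χ ++ (a , b , c) ∷ t₁) (mk es ψ ++ (a , b , d) ∷ t₂)) F
        ≡⟨ extend es χ ψ _ _ ⟩
      S ℕ.+ (F₀ ℕ.+ ∑ (zip t₁ t₂) F)
        ≡⟨ sym (+-assoc S F₀ _) ⟩
      (S ℕ.+ F₀) ℕ.+ ∑ (zip t₁ t₂) F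
        ≡⟨ cong (ℕ._+ ∑ (zip t₁ t₂) F) (trans (+-comm S F₀) (sym (∑-allFin-suc m _))) ⟩
      ∑ (allFin (suc m)) (λ i → F (at ((a , b) ∷ es) (c ∷ χ) i , at ((a , b) ∷ es) (d ∷ ψ) i)) ℕ.+ ∑ (zip t₁ t₂) F ∎
      where
      open ≡-Reasoning
      S F₀ : ℕ
      S  = ∑ (allFin m) (λ i → F (at es χ i , at es ψ i))
      F₀ = F ((a , b , c) , (a , b , d))

  -- `zip` stops at the end of the older state, so whatever `tl` appends is not counted.
  recourse-mk : ∀ {m} (es : Edges m) (χ ψ : Colouring m) tl →
                recourse (mk es χ) (mk es ψ ++ tl) ≡ ∑ (allFin m) (λ i → when (not (lookup χ i == lookup ψ i)) 1)
  recourse-mk es χ ψ tl = trans (countᵇ-∑ _ (zip (mk es χ) (mk es ψ ++ tl))) (zip-mk es χ ψ tl _)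

  -- The recursion follows the order of insertion, so the condition on the newest edge splits off
  -- definitionally. `Proper` is the symmetric form, convenient for colour swaps.
  proper : ∀ {m} → Edges m → Colouring m → Bool
  proper []             []      = true
  proper ((a , b) ∷ es) (c ∷ χ) = proper es χ ∧ not (used es χ a c) ∧ not (used es χ b c)

  Proper : ∀ {m} → Edges m → Colouring m → Set
  Proper es χ = ∀ i j x → Inc es i x → Inc es j x → lookup χ i ≡ lookup χ j → i ≡ j

  proper-sound : ∀ {m} (es : Edges m) (χ : Colouring m) → proper es χ ≡ true → Proper es χ
  proper-sound ((a , b) ∷ es) (c ∷ χ) pr = go
    where
    older : proper es χ ≡ true
    older = proj₁ (∧-true pr)
    fresh : not (used es χ a c) ∧ not (used es χ b c) ≡ true
    fresh = proj₂ (∧-true {proper es χ} pr)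
    clash : ∀ j x → Inc ((a , b) ∷ es) zero x → Inc es j x → c ≡ lookup χ j → ⊥
    clash j x (_ , inj₁ refl) q eq = true≢false (used-complete es χ a c j q (sym eq)) (not-true (proj₁ (∧-true fresh)))
    clash j x (_ , inj₂ refl) q eq = true≢false (used-complete es χ b c j q (sym eq)) (not-true (proj₂ (∧-true {not (used es χ a c)} fresh)))
    go : Proper ((a , b) ∷ es) (c ∷ χ)
    go zero    zero    x p q eq = refl
    go zero    (suc j) x p q eq = ⊥-elim (clash j x p q eq)
    go (suc i) zero    x p q eq = ⊥-elim (clash i x q p (sym eq))
    go (suc i) (suc j) x p q eq = cong suc (proper-sound es χ older i j x p q eq)

  proper-complete : ∀ {m} (es : Edges m) (χ : Colouring m) → Proper es χ → proper es χ ≡ true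
  proper-complete []             []      pr = refl
  proper-complete ((a , b) ∷ es) (c ∷ χ) pr =
    ∧-intro (proper-complete es χ (λ i j x p q eq → Fin.suc-injective (pr (suc i) (suc j) x p q eq)))
      (∧-intro (fresh a (b , inj₁ refl)) (fresh b (a , inj₂ refl)))
    where
    fresh : ∀ x → Inc ((a , b) ∷ es) zero x → not (used es χ x c) ≡ true
    fresh x p with used es χ x c in eq
    ... | false = refl
    ... | true with (i , q , r) ← used-sound es χ x c eq with () ← pr zero (suc i) x p q (sym r)

  used-cons : ∀ {m} a b (es : Edges m) c (χ : Colouring m) x d →
              used ((a , b) ∷ es) (c ∷ χ) x d ≡ used es χ x d ∨ (((a == x) ∨ (b == x)) ∧ (c == d))
  used-cons a b es c χ x d = any-snoc _ (mk es χ) (a , b , c)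

  -- Induction on the newest edge: if it meets `x`, properness makes its colour new there, so
  -- exactly one used colour is gained.
  used-count : ∀ {m} (es : Edges m) (χ : Colouring m) x → proper es χ ≡ true →
               ∑ (allFin κ) (λ c → when (used es χ x c) 1) ≡ degV es x
  used-count []             []      x pr = ∑-𝟘 (allFin κ)
  used-count {suc m} ((a , b) ∷ es) (c ∷ χ) x pr = begin
    ∑ (allFin κ) (λ d → when (used ((a , b) ∷ es) (c ∷ χ) x d) 1)
      ≡⟨ ∑-cong (allFin κ) split ⟩
    ∑ (allFin κ) (λ d → when inc (when (c == d) 1) ℕ.+ when (used es χ x d) 1)
      ≡⟨ ∑-⊕ (allFin κ) _ _ ⟩
    ∑ (allFin κ) (λ d → when inc (when (c == d) 1)) ℕ.+ ∑ (allFin κ) (λ d → when (used es χ x d) 1)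
      ≡⟨ cong₂ ℕ._+_ (trans (sym (∑-when inc (allFin κ) _)) (cong (when inc) (∑-δ c (λ _ → 1)))) (used-count es χ x (proj₁ (∧-true pr))) ⟩
    when inc 1 ℕ.+ degV es x
      ≡⟨ sym (∑-allFin-suc m (λ i → when (incB ((a , b) ∷ es) i x) 1)) ⟩
    degV ((a , b) ∷ es) x ∎
    where
    open ≡-Reasoning
    inc : Bool
    inc = (a == x) ∨ (b == x)
    fresh : inc ≡ true → used es χ x c ≡ false
    fresh e with used es χ x c in eq
    ... | false = refl
    ... | true with (i , q , r) ← used-sound es χ x c eq
      with () ← proper-sound ((a , b) ∷ es) (c ∷ χ) pr zero (suc i) x (incB-sound ((a , b) ∷ es) zero x e) q (sym r)
    split : ∀ d → when (used ((a , b) ∷ es) (c ∷ χ) x d) 1 ≡ when inc (when (c == d) 1) ℕ.+ when (used es χ x d) 1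
    split d rewrite used-cons a b es c χ x d with (a == x) ∨ (b == x) in e
    ... | false rewrite ∨-identityʳ (used es χ x d) = refl
    ... | true with c Fin.≟ d
    ...   | no _ rewrite ∨-identityʳ (used es χ x d) = refl
    ...   | yes refl rewrite fresh e = refl

  -- Colour swaps and rooted forests

  lookup-ext : ∀ {A : Set} {m} {χ ψ : Vec A m} → (∀ i → lookup χ i ≡ lookup ψ i) → χ ≡ ψ
  lookup-ext {χ = χ} {ψ} eq = trans (sym (tabulate∘lookup χ)) (trans (tabulate-cong eq) (tabulate∘lookup ψ))

  transpose-left : ∀ (a b : Fin κ) → transpose a b a ≡ b
  transpose-left a b with a Fin.≟ a
  ... | yes _ = refl
  ... | no q = ⊥-elim (q refl)

  transpose-right : ∀ (a b : Fin κ) → transpose a b b ≡ a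
  transpose-right a b with b Fin.≟ a
  ... | yes p = p
  ... | no _ with b Fin.≟ b
  ...   | yes _ = refl
  ...   | no q = ⊥-elim (q refl)

  transpose-other : ∀ (a b c : Fin κ) → ¬ c ≡ a → ¬ c ≡ b → transpose a b c ≡ c
  transpose-other a b c c≢a c≢b with c Fin.≟ a
  ... | yes p = ⊥-elim (c≢a p)
  ... | no _ with c Fin.≟ b
  ...   | yes p = ⊥-elim (c≢b p)
  ...   | no _  = refl

  transpose-comm : ∀ (a b c : Fin κ) → transpose a b c ≡ transpose b a c
  transpose-comm a b c = cases (c Fin.≟ a) (c Fin.≟ b)
    where
    cases : Dec (c ≡ a) → Dec (c ≡ b) → transpose a b c ≡ transpose b a c
    cases (yes refl) _          = trans (transpose-left c b) (sym (transpose-right b c))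
    cases (no _)     (yes refl) = trans (transpose-right a c) (sym (transpose-left c a))
    cases (no c≢a)   (no c≢b)   = trans (transpose-other a b c c≢a c≢b) (sym (transpose-other b a c c≢b c≢a))

  transpose-involutive : ∀ (a b c : Fin κ) → transpose a b (transpose a b c) ≡ c
  transpose-involutive a b c = trans (transpose-comm a b (transpose a b c)) (transpose-inverse b a)

  transpose-injective : ∀ (a b : Fin κ) {c d} → transpose a b c ≡ transpose a b d → c ≡ d
  transpose-injective a b eq = trans (sym (transpose-involutive a b _)) (trans (cong (transpose a b) eq) (transpose-involutive a b _))

  swapOn : ∀ {m} → (Fin m → Bool) → Fin κ → Fin κ → Colouring m → Colouring m
  swapOn P a b χ = tabulate (λ i → if P i then transpose a b (lookup χ i) else lookup χ i)

  module _ {m} (P : Fin m → Bool) (a b : Fin κ) (χ : Colouring m) where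

    swapOn-inside : ∀ {i} → P i ≡ true → lookup (swapOn P a b χ) i ≡ transpose a b (lookup χ i)
    swapOn-inside {i} Pi rewrite lookup∘tabulate (λ i → if P i then transpose a b (lookup χ i) else lookup χ i) i | Pi = refl

    swapOn-outside : ∀ {i} → P i ≡ false → lookup (swapOn P a b χ) i ≡ lookup χ i
    swapOn-outside {i} Pi rewrite lookup∘tabulate (λ i → if P i then transpose a b (lookup χ i) else lookup χ i) i | Pi = refl

    -- An outside edge that touches an inside one has neither of the two colours, so the
    -- transposition fixes its colour as well. Wherever edges meet, the change is thus one injective
    -- map applied to all their colours.
    swapOn-proper : (es : Edges m) → Proper es χ →
      (∀ i j x → Inc es i x → Inc es j x → P i ≡ true → P j ≡ false → ¬ lookup χ j ≡ a × ¬ lookup χ j ≡ b) →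
      Proper es (swapOn P a b χ)
    swapOn-proper es pr sep i j x Ii Ij eq with P i in Pi | P j in Pj
    ... | true  | true  = pr i j x Ii Ij (transpose-injective a b (trans (sym (swapOn-inside Pi)) (trans eq (swapOn-inside Pj))))
    ... | false | false = pr i j x Ii Ij (trans (sym (swapOn-outside Pi)) (trans eq (swapOn-outside Pj)))
    ... | true  | false = pr i j x Ii Ij (transpose-injective a b
      (trans (sym (swapOn-inside Pi)) (trans eq (trans (swapOn-outside Pj) (sym (transpose-other a b _ (proj₁ s) (proj₂ s)))))))
      where
      s : ¬ lookup χ j ≡ a × ¬ lookup χ j ≡ b
      s = sep i j x Ii Ij Pi Pj
    ... | false | true  = pr i j x Ii Ij (transpose-injective a b
      (trans (transpose-other a b _ (proj₁ s) (proj₂ s)) (trans (sym (swapOn-outside Pi)) (trans eq (swapOn-inside Pj)))))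
      where
      s : ¬ lookup χ i ≡ a × ¬ lookup χ i ≡ b
      s = sep j i x Ij Ii Pj Pi

  swapOn-involutive : ∀ {m} (P Q : Fin m → Bool) a b (χ : Colouring m) → (∀ i → Q i ≡ P i) →
                      swapOn Q a b (swapOn P a b χ) ≡ χ
  swapOn-involutive P Q a b χ Q≡P = lookup-ext go
    where
    go : ∀ i → lookup (swapOn Q a b (swapOn P a b χ)) i ≡ lookup χ i
    go i with P i in Pi
    ... | true  = trans (swapOn-inside Q a b (swapOn P a b χ) (trans (Q≡P i) Pi))
                    (trans (cong (transpose a b) (swapOn-inside P a b χ Pi)) (transpose-involutive a b _))
    ... | false = trans (swapOn-outside Q a b (swapOn P a b χ) (trans (Q≡P i) Pi)) (swapOn-outside P a b χ Pi)

  swapOn-comm : ∀ {m} (P : Fin m → Bool) a b (χ : Colouring m) → swapOn P a b χ ≡ swapOn P b a χ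
  swapOn-comm P a b χ = tabulate-cong (λ i → cong (λ z → if P i then z else lookup χ i) (transpose-comm a b (lookup χ i)))

  swapOn-cancel : ∀ {m} (P : Fin m → Bool) a b (χ : Colouring m) → swapOn P b a (swapOn P a b χ) ≡ χ
  swapOn-cancel P a b χ = trans (swapOn-comm P b a (swapOn P a b χ)) (swapOn-involutive P P a b χ (λ _ → refl))

  used-false : ∀ {m} (es : Edges m) (χ : Colouring m) x c → used es χ x c ≡ false → ∀ i → Inc es i x → ¬ lookup χ i ≡ c
  used-false es χ x c eq i Ii χi≡c = true≢false (used-complete es χ x c i Ii χi≡c) eq

  used-false⁺ : ∀ {m} (es : Edges m) (χ : Colouring m) x c → (∀ i → Inc es i x → ¬ lookup χ i ≡ c) → used es χ x c ≡ false
  used-false⁺ es χ x c none with used es χ x c in eq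
  ... | false = refl
  ... | true with (i , Ii , χi) ← used-sound es χ x c eq = ⊥-elim (none i Ii χi)

  -- A choice of a root in every tree such that r is one of them; edge i joins its
  -- parent end pn i to its child end ce i, and rep is constant on every tree.
  record Rooted {m} (es : Edges m) (rep : Fin n → Fin n) (r : Fin n) : Set where
    field
      dep        : Fin n → ℕ
      ce pn      : Fin m → Fin n
      joins      : ∀ i → Joins es i (pn i) (ce i)
      depth      : ∀ i → dep (ce i) ≡ suc (dep (pn i))
      ce-inj     : ∀ {i j} → ce i ≡ ce j → i ≡ j
      root       : dep r ≡ 0
      parent     : ∀ x → ¬ dep x ≡ 0 → ∃ λ i → ce i ≡ x
      rep-edge   : ∀ i → rep (ce i) ≡ rep (pn i)
      top-unique : ∀ x → dep x ≡ 0 → rep x ≡ rep r → x ≡ r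

    joins-ends : ∀ {i x y} → Joins es i x y → (x ≡ pn i × y ≡ ce i) ⊎ (x ≡ ce i × y ≡ pn i)
    joins-ends {i} (inj₁ p) with joins i
    ... | inj₁ q with refl ← trans (sym p) q = inj₁ (refl , refl)
    ... | inj₂ q with refl ← trans (sym p) q = inj₂ (refl , refl)
    joins-ends {i} (inj₂ p) with joins i
    ... | inj₁ q with refl ← trans (sym p) q = inj₂ (refl , refl)
    ... | inj₂ q with refl ← trans (sym p) q = inj₁ (refl , refl)

    inc-ends : ∀ {i x} → Inc es i x → x ≡ pn i ⊎ x ≡ ce i
    inc-ends (y , j) with joins-ends j
    ... | inj₁ (p , _) = inj₁ p
    ... | inj₂ (p , _) = inj₂ p

    inc-pn : ∀ i → Inc es i (pn i)
    inc-pn i = ce i , joins i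

    inc-ce : ∀ i → Inc es i (ce i)
    inc-ce i with joins i
    ... | inj₁ p = pn i , inj₂ p
    ... | inj₂ p = pn i , inj₁ p

    inc-rep : ∀ {i x} → Inc es i x → rep x ≡ rep (pn i)
    inc-rep {i} Ii with inc-ends Ii
    ... | inj₁ refl = refl
    ... | inj₂ refl = rep-edge i

    pn≢ce : ∀ i → ¬ pn i ≡ ce i
    pn≢ce i eq = 1+n≢n (trans (sym (depth i)) (cong dep (sym eq)))

    ce≢root : ∀ i → ¬ ce i ≡ r
    ce≢root i eq with () ← trans (sym (depth i)) (trans (cong dep eq) root)

    inc-root : ∀ {i} → Inc es i r → pn i ≡ r
    inc-root {i} Ii with inc-ends Ii
    ... | inj₁ p = sym p
    ... | inj₂ p = ⊥-elim (ce≢root i (sym p))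

    -- Descending along `i` and then along `j` would return to the same vertex two levels deeper.
    not-opposite : ∀ i j → pn i ≡ ce j → ce i ≡ pn j → ⊥
    not-opposite i j p q = m≢1+m+n _ {1} (trans (trans (cong dep p) (depth j))
      (trans (cong (suc ∘ dep) (sym q)) (trans (cong suc (depth i)) (cong suc (+-comm 1 _)))))

    joins-unique : ∀ {i j x y} → Joins es i x y → Joins es j x y → i ≡ j
    joins-unique {i} {j} p q with joins-ends p | joins-ends q
    ... | inj₁ (a , b) | inj₁ (c , d) = ce-inj (trans (sym b) d)
    ... | inj₂ (a , b) | inj₂ (c , d) = ce-inj (trans (sym a) c)
    ... | inj₁ (a , b) | inj₂ (c , d) = ⊥-elim (not-opposite i j (trans (sym a) c) (trans (sym b) d))
    ... | inj₂ (a , b) | inj₁ (c , d) = ⊥-elim (not-opposite j i (trans (sym c) a) (trans (sym d) b))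

    ancestor : ∀ k d x → dep x ≡ k ℕ.+ d → ∃ λ y → dep y ≡ d
    ancestor zero    d x eq = x , eq
    ancestor (suc k) d x eq with parent x (λ z → 1+n≢0 (trans (sym eq) z))
    ... | i , refl = ancestor k d (pn i) (suc-injective (trans (sym (depth i)) eq))

    -- Pigeonhole: `x` has an ancestor on each of the levels `0` to `dep x`, and these are distinct
    -- vertices. This is what makes `n` enough fuel for `fixForbidden` and enough rounds for
    -- `inTree`.
    dep<n : ∀ x → dep x < n
    dep<n x = Fin.injective⇒≤ {f = f} inj
      where
      level : (i : Fin (suc (dep x))) → ∃ λ y → dep y ≡ toℕ i
      level i = ancestor (dep x ℕ.∸ toℕ i) (toℕ i) x (sym (m∸n+n≡m (≤-pred (Fin.toℕ<n i))))
      f : Fin (suc (dep x)) → Fin n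
      f i = proj₁ (level i)
      inj : ∀ {i j} → f i ≡ f j → i ≡ j
      inj {i} {j} eq = Fin.toℕ-injective (trans (sym (proj₂ (level i))) (trans (cong dep eq) (proj₂ (level j))))

    parentEdge? : ∀ x → Dec (∃ λ j → ce j ≡ x)
    parentEdge? x = Fin.any? (λ j → ce j Fin.≟ x)

    aboveB : Fin n → (Fin m → Bool) → Bool
    aboveB x f with parentEdge? x
    ... | yes (j , _) = f j
    ... | no _        = false

    aboveB-sound : ∀ x f → aboveB x f ≡ true → ∃ λ j → ce j ≡ x × f j ≡ true
    aboveB-sound x f eq with parentEdge? x
    ... | yes (j , p) = j , p , eq

    aboveB-complete : ∀ x f j → ce j ≡ x → f j ≡ true → aboveB x f ≡ true
    aboveB-complete x f j p fj with parentEdge? x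
    ... | yes (i , q) = trans (cong f (ce-inj (trans q (sym p)))) fj
    ... | no q        = ⊥-elim (q (j , p))

    data Below (x : Fin n) : Fin n → Set where
      here : Below x x
      down : ∀ j → Below x (pn j) → Below x (ce j)

    -- The number is a recursion measure: climbing from `y` to a root takes `dep y` steps.
    belowFrom : Fin n → ℕ → Fin n → Bool
    belowFrom x zero    y = x == y
    belowFrom x (suc d) y = (x == y) ∨ aboveB y (λ j → belowFrom x d (pn j))

    below : Fin n → Fin n → Bool
    below x y = belowFrom x (dep y) y

    belowFrom-sound : ∀ x d y → belowFrom x d y ≡ true → Below x y
    belowFrom-sound x zero y eq with refl ← ==-true {i = x} eq = here
    belowFrom-sound x (suc d) y eq with ∨-true {x == y} eq
    ... | inj₁ p with refl ← ==-true {i = x} p = here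
    ... | inj₂ p with (j , refl , q) ← aboveB-sound y _ p = down j (belowFrom-sound x d (pn j) q)

    below-sound : ∀ x y → below x y ≡ true → Below x y
    below-sound x y = belowFrom-sound x (dep y) y

    belowFrom-refl : ∀ x d → belowFrom x d x ≡ true
    belowFrom-refl x zero    = ==-refl x
    belowFrom-refl x (suc d) = ∨-introˡ (==-refl x)

    below-complete : ∀ x y → Below x y → below x y ≡ true
    below-complete x _ here       = belowFrom-refl x (dep x)
    below-complete x _ (down j b) rewrite depth j =
      ∨-introʳ (x == ce j) (aboveB-complete (ce j) _ j refl (below-complete x (pn j) b))

    Below-dep : ∀ {x y} → Below x y → dep x ≤ dep y
    Below-dep here       = ≤-refl
    Below-dep (down j b) = ≤-trans (Below-dep b) (≤-trans (n≤1+n _) (≤-reflexive (sym (depth j))))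

    Below-rep : ∀ {x y} → Below x y → rep y ≡ rep x
    Below-rep here       = refl
    Below-rep (down j b) = trans (rep-edge j) (Below-rep b)

  -- Kempe chains

  -- The colour at depth `d` of a chain that leaves the root with colour `β`. With the two colours
  -- exchanged it is the colour after the Kempe swap.
  alternate : Fin κ → Fin κ → ℕ → Fin κ
  alternate β α zero    = β
  alternate β α (suc d) = alternate α β d

  alternate-transpose : ∀ β α d → transpose α β (alternate β α d) ≡ alternate α β d
  alternate-transpose β α zero    = transpose-right α β
  alternate-transpose β α (suc d) = trans (transpose-comm α β (alternate α β d)) (alternate-transpose α β d)

  alternate-≢ : ∀ {β α} → ¬ α ≡ β → ∀ d → ¬ alternate α β d ≡ alternate β α d
  alternate-≢ α≢β zero    eq = α≢β eq
  alternate-≢ α≢β (suc d) eq = alternate-≢ α≢β d (sym eq)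

  module Tree {m} (es : Edges m) (rep : Fin n → Fin n) (u v : Fin n) (R : Rooted es rep v) (u≁v : ¬ rep u ≡ rep v) where
    open Rooted R

    -- When `α` is free at `v`, the part coloured `α` and `β` that contains `v` is a path which
    -- leaves `v` through its edge of colour `β` and only descends. Hence the colour is prescribed
    -- by the depth.
    data Chain (β α : Fin κ) (χ : Colouring m) : Fin m → Set where
      top  : ∀ {i} → pn i ≡ v → lookup χ i ≡ β → Chain β α χ i
      step : ∀ {i} j → ce j ≡ pn i → Chain β α χ j → lookup χ i ≡ alternate β α (dep (pn i)) → Chain β α χ i

    onFrom : Fin κ → Fin κ → Colouring m → ℕ → Fin m → Bool
    onFrom β α χ zero    i = (pn i == v) ∧ (lookup χ i == β)
    onFrom β α χ (suc d) i = aboveB (pn i) (onFrom β α χ d) ∧ (lookup χ i == alternate β α (suc d))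

    on : Fin κ → Fin κ → Colouring m → Fin m → Bool
    on β α χ i = onFrom β α χ (dep (pn i)) i

    onFrom-sound : ∀ {β α χ} d i → dep (pn i) ≡ d → onFrom β α χ d i ≡ true → Chain β α χ i
    onFrom-sound zero i _ eq = let (p , q) = ∧-true {pn i == v} eq in top (==-true p) (==-true q)
    onFrom-sound {β} {α} {χ} (suc d) i dp eq with ∧-true {aboveB (pn i) (onFrom β α χ d)} eq
    ... | p , q with aboveB-sound (pn i) _ p
    ... | j , r , s = step j r (onFrom-sound d j (suc-injective (trans (sym (depth j)) (trans (cong dep r) dp))) s)
      (trans (==-true q) (cong (alternate β α) (sym dp)))

    on-sound : ∀ {β α χ i} → on β α χ i ≡ true → Chain β α χ i
    on-sound {i = i} = onFrom-sound (dep (pn i)) i refl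

    on-complete : ∀ {β α χ i} → Chain β α χ i → on β α χ i ≡ true
    on-complete {i = i} (top p q) rewrite trans (cong dep p) root = ∧-intro (==-complete p) (==-complete q)
    on-complete {i = i} (step j p c q) rewrite trans (sym (cong dep p)) (depth j) =
      ∧-intro (aboveB-complete (pn i) _ j p (on-complete c)) (==-complete q)

    on-false : ∀ {β α χ i} → on β α χ i ≡ false → ¬ Chain β α χ i
    on-false eq c = true≢false (on-complete c) eq

    chain-colour : ∀ {β α χ i} → Chain β α χ i → lookup χ i ≡ alternate β α (dep (pn i))
    chain-colour {β} {α} (top p q)      = trans q (cong (alternate β α) (sym (trans (cong dep p) root)))
    chain-colour (step _ _ _ q) = q

    chain-rep : ∀ {β α χ i} → Chain β α χ i → rep (pn i) ≡ rep v
    chain-rep (top p _)      = cong rep p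
    chain-rep (step j p c _) = trans (cong rep (sym p)) (trans (rep-edge j) (chain-rep c))

    chain-start : ∀ {β α χ i} → Chain β α χ i → ∃ λ j → Inc es j v × lookup χ j ≡ β
    chain-start {i = i} (top p q) = i , subst (Inc es i) p (inc-pn i) , q
    chain-start (step _ _ c _)    = chain-start c

    chain-parent : ∀ {β α χ i j} → ce j ≡ pn i → Chain β α χ i → Chain β α χ j
    chain-parent {j = j} p (top q _)      = ⊥-elim (ce≢root j (trans p q))
    chain-parent {β} {α} {χ} p (step k q c _) = subst (Chain β α χ) (ce-inj (trans q (sym p))) c

    child-dep : ∀ {i j} → ce j ≡ pn i → dep (pn i) ≡ suc (dep (pn j))
    child-dep {i} {j} p = trans (cong dep (sym p)) (depth j)

    extend : ∀ {β α χ i} j → ce j ≡ pn i → Chain β α χ j → lookup χ i ≡ alternate α β (dep (pn j)) → Chain β α χ i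
    extend {β} {α} j p c q = step j p c (trans q (cong (alternate β α) (sym (child-dep p))))

    -- The colour δ at u is kept apart from β because a swap exchanges the roles of β and α at v but leaves u alone.
    good : Fin κ → Fin κ → Colouring m → Bool
    good δ α χ = proper es χ ∧ not (used es χ u δ) ∧ not (used es χ v α)

    record Good (δ α : Fin κ) (χ : Colouring m) : Set where
      constructor mkGood
      field
        isProper : Proper es χ
        free-u   : ∀ i → Inc es i u → ¬ lookup χ i ≡ δ
        free-v   : ∀ i → Inc es i v → ¬ lookup χ i ≡ α

    good-sound : ∀ {δ α χ} → good δ α χ ≡ true → Good δ α χ
    good-sound {δ} {α} {χ} eq =
      let (p , q) = ∧-true {proper es χ} eq ; (r , s) = ∧-true {not (used es χ u δ)} q in
      mkGood (proper-sound es χ p) (used-false es χ u δ (not-true r)) (used-false es χ v α (not-true s))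

    good-complete : ∀ {δ α χ} → Good δ α χ → good δ α χ ≡ true
    good-complete {δ} {α} {χ} (mkGood pr fu fv) =
      ∧-intro (proper-complete es χ pr) (∧-intro (cong not (used-false⁺ es χ u δ fu)) (cong not (used-false⁺ es χ v α fv)))

    unchanged-u : ∀ {χ ψ : Colouring m} {δ} → (∀ i → ¬ rep (pn i) ≡ rep v → lookup ψ i ≡ lookup χ i) →
                  (∀ i → Inc es i u → ¬ lookup χ i ≡ δ) → ∀ i → Inc es i u → ¬ lookup ψ i ≡ δ
    unchanged-u same fu i Ii eq = fu i Ii (trans (sym (same i (λ r → u≁v (trans (inc-rep Ii) r)))) eq)

    kempe : Fin κ → Fin κ → Colouring m → Colouring m
    kempe β α χ = swapOn (on β α χ) α β χ

    kempe-outside : ∀ {β α χ i} → on β α χ i ≡ false → lookup (kempe β α χ) i ≡ lookup χ i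
    kempe-outside {β} {α} {χ} = swapOn-outside (on β α χ) α β χ

    kempe-on : ∀ {β α χ i} → Chain β α χ i → lookup (kempe β α χ) i ≡ alternate α β (dep (pn i))
    kempe-on {β} {α} {χ} {i} c = trans (swapOn-inside (on β α χ) α β χ (on-complete c))
      (trans (cong (transpose α β) (chain-colour c)) (alternate-transpose β α (dep (pn i))))

    module KempeSwap {δ β α : Fin κ} {χ : Colouring m} (α≢β : ¬ α ≡ β) (g : Good δ α χ) where
      open Good g

      -- At `v` the other colour is `α`, which is free there. At a lower vertex it is the colour of
      -- the preceding chain edge, so by properness no edge off the chain has it.
      siblings : ∀ {i j} → pn i ≡ pn j → Chain β α χ i → ¬ Chain β α χ j → ¬ lookup χ j ≡ alternate α β (dep (pn i))
      siblings {i} {j} p (top q _) ¬c eq = free-v j (subst (Inc es j) (trans (sym p) q) (inc-pn j))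
        (trans eq (cong (alternate α β) (trans (cong dep q) root)))
      siblings {i} {j} p (step k q c _) ¬c eq = ¬c (subst (Chain β α χ) (isProper k j (ce k) (inc-ce k)
        (subst (Inc es j) (trans (sym p) (sym q)) (inc-pn j))
        (trans (chain-colour c) (trans (cong (alternate α β) (sym (child-dep q))) (sym eq)))) c)

      -- If the colours agreed, `j` would be `i` by properness. With the other colour, `j` would
      -- prolong the chain if it hangs below `i`, and is excluded by `siblings` if it starts where
      -- `i` does; the remaining positions make it `i` or the parent edge of `i`, both on the chain.
      isolated : ∀ i j x → Inc es i x → Inc es j x → Chain β α χ i → ¬ Chain β α χ j →
                 ¬ lookup χ j ≡ alternate β α (dep (pn i)) × ¬ lookup χ j ≡ alternate α β (dep (pn i))
      isolated i j x Ii Ij c ¬c = same , other (inc-ends Ii) (inc-ends Ij)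
        where
        same : ¬ lookup χ j ≡ alternate β α (dep (pn i))
        same eq = ¬c (subst (Chain β α χ) (isProper i j x Ii Ij (trans (chain-colour c) (sym eq))) c)
        other : x ≡ pn i ⊎ x ≡ ce i → x ≡ pn j ⊎ x ≡ ce j → ¬ lookup χ j ≡ alternate α β (dep (pn i))
        other (inj₁ p) (inj₁ q) eq = siblings (trans (sym p) q) c ¬c eq
        other (inj₂ p) (inj₁ q) eq = ¬c (extend i (trans (sym p) q) c eq)
        other (inj₂ p) (inj₂ q) eq = ¬c (subst (Chain β α χ) (ce-inj (trans (sym p) q)) c)
        other (inj₁ p) (inj₂ q) eq = ¬c (chain-parent (trans (sym q) p) c)

      separated : ∀ i j x → Inc es i x → Inc es j x → on β α χ i ≡ true → on β α χ j ≡ false →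
                  ¬ lookup χ j ≡ α × ¬ lookup χ j ≡ β
      separated i j x Ii Ij oni onj = choose (dep (pn i)) (isolated i j x Ii Ij (on-sound oni) (on-false onj))
        where
        choose : ∀ d → ¬ lookup χ j ≡ alternate β α d × ¬ lookup χ j ≡ alternate α β d → ¬ lookup χ j ≡ α × ¬ lookup χ j ≡ β
        choose zero          (p , q) = q , p
        choose (suc zero)    (p , q) = p , q
        choose (suc (suc d)) pq      = choose d pq

      kempe-proper : Proper es (kempe β α χ)
      kempe-proper = swapOn-proper (on β α χ) α β χ es isProper separated

      chain-forth : ∀ {i} → Chain β α χ i → Chain α β (kempe β α χ) i
      chain-forth {i} c@(top p q) = top p (trans (kempe-on c) (cong (alternate α β) (trans (cong dep p) root)))
      chain-forth {i} c@(step j p c′ q) = step j p (chain-forth c′) (kempe-on c)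

      -- An edge off the old chain keeps its colour. At `v` this colour would be `α`, which is free
      -- there. Further down it would have been the colour of the parent edge before the swap, and
      -- properness identifies the two edges.
      chain-back : ∀ {i} → Chain α β (kempe β α χ) i → Chain β α χ i
      chain-back {i} c with on β α χ i in eq
      ... | true = on-sound eq
      ... | false with c
      ...   | top p q = ⊥-elim (free-v i (subst (Inc es i) p (inc-pn i)) (trans (sym (kempe-outside eq)) q))
      ...   | step j p c′ q = subst (Chain β α χ) (isProper j i (ce j) (inc-ce j) (subst (Inc es i) (sym p) (inc-pn i))
                (trans (chain-colour (chain-back c′)) (sym (trans (sym (kempe-outside eq)) (trans q (cong (alternate α β) (child-dep p)))))))
                (chain-back c′)

      on-kempe : ∀ i → on α β (kempe β α χ) i ≡ on β α χ i
      on-kempe i = bool-ext (λ e → on-complete (chain-back (on-sound e))) (λ e → on-complete (chain-forth (on-sound e)))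

      kempe-involutive : kempe α β (kempe β α χ) ≡ χ
      kempe-involutive = trans (swapOn-comm (on α β (kempe β α χ)) β α (kempe β α χ))
        (swapOn-involutive (on β α χ) (on α β (kempe β α χ)) α β χ on-kempe)

      kempe-good : Good δ β (kempe β α χ)
      kempe-good = mkGood kempe-proper
        (unchanged-u {χ} {kempe β α χ} (λ i r → kempe-outside (outside i r)) free-u)
        (λ i Ii eq → atRoot i Ii eq)
        where
        outside : ∀ i → ¬ rep (pn i) ≡ rep v → on β α χ i ≡ false
        outside i r with on β α χ i in eq
        ... | false = refl
        ... | true  = ⊥-elim (r (chain-rep (on-sound eq)))
        atRoot : ∀ i → Inc es i v → ¬ lookup (kempe β α χ) i ≡ β
        atRoot i Ii eq with on β α χ i in e
        ... | true  = α≢β (trans (sym (trans (kempe-on (on-sound e)) (cong (alternate α β) (trans (cong dep (inc-root Ii)) root)))) eq)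
        ... | false = on-false e (top (inc-root Ii) (trans (sym (kempe-outside e)) eq))

      kempe-used : used es χ v β ≡ true → used es (kempe β α χ) v α ≡ true
      kempe-used us with used-sound es χ v β us
      ... | i , Ii , q = used-complete es (kempe β α χ) v α i Ii
        (trans (kempe-on (top (inc-root Ii) q)) (cong (alternate α β) (trans (cong dep (inc-root Ii)) root)))

    conflict : Fin κ → Fin κ → Fin κ → Colouring m → Bool
    conflict δ β α χ = good δ α χ ∧ used es χ v β

    conflict-≢ : ∀ {δ β α χ} → conflict δ β α χ ≡ true → ¬ α ≡ β
    conflict-≢ {δ} {β} {α} {χ} eq refl =
      let (p , q) = ∧-true {good δ α χ} eq ; (i , Ii , r) = used-sound es χ v β q in Good.free-v (good-sound {δ} p) i Ii r

    kempe-conflict : ∀ δ β α χ → conflict δ β α χ ≡ true →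
                     conflict δ α β (kempe β α χ) ≡ true × kempe α β (kempe β α χ) ≡ χ
    kempe-conflict δ β α χ eq = let (p , q) = ∧-true {good δ α χ} eq in
      ∧-intro (good-complete (KempeSwap.kempe-good (conflict-≢ {δ} eq) (good-sound p))) (KempeSwap.kempe-used (conflict-≢ {δ} eq) (good-sound {δ} p) q)
      , KempeSwap.kempe-involutive (conflict-≢ {δ} eq) (good-sound {δ} p)

  -- Counting proper colourings

  # : ∀ {m} → (Colouring m → Bool) → ℕ
  # {m} P = ∑ (colourings m) (λ χ → when (P χ) 1)

  free : ∀ {m} → Edges m → Fin n → ℕ
  free es x = κ ∸ degV es x

  ∑-not : ∀ (p : Fin κ → Bool) → ∑ (allFin κ) (λ c → when (not (p c)) 1) + ∑ (allFin κ) (λ c → when (p c) 1) ≡ κ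
  ∑-not p = trans (sym (∑-⊕ (allFin κ) _ _)) (trans (∑-cong (allFin κ) (λ c → total (p c))) (∑-1-allFin κ))
    where
    total : ∀ b → when (not b) 1 + when b 1 ≡ 1
    total true  = refl
    total false = refl

  free-count : ∀ {m} (es : Edges m) (χ : Colouring m) x → proper es χ ≡ true →
               ∑ (allFin κ) (λ c → when (not (used es χ x c)) 1) ≡ free es x
  free-count es χ x pr = begin
    F                   ≡⟨ sym (m+n∸n≡m F (degV es x)) ⟩
    F + degV es x ∸ degV es x ≡⟨ cong (λ z → F + z ∸ degV es x) (sym (used-count es χ x pr)) ⟩
    F + ∑ (allFin κ) (λ c → when (used es χ x c) 1) ∸ degV es x ≡⟨ cong (_∸ degV es x) (∑-not (used es χ x)) ⟩
    free es x ∎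
    where
    open ≡-Reasoning
    F : ℕ
    F = ∑ (allFin κ) (λ c → when (not (used es χ x c)) 1)

  ∑-const : ∀ {X : Set} (p : X → Bool) (xs : List X) a → ∑ xs (λ x → when (p x) a) ≡ ∑ xs (λ x → when (p x) 1) * a
  ∑-const p xs a = begin
    ∑ xs (λ x → when (p x) a)         ≡⟨ ∑-cong xs (λ x → trans (cong (when (p x)) (sym (*-identityʳ a))) (sym (when-* (p x) a 1))) ⟩
    ∑ xs (λ x → a * when (p x) 1)     ≡⟨ sym (∑-*ˡ a xs _) ⟩
    a * ∑ xs (λ x → when (p x) 1)     ≡⟨ *-comm a _ ⟩
    ∑ xs (λ x → when (p x) 1) * a     ∎
    where open ≡-Reasoning

  module CountTree {m} (es : Edges m) (rep : Fin n → Fin n) (u v : Fin n) (R : Rooted es rep v) (u≁v : ¬ rep u ≡ rep v) where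
    open Rooted R
    open Tree es rep u v R u≁v

    -- The swaps act strictly below `j`. `c₀` is the colour that `j` has whenever it is on the
    -- chain, so `i`, a child edge of `j`, can take only the other `κ ∸ 1` colours; `c₁` is the one
    -- among them that continues the chain.
    module Subtree (β α : Fin κ) (i j : Fin m) (j↑i : ce j ≡ pn i) where

      inside : Fin m → Bool
      inside l = below (ce j) (pn l)

      c₀ : Fin κ
      c₀ = alternate β α (dep (pn j))

      withColour : Fin κ → Colouring m → Bool
      withColour c χ = (good β α χ ∧ on β α χ j) ∧ (lookup χ i == c)

      i≢j : ¬ j ≡ i
      i≢j refl = pn≢ce i (sym j↑i)

      -- A chain starts with an edge of colour `β` at `v`, where `α` is free.
      chain-distinct : ∀ {χ} → good β α χ ∧ on β α χ j ≡ true → ¬ α ≡ β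
      chain-distinct {χ} gj refl = let (g , o) = ∧-true {good β α χ} gj ; (k , Ik , q) = chain-start (on-sound o) in
        Good.free-v (good-sound {β} g) k Ik q

      colour-≢ : ∀ {χ} → good β α χ ∧ on β α χ j ≡ true → ¬ lookup χ i ≡ c₀
      colour-≢ {χ} gj eq = let (g , o) = ∧-true {good β α χ} gj in
        i≢j (Good.isProper (good-sound {β} g) j i (ce j) (inc-ce j) (subst (Inc es i) (sym j↑i) (inc-pn i))
          (trans (chain-colour (on-sound o)) (sym eq)))

      module _ (a b : Fin κ) (a≢c₀ : ¬ a ≡ c₀) (b≢c₀ : ¬ b ≡ c₀) (χ : Colouring m) (g : Good β α χ) (c : Chain β α χ j) where

        swapped : Colouring m
        swapped = swapOn inside a b χ

        not-inside : ∀ l → ¬ Below (ce j) (pn l) → inside l ≡ false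
        not-inside l ¬b with inside l in eq
        ... | false = refl
        ... | true  = ⊥-elim (¬b (below-sound _ _ eq))

        same : ∀ l → ¬ Below (ce j) (pn l) → lookup swapped l ≡ lookup χ l
        same l ¬b = swapOn-outside inside a b χ (not-inside l ¬b)

        Below-inc : ∀ {l x} → Below (ce j) (pn l) → Inc es l x → Below (ce j) x
        Below-inc {l} b Il with inc-ends Il
        ... | inj₁ refl = b
        ... | inj₂ refl = down l b

        Below-ce : ∀ {l x} → Below (ce j) x → x ≡ ce l → l ≡ j ⊎ Below (ce j) (pn l)
        Below-ce here       eq = inj₁ (ce-inj (sym eq))
        Below-ce (down k b) eq with refl ← ce-inj eq = inj₂ b

        -- `j` is the only edge that meets the swapped region from outside, and its colour `c₀` is
        -- neither `a` nor `b`.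
        separated : ∀ l l′ x → Inc es l x → Inc es l′ x → inside l ≡ true → inside l′ ≡ false →
                    ¬ lookup χ l′ ≡ a × ¬ lookup χ l′ ≡ b
        separated l l′ x Il Il′ inl outl′ with inc-ends Il′
        ... | inj₁ refl = ⊥-elim (true≢false (below-complete _ _ (Below-inc (below-sound _ _ inl) Il)) outl′)
        ... | inj₂ p with Below-ce (Below-inc (below-sound _ _ inl) Il) p
        ...   | inj₁ refl = (λ eq → a≢c₀ (trans (sym eq) (chain-colour c))) , (λ eq → b≢c₀ (trans (sym eq) (chain-colour c)))
        ...   | inj₂ bl = ⊥-elim (true≢false (below-complete _ _ bl) outl′)

        shallow : ∀ {l} → dep (pn l) < dep (ce j) → ¬ Below (ce j) (pn l)
        shallow lt b = <⇒≱ lt (Below-dep b)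

        -- The chain down to `j` runs above the swapped region, so the event that `j` is on the
        -- chain survives the swap.
        chain-same : ∀ {l} → dep (pn l) < dep (ce j) → Chain β α χ l → Chain β α swapped l
        chain-same {l} lt (top p q) = top p (trans (same l (shallow lt)) q)
        chain-same {l} lt (step k p c′ q) = step k p
          (chain-same (<-trans (≤-reflexive (sym (child-dep p))) lt) c′) (trans (same l (shallow lt)) q)

        swapped-good : Good β α swapped
        swapped-good = mkGood (swapOn-proper inside a b χ es (Good.isProper g) separated)
          (unchanged-u {χ} {swapped} (λ l r → same l (λ b → r (trans (Below-rep b) (trans (rep-edge j) (chain-rep c))))) (Good.free-u g))
          -- Edges at `v` lie outside the swapped region because `v` has depth `0` and `ce j` does
          -- not.
          (λ l Il eq → Good.free-v g l Il (trans (sym (same l (λ b → <⇒≱ (≤-<-trans (≤-reflexive (trans (cong dep (inc-root Il)) root)) (≤-trans (s≤s z≤n) (≤-reflexive (sym (depth j))))) (Below-dep b)))) eq))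

        swapped-chain : Chain β α swapped j
        swapped-chain = chain-same (≤-reflexive (sym (depth j))) c

        swapped-colour : lookup swapped i ≡ transpose a b (lookup χ i)
        swapped-colour = swapOn-inside inside a b χ (subst (λ x → below (ce j) x ≡ true) j↑i (below-complete _ _ here))

      swap-colour : ∀ a b χ → ¬ a ≡ c₀ → ¬ b ≡ c₀ → withColour a χ ≡ true → withColour b (swapOn inside a b χ) ≡ true
      swap-colour a b χ a≢ b≢ w =
        let (gj , q) = ∧-true {good β α χ ∧ on β α χ j} w ; (g , o) = ∧-true {good β α χ} gj
            G = good-sound {β} g ; C = on-sound o in
        ∧-intro (∧-intro (good-complete (swapped-good a b a≢ b≢ χ G C)) (on-complete (swapped-chain a b a≢ b≢ χ G C)))
          (==-complete (trans (swapped-colour a b a≢ b≢ χ G C) (trans (cong (transpose a b) (==-true q)) (transpose-left a b))))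

      c₁ : Fin κ
      c₁ = alternate α β (dep (pn j))

      recoloured : ∀ γ → ¬ γ ≡ c₀ → # (withColour γ) ≡ # (withColour c₁)
      recoloured γ γ≢c₀ = reindex (swapOn inside γ c₁) (swapOn inside c₁ γ) (withColour γ) (withColour c₁)
        (λ χ w → swap-colour γ c₁ χ γ≢c₀ (distinct w) w
               , swapOn-cancel inside γ c₁ χ)
        (λ χ w → swap-colour c₁ γ χ (distinct w) γ≢c₀ w
               , swapOn-cancel inside c₁ γ χ)
        (λ _ → 1)
        where
        distinct : ∀ {c χ} → withColour c χ ≡ true → ¬ c₁ ≡ c₀
        distinct w = alternate-≢ (chain-distinct (proj₁ (∧-true w))) (dep (pn j))

      on-child : ∀ χ → good β α χ ∧ on β α χ i ≡ withColour c₁ χ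
      on-child χ = bool-ext
        (λ w → let (g , o) = ∧-true {good β α χ} w ; c = on-sound o in
           ∧-intro (∧-intro g (on-complete (chain-parent j↑i c))) (==-complete (trans (chain-colour c) (cong (alternate β α) (child-dep j↑i)))))
        (λ w → let (gj , q) = ∧-true {good β α χ ∧ on β α χ j} w ; (g , o) = ∧-true {good β α χ} gj in
           ∧-intro g (on-complete (extend j j↑i (on-sound o) (==-true q))))

      -- Given the colour c₀ of j, all κ ∸ 1 other colours of i are equally likely.
      child-count : ∀ k → κ ≡ suc k → k * # (λ χ → good β α χ ∧ on β α χ i) ≡ # (λ χ → good β α χ ∧ on β α χ j)
      child-count k refl = sym (begin
        # gj
          ≡⟨ ∑-cong (colourings m) (λ χ → when-cong (gj χ) (λ w → sym (one-colour χ w))) ⟩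
        ∑ (colourings m) (λ χ → when (gj χ) (∑ (allFin κ) (λ γ → when (lookup χ i == γ) (when (not (c₀ == γ)) 1))))
          ≡⟨ ∑-cong (colourings m) (λ χ → trans (∑-when (gj χ) (allFin κ) _) (∑-cong (allFin κ) (λ γ → rearrange (gj χ) (lookup χ i == γ) (not (c₀ == γ))))) ⟩
        ∑ (colourings m) (λ χ → ∑ (allFin κ) (λ γ → when (not (c₀ == γ)) (when (withColour γ χ) 1)))
          ≡⟨ ∑-swap (colourings m) (allFin κ) _ ⟩
        ∑ (allFin κ) (λ γ → ∑ (colourings m) (λ χ → when (not (c₀ == γ)) (when (withColour γ χ) 1)))
          ≡⟨ ∑-cong (allFin κ) (λ γ → sym (∑-when (not (c₀ == γ)) (colourings m) _)) ⟩
        ∑ (allFin κ) (λ γ → when (not (c₀ == γ)) (# (withColour γ)))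
          ≡⟨ ∑-cong (allFin κ) (λ γ → when-cong (not (c₀ == γ)) (λ w → recoloured γ (λ eq → ==-false⁻¹ (not-true {c₀ == γ} w) (sym eq)))) ⟩
        ∑ (allFin κ) (λ γ → when (not (c₀ == γ)) (# (withColour c₁)))
          ≡⟨ ∑-const (λ γ → not (c₀ == γ)) (allFin κ) _ ⟩
        ∑ (allFin κ) (λ γ → when (not (c₀ == γ)) 1) * # (withColour c₁)
          ≡⟨ cong₂ _*_ others (∑-cong (colourings m) (λ χ → cong (λ b → when b 1) (sym (on-child χ)))) ⟩
        k * # (λ χ → good β α χ ∧ on β α χ i) ∎)
        where
        open ≡-Reasoning
        gj : Colouring m → Bool
        gj χ = good β α χ ∧ on β α χ j
        one-colour : ∀ χ → gj χ ≡ true → ∑ (allFin κ) (λ γ → when (lookup χ i == γ) (when (not (c₀ == γ)) 1)) ≡ 1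
        one-colour χ w = trans (∑-δ (lookup χ i) _) (cong (λ b → when (not b) 1) (==-false (λ eq → colour-≢ w (sym eq))))
        rearrange : ∀ a b c → when a (when b (when c 1)) ≡ when c (when (a ∧ b) 1)
        rearrange true  true  c = refl
        rearrange true  false true  = refl
        rearrange true  false false = refl
        rearrange false b     true  = refl
        rearrange false b     false = refl
        others : ∑ (allFin κ) (λ γ → when (not (c₀ == γ)) 1) ≡ k
        others = +-cancelʳ-≡ 1 _ _ (trans (trans (cong (∑ (allFin κ) (λ γ → when (not (c₀ == γ)) 1) +_) (sym (∑-δ c₀ (λ _ → 1)))) (∑-not (c₀ ==_))) (+-comm 1 k))

    -- Here the swap acts on the whole tree of `v`. No edge leaves a tree, so any two colours may be
    -- exchanged and all `κ` colours of `i` are equally likely; `u` lies in another tree, so `β`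
    -- stays free at `u`.
    module TopEdge (β : Fin κ) (i : Fin m) (top-i : pn i ≡ v) where

      inside : Fin m → Bool
      inside l = rep (pn l) == rep v

      base : Colouring m → Bool
      base χ = proper es χ ∧ not (used es χ u β)

      withColour : Fin κ → Colouring m → Bool
      withColour c χ = base χ ∧ (lookup χ i == c)

      swap-colour : ∀ a b χ → withColour a χ ≡ true → withColour b (swapOn inside a b χ) ≡ true
      swap-colour a b χ w = ∧-intro (∧-intro (proper-complete es _ (swapOn-proper inside a b χ es pr separated)) (cong not (used-false⁺ es _ u β free-u)))
        (==-complete (trans (swapOn-inside inside a b χ (==-complete (cong rep top-i))) (trans (cong (transpose a b) (==-true (proj₂ (∧-true {base χ} w)))) (transpose-left a b))))
        where
        bs : base χ ≡ true
        bs = proj₁ (∧-true w)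
        pr : Proper es χ
        pr = proper-sound es χ (proj₁ (∧-true bs))
        separated : ∀ l l′ x → Inc es l x → Inc es l′ x → inside l ≡ true → inside l′ ≡ false →
                    ¬ lookup χ l′ ≡ a × ¬ lookup χ l′ ≡ b
        separated l l′ x Il Il′ inl outl′ = ⊥-elim (==-false⁻¹ outl′ (trans (sym (inc-rep Il′)) (trans (inc-rep Il) (==-true inl))))
        free-u : ∀ l → Inc es l u → ¬ lookup (swapOn inside a b χ) l ≡ β
        free-u = unchanged-u {χ} {swapOn inside a b χ} (λ l r → swapOn-outside inside a b χ (==-false r))
          (used-false es χ u β (not-true (proj₂ (∧-true {proper es χ} bs))))

      top-count : κ * # (withColour β) ≡ # base
      top-count = sym (begin
        # base
          ≡⟨ ∑-cong (colourings m) (λ χ → cong (when (base χ)) (sym (∑-δ (lookup χ i) (λ _ → 1)))) ⟩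
        ∑ (colourings m) (λ χ → when (base χ) (∑ (allFin κ) (λ γ → when (lookup χ i == γ) 1)))
          ≡⟨ ∑-cong (colourings m) (λ χ → trans (∑-when (base χ) (allFin κ) _) (∑-cong (allFin κ) (λ γ → sym (when-∧ (base χ) (lookup χ i == γ) 1)))) ⟩
        ∑ (colourings m) (λ χ → ∑ (allFin κ) (λ γ → when (withColour γ χ) 1))
          ≡⟨ ∑-swap (colourings m) (allFin κ) _ ⟩
        ∑ (allFin κ) (λ γ → # (withColour γ))
          ≡⟨ ∑-cong (allFin κ) (λ γ → recoloured γ) ⟩
        ∑ (allFin κ) (λ γ → # (withColour β))
          ≡⟨ ∑-const (λ _ → true) (allFin κ) _ ⟩
        ∑ (allFin κ) (λ γ → 1) * # (withColour β)
          ≡⟨ cong (_* # (withColour β)) (∑-1-allFin κ) ⟩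
        κ * # (withColour β) ∎)
        where
        open ≡-Reasoning
        recoloured : ∀ γ → # (withColour γ) ≡ # (withColour β)
        recoloured γ = reindex (swapOn inside γ β) (swapOn inside β γ) (withColour γ) (withColour β)
          (λ χ w → swap-colour γ β χ w , swapOn-cancel inside γ β χ)
          (λ χ w → swap-colour β γ χ w , swapOn-cancel inside β γ χ)
          (λ _ → 1)

      -- For an edge at `v` the chain condition only concerns its own colour, so `α` still ranges
      -- over all colours free at `v`.
      all-α : ∑ (allFin κ) (λ α → # (λ χ → good β α χ ∧ on β α χ i)) ≡ # (withColour β) * free es v
      all-α = begin
        ∑ (allFin κ) (λ α → # (λ χ → good β α χ ∧ on β α χ i))
          ≡⟨ ∑-swap (allFin κ) (colourings m) _ ⟩
        ∑ (colourings m) (λ χ → ∑ (allFin κ) (λ α → when (good β α χ ∧ on β α χ i) 1))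
          ≡⟨ ∑-cong (colourings m) (λ χ → trans (∑-cong (allFin κ) (λ α → pointwise χ α)) (sym (∑-when (withColour β χ) (allFin κ) _))) ⟩
        ∑ (colourings m) (λ χ → when (withColour β χ) (∑ (allFin κ) (λ α → when (not (used es χ v α)) 1)))
          ≡⟨ ∑-cong (colourings m) (λ χ → when-cong (withColour β χ) (λ w → free-count es χ v (proj₁ (∧-true (proj₁ (∧-true w)))))) ⟩
        ∑ (colourings m) (λ χ → when (withColour β χ) (free es v))
          ≡⟨ ∑-const (withColour β) (colourings m) _ ⟩
        # (withColour β) * free es v ∎
        where
        open ≡-Reasoning
        on-top : ∀ α χ → on β α χ i ≡ (lookup χ i == β)
        on-top α χ rewrite trans (cong dep top-i) root | ==-complete top-i = refl
        rearrange : ∀ p a b c → when ((p ∧ a ∧ b) ∧ c) 1 ≡ when ((p ∧ a) ∧ c) (when b 1)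
        rearrange true  true  true  c     = refl
        rearrange true  true  false true  = refl
        rearrange true  true  false false = refl
        rearrange true  false b     c     = refl
        rearrange false a     b     c     = refl
        pointwise : ∀ χ α → when (good β α χ ∧ on β α χ i) 1 ≡ when (withColour β χ) (when (not (used es χ v α)) 1)
        pointwise χ α rewrite on-top α χ = rearrange (proper es χ) (not (used es χ u β)) (not (used es χ v α)) (lookup χ i == β)

    all-β : ∑ (allFin κ) (λ β → # (λ χ → proper es χ ∧ not (used es χ u β))) ≡ # (proper es) * free es u
    all-β = begin
      ∑ (allFin κ) (λ β → # (λ χ → proper es χ ∧ not (used es χ u β)))
        ≡⟨ ∑-swap (allFin κ) (colourings m) _ ⟩
      ∑ (colourings m) (λ χ → ∑ (allFin κ) (λ β → when (proper es χ ∧ not (used es χ u β)) 1))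
        ≡⟨ ∑-cong (colourings m) (λ χ → trans (∑-cong (allFin κ) (λ β → when-∧ (proper es χ) _ 1)) (sym (∑-when (proper es χ) (allFin κ) _))) ⟩
      ∑ (colourings m) (λ χ → when (proper es χ) (∑ (allFin κ) (λ β → when (not (used es χ u β)) 1)))
        ≡⟨ ∑-cong (colourings m) (λ χ → when-cong (proper es χ) (free-count es χ u)) ⟩
      ∑ (colourings m) (λ χ → when (proper es χ) (free es u))
        ≡⟨ ∑-const (proper es) (colourings m) _ ⟩
      # (proper es) * free es u ∎
      where open ≡-Reasoning

    -- Up to normalisation, the probability that the insertion recolours edge i.
    hits : Fin m → ℕ
    hits i = ∑ (allFin κ) (λ β → ∑ (allFin κ) (λ α → # (λ χ → good β α χ ∧ on β α χ i)))

    hits-outside : ∀ i → ¬ rep (pn i) ≡ rep v → hits i ≡ 0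
    hits-outside i r = trans (∑-cong (allFin κ) (λ β → trans (∑-cong (allFin κ) (λ α →
        trans (∑-cong (colourings m) (λ χ → cong (λ b → when b 1) (never β α χ))) (∑-𝟘 (colourings m)))) (∑-𝟘 (allFin κ)))) (∑-𝟘 (allFin κ))
      where
      never : ∀ β α χ → good β α χ ∧ on β α χ i ≡ false
      never β α χ with good β α χ | on β α χ i in eq
      ... | _     | true  = ⊥-elim (r (chain-rep (on-sound eq)))
      ... | true  | false = refl
      ... | false | false = refl

    hits-top : ∀ i → pn i ≡ v → κ * hits i ≡ free es u * free es v * # (proper es)
    hits-top i p = begin
      κ * hits i
        ≡⟨ cong (κ *_) (∑-cong (allFin κ) (λ β → TopEdge.all-α β i p)) ⟩
      κ * ∑ (allFin κ) (λ β → # (TopEdge.withColour β i p β) * free es v)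
        ≡⟨ ∑-*ˡ κ (allFin κ) _ ⟩
      ∑ (allFin κ) (λ β → κ * (# (TopEdge.withColour β i p β) * free es v))
        ≡⟨ ∑-cong (allFin κ) (λ β → trans (sym (*-assoc κ _ (free es v))) (trans (cong (_* free es v) (TopEdge.top-count β i p)) (*-comm _ (free es v)))) ⟩
      ∑ (allFin κ) (λ β → free es v * # (λ χ → proper es χ ∧ not (used es χ u β)))
        ≡⟨ sym (∑-*ˡ (free es v) (allFin κ) _) ⟩
      free es v * ∑ (allFin κ) (λ β → # (λ χ → proper es χ ∧ not (used es χ u β)))
        ≡⟨ cong (free es v *_) all-β ⟩
      free es v * (# (proper es) * free es u)
        ≡⟨ trans (cong (free es v *_) (*-comm (# (proper es)) (free es u))) (trans (sym (*-assoc (free es v) (free es u) _)) (cong (_* # (proper es)) (*-comm (free es v) (free es u)))) ⟩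
      free es u * free es v * # (proper es) ∎
      where open ≡-Reasoning

    hits-child : ∀ k → κ ≡ suc k → ∀ i j → ce j ≡ pn i → k * hits i ≡ hits j
    hits-child k eq i j p = trans (∑-*ˡ k (allFin κ) _) (∑-cong (allFin κ) (λ β →
      trans (∑-*ˡ k (allFin κ) _) (∑-cong (allFin κ) (λ α → Subtree.child-count β α i j p k eq))))

    -- The probability `1 / (κ * k ^ d)` without division. The right side counts all triples of a
    -- proper colouring, a colour free at `u` and a colour free at `v`; each step down divides
    -- `hits` by `k`.
    hits-weight : ∀ k → κ ≡ suc k → ∀ i → rep (pn i) ≡ rep v →
                  k ^ dep (pn i) * (κ * hits i) ≡ free es u * free es v * # (proper es)
    hits-weight k eq i r = go (dep (pn i)) i refl r
      where
      go : ∀ d i → dep (pn i) ≡ d → rep (pn i) ≡ rep v → k ^ d * (κ * hits i) ≡ free es u * free es v * # (proper es)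
      go zero    i dp r = trans (+-identityʳ _) (hits-top i (top-unique (pn i) dp r))
      go (suc d) i dp r with parent (pn i) (λ z → 1+n≢0 (trans (sym dp) z))
      ... | j , p = begin
        k * k ^ d * (κ * hits i)    ≡⟨ cong (_* (κ * hits i)) (*-comm k (k ^ d)) ⟩
        k ^ d * k * (κ * hits i)    ≡⟨ *-assoc (k ^ d) k _ ⟩
        k ^ d * (k * (κ * hits i))  ≡⟨ cong (k ^ d *_) (trans (sym (*-assoc k κ _)) (trans (cong (_* hits i) (*-comm k κ)) (*-assoc κ k _))) ⟩
        k ^ d * (κ * (k * hits i))  ≡⟨ cong (λ z → k ^ d * (κ * z)) (hits-child k eq i j p) ⟩
        k ^ d * (κ * hits j)        ≡⟨ go d j (suc-injective (trans (sym (child-dep p)) dp)) (trans (sym (rep-edge j)) (trans (cong rep p) r)) ⟩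
        free es u * free es v * # (proper es) ∎
        where open ≡-Reasoning

  -- The effect of one insertion

  module InsertTree {m} (es : Edges m) (rep : Fin n → Fin n) (u v : Fin n) (R : Rooted es rep v) (u≁v : ¬ rep u ≡ rep v) where
    open Rooted R
    open Tree es rep u v R u≁v
    open CountTree es rep u v R u≁v

    u≢v : ¬ u ≡ v
    u≢v eq = u≁v (cong rep eq)

    module Walk (β α : Fin κ) (χ : Colouring m) (pr : Proper es χ) where

      -- By induction two chain edges of equal depth have the same parent edge, hence start at the
      -- same vertex, where properness separates colours.
      chain-unique : ∀ {i j} → Chain β α χ i → Chain β α χ j → dep (pn i) ≡ dep (pn j) → i ≡ j
      chain-unique {i} {j} (top p q) (top r s) _ =
        pr i j v (subst (Inc es i) p (inc-pn i)) (subst (Inc es j) r (inc-pn j)) (trans q (sym s))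
      chain-unique (top p _) (step k r _ _) eq with () ← trans (sym (trans (cong dep p) root)) (trans eq (child-dep r))
      chain-unique (step k r _ _) (top p _) eq with () ← trans (sym (trans (cong dep p) root)) (trans (sym eq) (child-dep r))
      chain-unique {i} {j} (step k p c q) (step l r d s) eq =
        pr i j (pn i) (inc-pn i) (subst (Inc es j) (trans (sym r) (trans (cong ce (sym k≡l)) p)) (inc-pn j))
          (trans q (trans (cong (alternate β α) eq) (sym s)))
        where
        k≡l : k ≡ l
        k≡l = chain-unique c d (suc-injective (trans (sym (child-dep p)) (trans eq (child-dep r))))

      within : ℕ → Fin m → Bool
      within d i = on β α χ i ∧ ⌊ dep (pn i) ℕ.≤? d ⌋

      -- The colouring at the moment when the walk has treated the chain edges whose parent end has
      -- depth at most `d`.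
      partial : ℕ → Colouring m
      partial d = swapOn (within d) α β χ

      within-true : ∀ {d i} → Chain β α χ i → dep (pn i) ≤ d → within d i ≡ true
      within-true {d} {i} c le rewrite on-complete c with dep (pn i) ℕ.≤? d
      ... | yes _ = refl
      ... | no q  = ⊥-elim (q le)

      within-deep : ∀ {d i} → d < dep (pn i) → within d i ≡ false
      within-deep {d} {i} lt with dep (pn i) ℕ.≤? d
      ... | yes q = ⊥-elim (<⇒≱ lt q)
      ... | no _  = ∧-zeroʳ (on β α χ i)

      within-off : ∀ {d i} → on β α χ i ≡ false → within d i ≡ false
      within-off eq rewrite eq = refl

      partial-on : ∀ {d i} → Chain β α χ i → dep (pn i) ≤ d → lookup (partial d) i ≡ alternate α β (dep (pn i))
      partial-on {d} {i} c le = trans (swapOn-inside (within d) α β χ (within-true c le))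
        (trans (cong (transpose α β) (chain-colour c)) (alternate-transpose β α (dep (pn i))))

      partial-deep : ∀ {d i} → d < dep (pn i) → lookup (partial d) i ≡ lookup χ i
      partial-deep {d} lt = swapOn-outside (within d) α β χ (within-deep lt)

      -- By `chain-unique`, `i` is the only chain edge on its level, so a single recolouring
      -- advances the whole description.
      partial-suc : ∀ {d i} → Chain β α χ i → dep (pn i) ≡ suc d → partial d [ i ]≔ alternate β α d ≡ partial (suc d)
      partial-suc {d} {i} c dp = lookup-ext pointwise
        where
        pointwise : ∀ l → lookup (partial d [ i ]≔ alternate β α d) l ≡ lookup (partial (suc d)) l
        pointwise l with l Fin.≟ i
        ... | yes refl = trans (lookup∘update l (partial d) _)
                (sym (trans (partial-on c (≤-reflexive dp)) (cong (alternate α β) dp)))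
        ... | no l≢i with on β α χ l in onl
        ...   | false = trans (lookup∘update′ l≢i (partial d) _)
                  (trans (swapOn-outside (within d) α β χ (within-off onl)) (sym (swapOn-outside (within (suc d)) α β χ (within-off onl))))
        ...   | true with dep (pn l) ℕ.≤? d
        ...     | yes le = trans (lookup∘update′ l≢i (partial d) _)
                    (trans (partial-on (on-sound onl) le) (sym (partial-on (on-sound onl) (m≤n⇒m≤1+n le))))
        ...     | no nle = trans (lookup∘update′ l≢i (partial d) _) (trans (partial-deep (≰⇒> nle))
                    (sym (partial-deep (≤∧≢⇒< (≰⇒> nle) (λ eq → l≢i (chain-unique (on-sound onl) c (trans (sym eq) (sym dp))))))))

      partial-zero : ∀ {i} → pn i ≡ v → lookup χ i ≡ β → χ [ i ]≔ α ≡ partial 0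
      partial-zero {i} p q = lookup-ext pointwise
        where
        dp : dep (pn i) ≡ 0
        dp = trans (cong dep p) root
        pointwise : ∀ l → lookup (χ [ i ]≔ α) l ≡ lookup (partial 0) l
        pointwise l with l Fin.≟ i
        ... | yes refl = trans (lookup∘update l χ α) (sym (trans (partial-on (top p q) (≤-reflexive dp)) (cong (alternate α β) dp)))
        ... | no l≢i with on β α χ l in onl
        ...   | false = trans (lookup∘update′ l≢i χ α) (sym (swapOn-outside (within 0) α β χ (within-off onl)))
        ...   | true = trans (lookup∘update′ l≢i χ α) (sym (partial-deep
                  (n≢0⇒n>0 (λ eq → l≢i (chain-unique (on-sound onl) (top p q) (trans eq (sym dp)))))))

      module _ (c₀ : Fin κ) where

        tl : St
        tl = (u , v , c₀) ∷ []

        -- The inserted edge is never mistaken for a child edge: it either misses `x` or leads from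
        -- `x` to the parent.
        childWith-tl : ∀ p x c → ¬ u ≡ x → (v ≡ x → u ≡ p) → childWith tl p x c ≡ nothing
        childWith-tl p x c u≢x v≡x rewrite ==-false u≢x with v Fin.≟ x
        ... | no _     = refl
        ... | yes v≡x′ rewrite ==-complete (v≡x v≡x′) = refl

        -- The vertex `ce j` has depth `suc d`, and depths stay below `n`, so the inequality on the
        -- fuel shows that `k` never reaches `0`.
        walk : ∀ k d j → Chain β α χ j → dep (pn j) ≡ d → n ≤ k + suc d →
               fixForbidden k (mk es (partial d) ++ tl) (pn j) (ce j) (alternate β α d) (alternate α β d)
               ≡ mk es (kempe β α χ) ++ tl
        walk zero d j c dp fuel = ⊥-elim (<⇒≱ (dep<n (ce j)) (≤-trans fuel (≤-reflexive (sym (trans (depth j) (cong suc dp))))))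
        walk (suc k) d j c dp fuel with childWith (mk es (partial d) ++ tl) (pn j) (ce j) (alternate α β d) in eq
        ... | nothing = cong (λ ψ → mk es ψ ++ tl) (lookup-ext pointwise)
          where
          shallow : ∀ {i} → Chain β α χ i → dep (pn i) ≤ d
          shallow (top p _) = ≤-trans (≤-reflexive (trans (cong dep p) root)) z≤n
          -- By induction the parent edge `l` has depth at most `d`. If it had depth `d`, it would
          -- be `j`, and the search that stopped would have found `i`.
          shallow {i} (step l p c′ q) with dep (pn l) ℕ.<? d
          ... | yes lt = ≤-trans (≤-reflexive (child-dep p)) lt
          ... | no ≮d with refl ← chain-unique c′ c (trans (≤-antisym (shallow c′) (≮⇒≥ ≮d)) (sym dp)) =
            ⊥-elim (childWith-nothing (mk es (partial d)) (pn j) (ce j) (alternate α β d) (ce i) stop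
              (Any-mk⁺ es (partial d) i (Joins⇒ChildEdge es (partial d) i (subst (λ x → Joins es i x (ce i)) (sym p) (joins i))
                (λ e → not-opposite i j (sym p) e) (trans (partial-deep (≤-reflexive (sym di))) (trans q (cong (alternate β α) di))))))
            where
            di : dep (pn i) ≡ suc d
            di = trans (child-dep p) (cong suc dp)
            stop : childWith (mk es (partial d)) (pn j) (ce j) (alternate α β d) ≡ nothing
            stop = trans (sym (childWith-++ (mk es (partial d)) tl (pn j) (ce j) (alternate α β d)
              (childWith-tl (pn j) (ce j) (alternate α β d) (λ e → u≁v (trans (cong rep e) (trans (rep-edge j) (chain-rep c))))
                (λ e → ⊥-elim (ce≢root j (sym e)))))) eq
          pointwise : ∀ l → lookup (partial d) l ≡ lookup (kempe β α χ) l
          pointwise l with on β α χ l in onl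
          ... | false = trans (swapOn-outside (within d) α β χ (within-off onl)) (sym (kempe-outside onl))
          ... | true  = trans (partial-on (on-sound onl) (shallow (on-sound onl))) (sym (kempe-on (on-sound onl)))
        ... | just w with Any-mk⁻ es (partial d) (childWith-just (mk es (partial d)) (pn j) (ce j) (alternate α β d) w go)
          where
          go : childWith (mk es (partial d)) (pn j) (ce j) (alternate α β d) ≡ just w
          go = trans (sym (childWith-++ (mk es (partial d)) tl (pn j) (ce j) (alternate α β d)
              (childWith-tl (pn j) (ce j) (alternate α β d) (λ e → u≁v (trans (cong rep e) (trans (rep-edge j) (chain-rep c))))
                (λ e → ⊥-elim (ce≢root j (sym e)))))) eq
        ...   | i , ch with ChildEdge⇒Joins es (partial d) i ch
        ...     | ji , w≢ , col with joins-ends ji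
        -- The edge found cannot be the one leading up, since the search excludes the parent.
        ...       | inj₂ (p , q) = ⊥-elim (w≢ (trans q (cong pn (ce-inj (sym p)))))
        ...       | inj₁ (p , refl) = begin
          fixForbidden k (recolor (mk es (partial d) ++ tl) (ce j) (ce i) (alternate β α d)) (ce j) (ce i) (alternate α β d) (alternate β α d)
            ≡⟨ cong (λ st → fixForbidden k st (ce j) (ce i) (alternate α β d) (alternate β α d)) recoloured ⟩
          fixForbidden k (mk es (partial (suc d)) ++ tl) (ce j) (ce i) (alternate α β d) (alternate β α d)
            ≡⟨ cong (λ x → fixForbidden k (mk es (partial (suc d)) ++ tl) x (ce i) (alternate α β d) (alternate β α d)) p ⟩
          fixForbidden k (mk es (partial (suc d)) ++ tl) (pn i) (ce i) (alternate α β d) (alternate β α d)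
            ≡⟨ walk k (suc d) i ci di (≤-trans fuel (≤-reflexive (sym (+-suc k (suc d))))) ⟩
          mk es (kempe β α χ) ++ tl ∎
          where
          open ≡-Reasoning
          di : dep (pn i) ≡ suc d
          di = trans (child-dep p) (cong suc dp)
          ci : Chain β α χ i
          ci = extend j p c (trans (trans (sym (partial-deep (≤-reflexive (sym di)))) col) (cong (alternate α β) (sym dp)))
          recoloured : recolor (mk es (partial d) ++ tl) (ce j) (ce i) (alternate β α d) ≡ mk es (partial (suc d)) ++ tl
          recoloured = trans (recolor-++ˡ (mk es (partial d)) tl (ce j) (ce i) (alternate β α d) (Any-mk⁺ es (partial d) i (Joins⇒EdgeOf es (partial d) i _ _ ji)))
            (cong (_++ tl) (trans (recolor-mk es (partial d) i _ _ (alternate β α d) ji (λ l jl → joins-unique jl ji)) (cong (mk es) (partial-suc ci di))))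

        walk-root : ∀ i w → Joins es i v w → lookup χ i ≡ β →
                    fixForbidden n (recolor (mk es χ ++ tl) v w α) v w β α ≡ mk es (kempe β α χ) ++ tl
        walk-root i w ji q with joins-ends ji
        ... | inj₂ (p , _) = ⊥-elim (ce≢root i (sym p))
        ... | inj₁ (p , refl) = begin
          fixForbidden n (recolor (mk es χ ++ tl) v (ce i) α) v (ce i) β α
            ≡⟨ cong₂ (λ st x → fixForbidden n st x (ce i) β α) recoloured p ⟩
          fixForbidden n (mk es (partial 0) ++ tl) (pn i) (ce i) β α
            ≡⟨ walk n 0 i (top (sym p) q) (trans (cong dep (sym p)) root) (m≤m+n n 1) ⟩
          mk es (kempe β α χ) ++ tl ∎
          where
          open ≡-Reasoning
          recoloured : recolor (mk es χ ++ tl) v (ce i) α ≡ mk es (partial 0) ++ tl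
          recoloured = trans (recolor-++ˡ (mk es χ) tl v (ce i) α (Any-mk⁺ es χ i (Joins⇒EdgeOf es χ i _ _ ji)))
            (cong (_++ tl) (trans (recolor-mk es χ i _ _ α ji (λ l jl → joins-unique jl ji)) (cong (mk es) (partial-zero (sym p) q))))

    es′ : Edges (suc m)
    es′ = (u , v) ∷ es

    length-avail : ∀ {χ} → proper es χ ≡ true → ∀ x → length (avail (mk es χ) x) ≡ free es x
    length-avail {χ} pr x = trans (length-filterᵇ-allFin (λ c → not (used es χ x c))) (free-count es χ x pr)

    childWith-root : ∀ χ β → childWith (mk es χ ++ (u , v , β) ∷ []) u v β ≡ childWith (mk es χ) u v β
    childWith-root χ β = childWith-++ (mk es χ) _ u v β last
      where
      last : childWith ((u , v , β) ∷ []) u v β ≡ nothing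
      last rewrite ==-false u≢v | ==-refl v | ==-refl u = refl

    rootToChild-free : ∀ χ β → used es χ v β ≡ false → rootToChild (mk es′ (β ∷ χ)) u v β ≡ ret (mk es′ (β ∷ χ))
    rootToChild-free χ β us with childWith (mk es χ ++ (u , v , β) ∷ []) u v β in eq
    ... | nothing = refl
    ... | just w with Any-mk⁻ es χ (childWith-just (mk es χ) u v β w (trans (sym (childWith-root χ β)) eq))
    ...   | i , ch with ChildEdge⇒Joins es χ i ch
    ...     | ji , _ , q = ⊥-elim (used-false es χ v β us i (w , ji) q)

    rootToChild-used : ∀ χ β (h : St → ℚ) → proper es χ ≡ true → used es χ v β ≡ true → 0 < free es v →
      toℚ (free es v) ℚ.* 𝔼 (rootToChild (mk es′ (β ∷ χ)) u v β) h
      ≡ ∑ℚ (allFin κ) (λ α → whenℚ (not (used es χ v α)) (h (mk es′ (β ∷ kempe β α χ))))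
    rootToChild-used χ β h pr us fr with childWith (mk es χ ++ (u , v , β) ∷ []) u v β in eq
    ... | nothing with (i , (w , ji) , q) ← used-sound es χ v β us =
      ⊥-elim (childWith-nothing (mk es χ) u v β w (trans (sym (childWith-root χ β)) eq)
        (Any-mk⁺ es χ i (Joins⇒ChildEdge es χ i ji (λ w≡u → u≁v (trans (cong rep (sym w≡u)) (sameTree i w ji))) q)))
      where
      sameTree : ∀ i w → Joins es i v w → rep w ≡ rep v
      sameTree i w ji with joins-ends ji
      ... | inj₁ (p , r) = trans (cong rep r) (trans (rep-edge i) (cong rep (sym p)))
      ... | inj₂ (p , r) = trans (cong rep r) (trans (sym (rep-edge i)) (cong rep (sym p)))
    ... | just w with Any-mk⁻ es χ (childWith-just (mk es χ) u v β w (trans (sym (childWith-root χ β)) eq))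
    ...   | i , ch with ChildEdge⇒Joins es χ i ch
    ...     | ji , _ , q = trans (𝔼-uniformFrom (avail (mk es′ (β ∷ χ)) v) _ h length-avail′ fr) (begin
      ∑ℚ (avail (mk es′ (β ∷ χ)) v) (λ α → h (fixForbidden n (recolor (mk es′ (β ∷ χ)) v w α) v w β α))
        ≡⟨ ℚ∑.∑-filterᵇ (λ α → not (used es′ (β ∷ χ) v α)) (allFin κ) _ ⟩
      ∑ℚ (allFin κ) (λ α → whenℚ (not (used es′ (β ∷ χ) v α)) (h (fixForbidden n (recolor (mk es′ (β ∷ χ)) v w α) v w β α)))
        ≡⟨ ℚ∑.∑-cong (allFin κ) (λ α → cong₂ (λ b st → whenℚ (not b) (h st)) (same-used α)
             (Walk.walk-root β α χ (proper-sound es χ pr) β i w ji q)) ⟩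
      ∑ℚ (allFin κ) (λ α → whenℚ (not (used es χ v α)) (h (mk es′ (β ∷ kempe β α χ)))) ∎)
      where
      open ≡-Reasoning
      -- `β` is used at `v` before the insertion, so the new edge does not change the set of colours
      -- free at `v`.
      same-used : ∀ α → used es′ (β ∷ χ) v α ≡ used es χ v α
      same-used α = trans (used-cons u v es β χ v α) (absorb (β Fin.≟ α))
        where
        absorb : Dec (β ≡ α) → used es χ v α ∨ (((u == v) ∨ (v == v)) ∧ (β == α)) ≡ used es χ v α
        absorb (yes refl) rewrite us = refl
        absorb (no β≢α) rewrite ==-false β≢α | ∧-zeroʳ ((u == v) ∨ (v == v)) = ∨-identityʳ _
      length-avail′ : length (avail (mk es′ (β ∷ χ)) v) ≡ free es v
      length-avail′ = trans (length-filterᵇ-allFin (λ c → not (used es′ (β ∷ χ) v c)))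
        (trans (∑-cong (allFin κ) (λ c → cong (λ b → when (not b) 1) (same-used c))) (free-count es χ v pr))

    -- Both random choices are cleared of denominators. Without a conflict no `α` is drawn, so that
    -- term keeps the factor `free es v`.
    insert-𝔼 : ∀ χ x y (h : St → ℚ) → orient (mk es χ) x y ≡ (u , v) → proper es χ ≡ true → 0 < free es u → 0 < free es v →
      toℚ (free es v) ℚ.* (toℚ (free es u) ℚ.* 𝔼 (insert (mk es χ) x y) h)
      ≡ ∑ℚ (allFin κ) (λ β → whenℚ (not (used es χ u β))
          (whenℚ (used es χ v β) (∑ℚ (allFin κ) (λ α → whenℚ (not (used es χ v α)) (h (mk es′ (β ∷ kempe β α χ)))))
           ℚ.+ whenℚ (not (used es χ v β)) (toℚ (free es v) ℚ.* h (mk es′ (β ∷ χ)))))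
    insert-𝔼 χ x y h or pr fu fv with orient (mk es χ) x y | or
    ... | _ | refl = trans (cong (toℚ (free es v) ℚ.*_) (𝔼-uniformFrom (avail (mk es χ) u) _ h (length-avail pr u) fu)) (begin
      F ℚ.* ∑ℚ (avail (mk es χ) u) (λ β → 𝔼 (rootToChild (mk es′ (β ∷ χ)) u v β) h)
        ≡⟨ cong (F ℚ.*_) (ℚ∑.∑-filterᵇ (λ β → not (used es χ u β)) (allFin κ) _) ⟩
      F ℚ.* ∑ℚ (allFin κ) (λ β → whenℚ (not (used es χ u β)) (𝔼 (rootToChild (mk es′ (β ∷ χ)) u v β) h))
        ≡⟨ ∑ℚ-*ˡ F (allFin κ) _ ⟩
      ∑ℚ (allFin κ) (λ β → F ℚ.* whenℚ (not (used es χ u β)) (𝔼 (rootToChild (mk es′ (β ∷ χ)) u v β) h))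
        ≡⟨ ℚ∑.∑-cong (allFin κ) (λ β → trans (when-*ℚ (not (used es χ u β)) F _) (cong (whenℚ (not (used es χ u β))) (branch β))) ⟩
      ∑ℚ (allFin κ) (λ β → whenℚ (not (used es χ u β))
          (whenℚ (used es χ v β) (∑ℚ (allFin κ) (λ α → whenℚ (not (used es χ v α)) (h (mk es′ (β ∷ kempe β α χ)))))
           ℚ.+ whenℚ (not (used es χ v β)) (F ℚ.* h (mk es′ (β ∷ χ))))) ∎)
      where
      open ≡-Reasoning
      F : ℚ
      F = toℚ (free es v)
      branch : ∀ β → F ℚ.* 𝔼 (rootToChild (mk es′ (β ∷ χ)) u v β) h
        ≡ whenℚ (used es χ v β) (∑ℚ (allFin κ) (λ α → whenℚ (not (used es χ v α)) (h (mk es′ (β ∷ kempe β α χ)))))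
          ℚ.+ whenℚ (not (used es χ v β)) (F ℚ.* h (mk es′ (β ∷ χ)))
      branch β with used es χ v β in us
      ... | true  = trans (rootToChild-used χ β h pr us fv) (sym (ℚ.+-identityʳ _))
      ... | false = trans (cong (λ r → F ℚ.* 𝔼 r h) (rootToChild-free χ β us)) (sym (ℚ.+-identityˡ _))

    module _ (x y : Fin n) (oriented : ∀ χ → orient (mk es χ) x y ≡ (u , v)) (fu : 0 < free es u) (fv : 0 < free es v) where

      private
        cs : List (Colouring m)
        cs = colourings m
        ks : List (Fin κ)
        ks = allFin κ
        Fu Fv : ℚ
        Fu = toℚ (free es u)
        Fv = toℚ (free es v)

      -- Unnormalised: division by the number of proper colourings would give the expectation for a
      -- uniform one.
      average : (Colouring m → St → ℚ) → ℚ
      average h = ∑ℚ cs (λ χ → whenℚ (proper es χ) (𝔼 (insert (mk es χ) x y) (h χ)))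

      average-insert : ∀ h → Fv ℚ.* (Fu ℚ.* average h) ≡
        ∑ℚ ks (λ β → ∑ℚ ks (λ α → ∑ℚ cs (λ χ → whenℚ (conflict β β α χ) (h χ (mk es′ (β ∷ kempe β α χ))))))
        ℚ.+ ∑ℚ ks (λ β → ∑ℚ cs (λ χ → whenℚ (good β β χ) (Fv ℚ.* h χ (mk es′ (β ∷ χ)))))
      average-insert h = begin
        Fv ℚ.* (Fu ℚ.* average h)
          ≡⟨ cong (Fv ℚ.*_) (∑ℚ-*ˡ Fu cs _) ⟩
        Fv ℚ.* ∑ℚ cs (λ χ → Fu ℚ.* whenℚ (proper es χ) (E χ))
          ≡⟨ ∑ℚ-*ˡ Fv cs _ ⟩
        ∑ℚ cs (λ χ → Fv ℚ.* (Fu ℚ.* whenℚ (proper es χ) (E χ)))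
          ≡⟨ ℚ∑.∑-cong cs (λ χ → trans (cong (Fv ℚ.*_) (when-*ℚ (proper es χ) Fu (E χ))) (trans (when-*ℚ (proper es χ) Fv _)
               (ℚ∑.when-cong (proper es χ) (λ pr → insert-𝔼 χ x y (h χ) (oriented χ) pr fu fv)))) ⟩
        ∑ℚ cs (λ χ → whenℚ (proper es χ) (∑ℚ ks (λ β → whenℚ (not (used es χ u β)) (P χ β ℚ.+ Q χ β))))
          ≡⟨ ℚ∑.∑-cong cs (λ χ → trans (ℚ∑.∑-when (proper es χ) ks _) (trans (ℚ∑.∑-cong ks (λ β → pointwise χ β)) (ℚ∑.∑-⊕ ks _ _))) ⟩
        ∑ℚ cs (λ χ → ∑ℚ ks (λ β → ∑ℚ ks (λ α → K χ β α)) ℚ.+ ∑ℚ ks (λ β → G χ β))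
          ≡⟨ ℚ∑.∑-⊕ cs _ _ ⟩
        ∑ℚ cs (λ χ → ∑ℚ ks (λ β → ∑ℚ ks (λ α → K χ β α))) ℚ.+ ∑ℚ cs (λ χ → ∑ℚ ks (λ β → G χ β))
          ≡⟨ cong₂ ℚ._+_ (trans (ℚ∑.∑-swap cs ks _) (ℚ∑.∑-cong ks (λ β → ℚ∑.∑-swap cs ks (λ χ α → K χ β α)))) (ℚ∑.∑-swap cs ks _) ⟩
        ∑ℚ ks (λ β → ∑ℚ ks (λ α → ∑ℚ cs (λ χ → K χ β α))) ℚ.+ ∑ℚ ks (λ β → ∑ℚ cs (λ χ → G χ β)) ∎
        where
        open ≡-Reasoning
        E : Colouring m → ℚ
        E χ = 𝔼 (insert (mk es χ) x y) (h χ)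
        P Q G : Colouring m → Fin κ → ℚ
        P χ β = whenℚ (used es χ v β) (∑ℚ ks (λ α → whenℚ (not (used es χ v α)) (h χ (mk es′ (β ∷ kempe β α χ)))))
        Q χ β = whenℚ (not (used es χ v β)) (Fv ℚ.* h χ (mk es′ (β ∷ χ)))
        G χ β = whenℚ (good β β χ) (Fv ℚ.* h χ (mk es′ (β ∷ χ)))
        K : Colouring m → Fin κ → Fin κ → ℚ
        K χ β α = whenℚ (conflict β β α χ) (h χ (mk es′ (β ∷ kempe β α χ)))
        regroup : ∀ a b c d (z : ℚ) → whenℚ a (whenℚ b (whenℚ c (whenℚ d z))) ≡ whenℚ ((a ∧ b ∧ d) ∧ c) z
        regroup true  true  true  true  z = refl
        regroup true  true  true  false z = refl
        regroup true  true  false true  z = refl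
        regroup true  true  false false z = refl
        regroup true  false c     d     z = refl
        regroup false b     c     d     z = refl
        regroup₂ : ∀ a b c (z : ℚ) → whenℚ a (whenℚ b (whenℚ c z)) ≡ whenℚ (a ∧ b ∧ c) z
        regroup₂ true  true  c z = refl
        regroup₂ true  false c z = refl
        regroup₂ false b     c z = refl
        pointwise : ∀ χ β → whenℚ (proper es χ) (whenℚ (not (used es χ u β)) (P χ β ℚ.+ Q χ β)) ≡ ∑ℚ ks (λ α → K χ β α) ℚ.+ G χ β
        pointwise χ β = begin
          whenℚ p (whenℚ a (P χ β ℚ.+ Q χ β))
            ≡⟨ trans (cong (whenℚ p) (ℚ∑.when-⊕ a _ _)) (ℚ∑.when-⊕ p _ _) ⟩
          whenℚ p (whenℚ a (P χ β)) ℚ.+ whenℚ p (whenℚ a (Q χ β))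
            ≡⟨ cong₂ ℚ._+_
                 (trans (cong (λ z → whenℚ p (whenℚ a z)) (ℚ∑.∑-when (used es χ v β) ks _))
                   (trans (cong (whenℚ p) (ℚ∑.∑-when a ks _)) (trans (ℚ∑.∑-when p ks _)
                     (ℚ∑.∑-cong ks (λ α → regroup p a (used es χ v β) (not (used es χ v α)) _)))))
                 (regroup₂ p a (not (used es χ v β)) _) ⟩
          ∑ℚ ks (λ α → K χ β α) ℚ.+ G χ β ∎
          where
          p a : Bool
          p = proper es χ
          a = not (used es χ u β)

      ∑ℚ-const : (p : Fin κ → Bool) (a : ℚ) → ∑ℚ ks (λ c → whenℚ (p c) a) ≡ toℚ (∑ ks (λ c → when (p c) 1)) ℚ.* a
      ∑ℚ-const p a = begin
        ∑ℚ ks (λ c → whenℚ (p c) a)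
          ≡⟨ ℚ∑.∑-cong ks (λ c → sym (trans (when-*ℚ (p c) a 1ℚ) (cong (whenℚ (p c)) (ℚ.*-identityʳ a)))) ⟩
        ∑ℚ ks (λ c → a ℚ.* whenℚ (p c) 1ℚ)
          ≡⟨ sym (∑ℚ-*ˡ a ks _) ⟩
        a ℚ.* ∑ℚ ks (λ c → whenℚ (p c) 1ℚ)
          ≡⟨ cong (a ℚ.*_) (sym (trans (toℚ-∑ ks _) (ℚ∑.∑-cong ks (λ c → trans (toℚ-when (p c) 1) (cong (whenℚ (p c)) toℚ-1))))) ⟩
        a ℚ.* toℚ (∑ ks (λ c → when (p c) 1))
          ≡⟨ ℚ.*-comm a _ ⟩
        toℚ (∑ ks (λ c → when (p c) 1)) ℚ.* a ∎
        where open ≡-Reasoning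

      -- A uniform proper colouring of es becomes a uniform proper colouring of es′: for fixed β the swaps
      -- reach every colouring in which β is free at v exactly degV es v times.
      uniform : ∀ (g : St → ℚ) → degV es v ≤ κ → Fv ℚ.* (Fu ℚ.* average (λ _ → g)) ≡
        toℚ κ ℚ.* ∑ℚ (colourings (suc m)) (λ ψ → whenℚ (proper es′ ψ) (g (mk es′ ψ)))
      uniform g dv≤κ = begin
        Fv ℚ.* (Fu ℚ.* average (λ _ → g))
          ≡⟨ average-insert (λ _ → g) ⟩
        ∑ℚ ks (λ β → ∑ℚ ks (λ α → ∑ℚ cs (λ χ → whenℚ (conflict β β α χ) (g (mk es′ (β ∷ kempe β α χ))))))
        ℚ.+ ∑ℚ ks (λ β → ∑ℚ cs (λ χ → whenℚ (good β β χ) (Fv ℚ.* g′ β χ)))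
          ≡⟨ sym (ℚ∑.∑-⊕ ks _ _) ⟩
        ∑ℚ ks (λ β → ∑ℚ ks (λ α → ∑ℚ cs (λ χ → whenℚ (conflict β β α χ) (g (mk es′ (β ∷ kempe β α χ)))))
                       ℚ.+ ∑ℚ cs (λ χ → whenℚ (good β β χ) (Fv ℚ.* g′ β χ)))
          ≡⟨ ℚ∑.∑-cong ks (λ β → perColour β) ⟩
        ∑ℚ ks (λ β → toℚ κ ℚ.* ∑ℚ cs (λ χ → whenℚ (good β β χ) (g′ β χ)))
          ≡⟨ sym (∑ℚ-*ˡ (toℚ κ) ks _) ⟩
        toℚ κ ℚ.* ∑ℚ ks (λ β → ∑ℚ cs (λ χ → whenℚ (good β β χ) (g′ β χ)))
          -- `good β β χ` unfolds to the same test as `proper es′ (β ∷ χ)`.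
          ≡⟨ cong (toℚ κ ℚ.*_) (sym (ℚ∑.∑-colourings-suc m (λ ψ → whenℚ (proper es′ ψ) (g (mk es′ ψ))))) ⟩
        toℚ κ ℚ.* ∑ℚ (colourings (suc m)) (λ ψ → whenℚ (proper es′ ψ) (g (mk es′ ψ))) ∎
        where
        open ≡-Reasoning
        g′ : Fin κ → Colouring m → ℚ
        g′ β χ = g (mk es′ (β ∷ χ))
        perColour : ∀ β →
          ∑ℚ ks (λ α → ∑ℚ cs (λ χ → whenℚ (conflict β β α χ) (g′ β (kempe β α χ))))
          ℚ.+ ∑ℚ cs (λ χ → whenℚ (good β β χ) (Fv ℚ.* g′ β χ))
          ≡ toℚ κ ℚ.* ∑ℚ cs (λ χ → whenℚ (good β β χ) (g′ β χ))
        perColour β = begin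
          ∑ℚ ks (λ α → ∑ℚ cs (λ χ → whenℚ (conflict β β α χ) (g′ β (kempe β α χ)))) ℚ.+ T
            ≡⟨ cong (ℚ._+ T) (ℚ∑.∑-cong ks (λ α → ℚ∑.reindex (kempe β α) (kempe α β) (conflict β β α) (conflict β α β)
                 (kempe-conflict β β α) (kempe-conflict β α β) (g′ β))) ⟩
          ∑ℚ ks (λ α → ∑ℚ cs (λ χ → whenℚ (conflict β α β χ) (g′ β χ))) ℚ.+ T
            ≡⟨ cong (ℚ._+ T) (trans (ℚ∑.∑-swap ks cs _) (ℚ∑.∑-cong cs (λ χ →
                 trans (ℚ∑.∑-cong ks (λ α → ℚ∑.when-∧ (good β β χ) (used es χ v α) (g′ β χ)))
                   (trans (sym (ℚ∑.∑-when (good β β χ) ks _)) (cong (whenℚ (good β β χ)) (∑ℚ-const (used es χ v) (g′ β χ))))))) ⟩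
          ∑ℚ cs (λ χ → whenℚ (good β β χ) (toℚ (∑ ks (λ α → when (used es χ v α) 1)) ℚ.* g′ β χ)) ℚ.+ T
            ≡⟨ sym (ℚ∑.∑-⊕ cs _ _) ⟩
          ∑ℚ cs (λ χ → whenℚ (good β β χ) (toℚ (∑ ks (λ α → when (used es χ v α) 1)) ℚ.* g′ β χ) ℚ.+ whenℚ (good β β χ) (Fv ℚ.* g′ β χ))
            -- The swaps contribute `degV es v` copies and the insertions without a conflict
            -- `free es v` copies, which makes `κ` for every colouring.
            ≡⟨ ℚ∑.∑-cong cs (λ χ → trans (sym (ℚ∑.when-⊕ (good β β χ) _ _)) (trans (ℚ∑.when-cong (good β β χ) (total χ)) (sym (when-*ℚ (good β β χ) (toℚ κ) _)))) ⟩
          ∑ℚ cs (λ χ → toℚ κ ℚ.* whenℚ (good β β χ) (g′ β χ))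
            ≡⟨ sym (∑ℚ-*ˡ (toℚ κ) cs _) ⟩
          toℚ κ ℚ.* ∑ℚ cs (λ χ → whenℚ (good β β χ) (g′ β χ)) ∎
          where
          T : ℚ
          T = ∑ℚ cs (λ χ → whenℚ (good β β χ) (Fv ℚ.* g′ β χ))
          total : ∀ χ → good β β χ ≡ true →
                  toℚ (∑ ks (λ α → when (used es χ v α) 1)) ℚ.* g′ β χ ℚ.+ Fv ℚ.* g′ β χ ≡ toℚ κ ℚ.* g′ β χ
          total χ gd = trans (sym (ℚ.*-distribʳ-+ (g′ β χ) (toℚ (∑ ks (λ α → when (used es χ v α) 1))) Fv)) (cong (ℚ._* g′ β χ)
            (trans (sym (toℚ-+ (∑ ks (λ α → when (used es χ v α) 1)) (free es v))) (cong toℚ (trans (cong (_+ free es v) (used-count es χ v (proj₁ (∧-true gd)))) (m+[n∸m]≡n dv≤κ)))))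

      recourse-free : ∀ χ β → recourse (mk es χ) (mk es′ (β ∷ χ)) ≡ 0
      recourse-free χ β = trans (recourse-mk es χ χ _) (trans (∑-cong (allFin m) (λ i → cong (λ b → when (not b) 1) (==-refl (lookup χ i)))) (∑-𝟘 (allFin m)))

      recourse-kempe : ∀ χ β α → ¬ α ≡ β → recourse (mk es χ) (mk es′ (β ∷ kempe β α χ)) ≡ ∑ (allFin m) (λ i → when (on β α χ i) 1)
      recourse-kempe χ β α α≢β = trans (recourse-mk es χ (kempe β α χ) _) (∑-cong (allFin m) (λ i → cong (λ b → when b 1) (changed i)))
        where
        changed : ∀ i → not (lookup χ i == lookup (kempe β α χ) i) ≡ on β α χ i
        changed i with on β α χ i in eq
        ... | true  rewrite ==-false (λ e → alternate-≢ α≢β (dep (pn i)) (trans (sym (kempe-on (on-sound eq))) (trans (sym e) (chain-colour (on-sound eq))))) = refl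
        ... | false rewrite kempe-outside eq | ==-refl (lookup χ i) = refl

      -- Linearity over the edges. A swap recolours exactly the chain, and a nonempty chain already
      -- shows that `β` is used at `v`, so `conflict` can be weakened to `good`.
      expected-recourse : Fv ℚ.* (Fu ℚ.* average (λ χ st → toℚ (recourse (mk es χ) st))) ≡ toℚ (∑ (allFin m) hits)
      expected-recourse = begin
        Fv ℚ.* (Fu ℚ.* average (λ χ st → toℚ (recourse (mk es χ) st)))
          ≡⟨ average-insert _ ⟩
        ∑ℚ ks (λ β → ∑ℚ ks (λ α → ∑ℚ cs (λ χ → whenℚ (conflict β β α χ) (toℚ (recourse (mk es χ) (mk es′ (β ∷ kempe β α χ)))))))
        ℚ.+ ∑ℚ ks (λ β → ∑ℚ cs (λ χ → whenℚ (good β β χ) (Fv ℚ.* toℚ (recourse (mk es χ) (mk es′ (β ∷ χ))))))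
          ≡⟨ cong₂ ℚ._+_ (ℚ∑.∑-cong ks (λ β → ℚ∑.∑-cong ks (λ α → ℚ∑.∑-cong cs (λ χ → trans
                 (ℚ∑.when-cong (conflict β β α χ) (λ c → cong toℚ (recourse-kempe χ β α (conflict-≢ {β} c)))) (sym (toℚ-when (conflict β β α χ) _))))))
               (trans (ℚ∑.∑-cong ks (λ β → trans (ℚ∑.∑-cong cs (λ χ → vanish χ β)) (ℚ∑.∑-𝟘 cs))) (ℚ∑.∑-𝟘 ks)) ⟩
        ∑ℚ ks (λ β → ∑ℚ ks (λ α → ∑ℚ cs (λ χ → toℚ (when (conflict β β α χ) (∑ (allFin m) (λ i → when (on β α χ i) 1)))))) ℚ.+ 0ℚ
          ≡⟨ ℚ.+-identityʳ _ ⟩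
        ∑ℚ ks (λ β → ∑ℚ ks (λ α → ∑ℚ cs (λ χ → toℚ (when (conflict β β α χ) (∑ (allFin m) (λ i → when (on β α χ i) 1))))))
          ≡⟨ ℚ∑.∑-cong ks (λ β → trans (ℚ∑.∑-cong ks (λ α → sym (toℚ-∑ cs _))) (sym (toℚ-∑ ks _))) ⟩
        ∑ℚ ks (λ β → toℚ (∑ ks (λ α → ∑ cs (λ χ → when (conflict β β α χ) (∑ (allFin m) (λ i → when (on β α χ i) 1))))))
          ≡⟨ sym (toℚ-∑ ks _) ⟩
        toℚ (∑ ks (λ β → ∑ ks (λ α → ∑ cs (λ χ → when (conflict β β α χ) (∑ (allFin m) (λ i → when (on β α χ i) 1))))))
          ≡⟨ cong toℚ (∑-cong ks (λ β → ∑-cong ks (λ α → trans (∑-cong cs (λ χ → trans (∑-when (conflict β β α χ) (allFin m) _) (∑-cong (allFin m) (λ i → absorb χ β α i))))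
               (∑-swap cs (allFin m) _)))) ⟩
        toℚ (∑ ks (λ β → ∑ ks (λ α → ∑ (allFin m) (λ i → # (λ χ → good β α χ ∧ on β α χ i)))))
          ≡⟨ cong toℚ (trans (∑-cong ks (λ β → ∑-swap ks (allFin m) _)) (∑-swap ks (allFin m) _)) ⟩
        toℚ (∑ (allFin m) hits) ∎
        where
        open ≡-Reasoning
        vanish : ∀ χ β → whenℚ (good β β χ) (Fv ℚ.* toℚ (recourse (mk es χ) (mk es′ (β ∷ χ)))) ≡ 0ℚ
        vanish χ β rewrite recourse-free χ β | toℚ-0 | ℚ.*-zeroʳ Fv with good β β χ
        ... | true  = refl
        ... | false = refl
        absorb : ∀ χ β α i → when (conflict β β α χ) (when (on β α χ i) 1) ≡ when (good β α χ ∧ on β α χ i) 1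
        absorb χ β α i = trans (sym (when-∧ (conflict β β α χ) _ 1)) (cong (λ b → when b 1) (bool-ext
          (λ e → let (c , o) = ∧-true {conflict β β α χ} e in ∧-intro (proj₁ (∧-true {good β α χ} c)) o)
          (λ e → let (g , o) = ∧-true {good β α χ} e ; (j , Ij , q) = chain-start (on-sound o) in ∧-intro (∧-intro g (used-complete es χ v β j Ij q)) o)))

  -- Joining two trees

  -- Rootings at all vertices are kept because an insertion may reroot a tree at any of its
  -- vertices.
  record Forest {m} (es : Edges m) (rep : Fin n → Fin n) : Set where
    field
      idem   : ∀ x → rep (rep x) ≡ rep x
      rooted : ∀ r → Rooted es rep r

  sizeV : ∀ {m} → Edges m → (Fin n → Fin n) → Fin n → ℕ
  sizeV {m} es rep x = ∑ (allFin m) (λ i → when (rep (proj₁ (lookup es i)) == rep x) 1)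

  sizeV-cong : ∀ {m} (es : Edges m) rep {x y} → rep x ≡ rep y → sizeV es rep x ≡ sizeV es rep y
  sizeV-cong {m} es rep eq = ∑-cong (allFin m) (λ i → cong (λ z → when (rep (proj₁ (lookup es i)) == z) 1) eq)

  empty : Forest [] (λ x → x)
  empty = record
    { idem = λ _ → refl
    ; rooted = λ r → record
      { dep = λ _ → 0 ; ce = λ () ; pn = λ () ; joins = λ () ; depth = λ () ; ce-inj = λ { {()} }
      ; root = refl ; parent = λ x q → ⊥-elim (q refl) ; rep-edge = λ () ; top-unique = λ x _ eq → eq } }

  redirect : (l w z : Fin n) → Fin n
  redirect l w z = if z == l then w else z

  redirect-l : ∀ l w → redirect l w l ≡ w
  redirect-l l w rewrite ==-refl l = refl

  redirect-≢ : ∀ l w z → ¬ z ≡ l → redirect l w z ≡ z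
  redirect-≢ l w z z≢l rewrite ==-false z≢l = refl

  redirect-merges : ∀ l w z z′ → redirect l w z ≡ redirect l w z′ → z ≡ z′ ⊎ (z ≡ l × z′ ≡ w) ⊎ (z ≡ w × z′ ≡ l)
  redirect-merges l w z z′ eq = cases (z Fin.≟ l) (z′ Fin.≟ l)
    where
    cases : Dec (z ≡ l) → Dec (z′ ≡ l) → z ≡ z′ ⊎ (z ≡ l × z′ ≡ w) ⊎ (z ≡ w × z′ ≡ l)
    cases (yes refl) (yes refl) = inj₁ refl
    cases (yes refl) (no q)     = inj₂ (inj₁ (refl , sym (trans (sym (redirect-l l w)) (trans eq (redirect-≢ l w z′ q)))))
    cases (no p)     (yes refl) = inj₂ (inj₂ (trans (sym (redirect-≢ l w z p)) (trans eq (redirect-l l w)) , refl))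
    cases (no p)     (no q)     = inj₁ (trans (sym (redirect-≢ l w z p)) (trans eq (redirect-≢ l w z′ q)))

  module _ {m} (es : Edges m) (rep : Fin n → Fin n) (l w : Fin n) (e : Fin n × Fin n) where

    merged : Fin n → Fin n
    merged x = redirect l w (rep x)

    -- Hang the tree of b, rooted at b, below a in a rooting whose root r lies outside the tree of b.
    graft : ∀ a b r → (∀ x → Rooted es rep x) → (e ≡ (a , b) ⊎ e ≡ (b , a)) →
            (w ≡ rep a × l ≡ rep b) ⊎ (w ≡ rep b × l ≡ rep a) → ¬ rep a ≡ rep b → ¬ rep r ≡ rep b →
            Rooted (e ∷ es) merged r
    graft a b r rooted ends wl a≁b r≁b = record
      { dep = dep ; ce = ce ; pn = pn ; joins = joins ; depth = depth ; ce-inj = ce-inj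
      ; root = root ; parent = parent ; rep-edge = rep-edge ; top-unique = top-unique }
      where
      module F = Rooted (rooted r)
      module G = Rooted (rooted b)
      side : Fin m → Bool
      side i = rep (F.pn i) == rep b
      same-rep : ∀ i → rep (G.pn i) ≡ rep (F.pn i)
      same-rep i = F.inc-rep (G.inc-pn i)
      dep : Fin n → ℕ
      dep x = if rep x == rep b then suc (F.dep a) + G.dep x else F.dep x
      dep-b : ∀ {x} → rep x ≡ rep b → dep x ≡ suc (F.dep a) + G.dep x
      dep-b eq rewrite ==-complete eq = refl
      dep-a : ∀ {x} → ¬ rep x ≡ rep b → dep x ≡ F.dep x
      dep-a neq rewrite ==-false neq = refl
      ce pn : Fin (suc m) → Fin n
      ce zero    = b
      ce (suc i) = if side i then G.ce i else F.ce i
      pn zero    = a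
      pn (suc i) = if side i then G.pn i else F.pn i
      joins : ∀ i → Joins (e ∷ es) i (pn i) (ce i)
      joins zero = ends
      joins (suc i) with side i
      ... | true  = G.joins i
      ... | false = F.joins i
      rep-ce : ∀ i → rep (ce (suc i)) ≡ rep (F.pn i)
      rep-ce i with side i
      ... | true  = trans (G.rep-edge i) (same-rep i)
      ... | false = F.rep-edge i
      rep-pn : ∀ i → rep (pn (suc i)) ≡ rep (F.pn i)
      rep-pn i with side i
      ... | true  = same-rep i
      ... | false = refl
      depth : ∀ i → dep (ce i) ≡ suc (dep (pn i))
      depth zero = trans (dep-b refl) (trans (cong (suc (F.dep a) +_) G.root) (trans (+-identityʳ _) (cong suc (sym (dep-a a≁b)))))
      depth (suc i) with side i in eq
      ... | true  = trans (dep-b (trans (G.rep-edge i) (trans (same-rep i) (==-true eq))))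
                      (trans (cong (suc (F.dep a) +_) (G.depth i)) (trans (+-suc (suc (F.dep a)) (G.dep (G.pn i))) (cong suc (sym (dep-b (trans (same-rep i) (==-true eq)))))))
      ... | false = trans (dep-a (λ e → ==-false⁻¹ eq (trans (sym (F.rep-edge i)) e)))
                      (trans (F.depth i) (cong suc (sym (dep-a (==-false⁻¹ eq)))))
      new≢old : ∀ i → ¬ b ≡ ce (suc i)
      new≢old i b≡ with side i in eq
      ... | true  = G.ce≢root i (sym b≡)
      ... | false = ==-false⁻¹ eq (trans (sym (F.rep-edge i)) (cong rep (sym b≡)))
      ce-inj : ∀ {i j} → ce i ≡ ce j → i ≡ j
      ce-inj {zero}  {zero}  eq = refl
      ce-inj {zero}  {suc j} eq = ⊥-elim (new≢old j eq)
      ce-inj {suc i} {zero}  eq = ⊥-elim (new≢old i (sym eq))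
      ce-inj {suc i} {suc j} eq with side i in p | side j in q
      ... | true  | true  = cong suc (G.ce-inj eq)
      ... | false | false = cong suc (F.ce-inj eq)
      ... | true  | false = ⊥-elim (==-false⁻¹ q (trans (sym (F.rep-edge j)) (trans (cong rep (sym eq)) (trans (G.rep-edge i) (trans (same-rep i) (==-true p))))))
      ... | false | true  = ⊥-elim (==-false⁻¹ p (trans (sym (F.rep-edge i)) (trans (cong rep eq) (trans (G.rep-edge j) (trans (same-rep j) (==-true q))))))
      root : dep r ≡ 0
      root = trans (dep-a r≁b) F.root
      parent : ∀ x → ¬ dep x ≡ 0 → ∃ λ i → ce i ≡ x
      parent x d≢0 with rep x Fin.≟ rep b
      ... | yes eq with G.dep x ℕ.≟ 0
      ...   | yes z = zero , sym (G.top-unique x z eq)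
      ...   | no nz with (i , refl) ← G.parent x nz = suc i , inside
        where
        inside : ce (suc i) ≡ G.ce i
        inside rewrite ==-complete (trans (sym (same-rep i)) (trans (sym (G.rep-edge i)) eq)) = refl
      parent x d≢0 | no neq with (i , refl) ← F.parent x d≢0 = suc i , outside
        where
        outside : ce (suc i) ≡ F.ce i
        outside rewrite ==-false (λ e → neq (trans (F.rep-edge i) e)) = refl
      merge-ab : merged a ≡ merged b
      merge-ab = go wl
        where
        go : (w ≡ rep a × l ≡ rep b) ⊎ (w ≡ rep b × l ≡ rep a) → redirect l w (rep a) ≡ redirect l w (rep b)
        go (inj₁ (refl , refl)) = trans (redirect-≢ (rep b) (rep a) (rep a) a≁b) (sym (redirect-l (rep b) (rep a)))
        go (inj₂ (refl , refl)) = trans (redirect-l (rep a) (rep b)) (sym (redirect-≢ (rep a) (rep b) (rep b) (λ e → a≁b (sym e))))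
      rep-edge : ∀ i → merged (ce i) ≡ merged (pn i)
      rep-edge zero    = sym merge-ab
      rep-edge (suc i) = cong (redirect l w) (trans (rep-ce i) (sym (rep-pn i)))
      top-unique : ∀ x → dep x ≡ 0 → merged x ≡ merged r → x ≡ r
      top-unique x d≡0 eq with rep x Fin.≟ rep b
      ... | yes e with () ← trans (sym (dep-b e)) (trans (dep-b e) d≡0)
      ... | no x≁b with redirect-merges l w (rep x) (rep r) eq
      ...   | inj₁ e = F.top-unique x d≡0 e
      ...   | inj₂ (inj₁ (x≡l , r≡w)) = ⊥-elim (go wl)
        where
        go : (w ≡ rep a × l ≡ rep b) ⊎ (w ≡ rep b × l ≡ rep a) → ⊥
        go (inj₁ (_ , q)) = x≁b (trans x≡l q)
        go (inj₂ (p , _)) = r≁b (trans r≡w p)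
      ...   | inj₂ (inj₂ (x≡w , r≡l)) = ⊥-elim (go wl)
        where
        go : (w ≡ rep a × l ≡ rep b) ⊎ (w ≡ rep b × l ≡ rep a) → ⊥
        go (inj₁ (_ , q)) = r≁b (trans r≡l q)
        go (inj₂ (p , _)) = x≁b (trans x≡w p)

  -- The loser `l` and the winner `w` may be the representatives in either order: the accounting
  -- selects them by final degree, independently of the orientation that the algorithm chooses.
  Swaps : (rep : Fin n → Fin n) (l w u v : Fin n) → Set
  Swaps rep l w u v = (w ≡ rep u × l ≡ rep v) ⊎ (w ≡ rep v × l ≡ rep u)

  module Link {m} (es : Edges m) (rep : Fin n → Fin n) (F : Forest es rep) (l w u v : Fin n)
              (wl : Swaps rep l w u v) (u≁v : ¬ rep u ≡ rep v) where
    open Forest F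

    rep′ : Fin n → Fin n
    rep′ x = redirect l w (rep x)

    rep-w : rep w ≡ w
    rep-w = go wl
      where
      go : Swaps rep l w u v → rep w ≡ w
      go (inj₁ (refl , _)) = idem u
      go (inj₂ (refl , _)) = idem v

    rep-l : rep l ≡ l
    rep-l = go wl
      where
      go : Swaps rep l w u v → rep l ≡ l
      go (inj₁ (_ , refl)) = idem v
      go (inj₂ (_ , refl)) = idem u

    w≢l : ¬ w ≡ l
    w≢l = go wl
      where
      go : Swaps rep l w u v → ¬ w ≡ l
      go (inj₁ (refl , refl)) = u≁v
      go (inj₂ (refl , refl)) = λ e → u≁v (sym e)

    rep′-w : rep′ w ≡ w
    rep′-w = trans (cong (redirect l w) rep-w) (redirect-≢ l w w w≢l)

    rep′-l : rep′ l ≡ w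
    rep′-l = trans (cong (redirect l w) rep-l) (redirect-l l w)

    rep′-other : ∀ x → ¬ x ≡ l → rep x ≡ x → rep′ x ≡ x
    rep′-other x x≢l eq = trans (cong (redirect l w) eq) (redirect-≢ l w x x≢l)

    rep′-u : rep′ u ≡ w
    rep′-u = go wl
      where
      go : Swaps rep l w u v → redirect l w (rep u) ≡ w
      go (inj₁ (refl , refl)) = redirect-≢ (rep v) (rep u) (rep u) u≁v
      go (inj₂ (refl , refl)) = redirect-l (rep u) (rep v)

    linked : Forest ((u , v) ∷ es) rep′
    linked = record { idem = idem′ ; rooted = rooted′ }
      where
      idem′ : ∀ x → rep′ (rep′ x) ≡ rep′ x
      idem′ x with rep x Fin.≟ l
      ... | yes _ = rep′-w
      ... | no neq = rep′-other (rep x) neq (idem x)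
      flip : Swaps rep l w v u
      flip = Sum.swap wl
      rooted′ : ∀ r → Rooted ((u , v) ∷ es) rep′ r
      rooted′ r with rep r Fin.≟ rep v
      ... | no neq = graft es rep l w (u , v) u v r rooted (inj₁ refl) wl u≁v neq
      ... | yes eq = graft es rep l w (u , v) v u r rooted (inj₂ refl) flip (λ e → u≁v (sym e)) (λ e → u≁v (trans (sym e) eq))

    size-w : sizeV ((u , v) ∷ es) rep′ w ≡ suc (sizeV es rep w + sizeV es rep l)
    size-w = trans (∑-allFin-suc m _) (cong₂ _+_ (cong (λ b → when b 1) (==-complete (trans rep′-u (sym rep′-w))))
      (trans (∑-cong (allFin m) (λ i → split (rep (proj₁ (lookup es i))))) (∑-⊕ (allFin m) _ _)))
      where
      split : ∀ z → when (redirect l w z == rep′ w) 1 ≡ when (z == rep w) 1 + when (z == rep l) 1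
      split z rewrite rep′-w | rep-w | rep-l with z Fin.≟ l
      ... | yes refl rewrite ==-refl w | ==-false (λ (e : z ≡ w) → w≢l (sym e)) = refl
      ... | no z≢l = sym (+-identityʳ _)

    size-other : ∀ x → rep x ≡ x → ¬ x ≡ l → ¬ x ≡ w → sizeV ((u , v) ∷ es) rep′ x ≡ sizeV es rep x
    size-other x eq x≢l x≢w = trans (∑-allFin-suc m _) (cong₂ _+_
        (cong (λ b → when b 1) (==-false (λ e → x≢w (trans (sym (rep′-other x x≢l eq)) (trans (sym e) rep′-u)))))
        (∑-cong (allFin m) (λ i → cong (λ b → when b 1) (same (rep (proj₁ (lookup es i)))))))
      where
      same : ∀ z → (redirect l w z == rep′ x) ≡ (z == rep x)
      same z rewrite rep′-other x x≢l eq | eq with z Fin.≟ l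
      ... | yes refl = trans (==-false (λ e → x≢w (sym e))) (sym (==-false (λ e → x≢l (sym e))))
      ... | no z≢l = refl

  module _ {m} (es : Edges m) (rep : Fin n → Fin n) (F : Forest es rep) where
    open Forest F

    reached : St → Fin n → ℕ → Fin n → Bool
    reached st x k = iter k (stepC st) (λ y → x == y)

    reached-sound : ∀ χ x k y → reached (mk es χ) x k y ≡ true → rep y ≡ rep x
    reached-sound χ x zero    y eq = cong rep (sym (==-true eq))
    reached-sound χ x (suc k) y eq with ∨-true {reached (mk es χ) x k y} eq
    ... | inj₁ p = reached-sound χ x k y p
    ... | inj₂ p with Any-mk⁻ es χ (any-true⁻ _ (mk es χ) p)
    ...   | i , q with ∨-true {reached (mk es χ) x k (proj₁ (lookup es i)) ∧ (proj₂ (lookup es i) == y)} q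
    ...     | inj₁ r = let (s , t) = ∧-true {reached (mk es χ) x k (proj₁ (lookup es i))} r in
                trans (cong rep (sym (==-true t))) (trans (trans (inc-rep (_ , inj₂ refl)) (sym (inc-rep {i} (_ , inj₁ refl)))) (reached-sound χ x k _ s))
                where open Rooted (rooted x)
    ...     | inj₂ r = let (s , t) = ∧-true {reached (mk es χ) x k (proj₂ (lookup es i))} r in
                trans (cong rep (sym (==-true t))) (trans (trans (inc-rep (_ , inj₁ refl)) (sym (inc-rep {i} (_ , inj₂ refl)))) (reached-sound χ x k _ s))
                where open Rooted (rooted x)

    -- In the rooting at `x` the depth of a vertex of the same tree is its distance from `x`, so one
    -- round is enough for one level.
    reached-complete : ∀ χ x k y → Rooted.dep (rooted x) y ≤ k → rep y ≡ rep x → reached (mk es χ) x k y ≡ true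
    reached-complete χ x zero y le eq = ==-complete (sym (Rooted.top-unique (rooted x) y (n≤0⇒n≡0 le) eq))
    reached-complete χ x (suc k) y le eq with Rooted.dep (rooted x) y ℕ.≟ 0
    ... | yes z = ∨-introˡ (reached-complete χ x k y (≤-trans (≤-reflexive z) z≤n) eq)
    ... | no nz with (i , refl) ← Rooted.parent (rooted x) y nz =
      ∨-introʳ (reached (mk es χ) x k (ce i)) (any-true⁺ _ (Any-mk⁺ es χ i (via (joins i))))
      where
      open Rooted (rooted x)
      up : reached (mk es χ) x k (pn i) ≡ true
      up = reached-complete χ x k (pn i) (≤-pred (≤-trans (≤-reflexive (sym (depth i))) le)) (trans (sym (rep-edge i)) eq)
      via : Joins es i (pn i) (ce i) →
            ((reached (mk es χ) x k (proj₁ (lookup es i)) ∧ (proj₂ (lookup es i) == ce i))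
              ∨ (reached (mk es χ) x k (proj₂ (lookup es i)) ∧ (proj₁ (lookup es i) == ce i))) ≡ true
      via (inj₁ p) = ∨-introˡ (∧-intro (trans (cong (reached (mk es χ) x k) (cong proj₁ p)) up) (==-complete (cong proj₂ p)))
      via (inj₂ p) = ∨-introʳ (reached (mk es χ) x k (proj₁ (lookup es i)) ∧ (proj₂ (lookup es i) == ce i))
        (∧-intro (trans (cong (reached (mk es χ) x k) (cong proj₂ p)) up) (==-complete (cong proj₁ p)))

    inTree-rep : ∀ χ x y → inTree (mk es χ) x y ≡ (rep y == rep x)
    inTree-rep χ x y = bool-ext (λ e → ==-complete (reached-sound χ x n y e))
      (λ e → reached-complete χ x n y (<⇒≤ (Rooted.dep<n (rooted x) y)) (==-true e))

    treeSize-mk : ∀ χ x → treeSize (mk es χ) x ≡ sizeV es rep x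
    treeSize-mk χ x = trans (countᵇ-∑ _ (mk es χ)) (trans (∑-mk es χ _)
      (∑-cong (allFin m) (λ i → cong (λ b → when b 1) (inTree-rep χ x (proj₁ (lookup es i))))))

  -- Edges by depth

  ⌊⌋-true : ∀ {P : Set} (d : Dec P) → ⌊ d ⌋ ≡ true → P
  ⌊⌋-true (yes p) _ = p

  ⌊⌋-intro : ∀ {P : Set} (d : Dec P) → P → ⌊ d ⌋ ≡ true
  ⌊⌋-intro (yes _) p = refl
  ⌊⌋-intro (no q)  p = ⊥-elim (q p)

  when-≤ : ∀ b {x y} → (b ≡ true → x ≤ y) → when b x ≤ when b y
  when-≤ true  f = f refl
  when-≤ false f = z≤n

  when-implies : ∀ {b} x y → (b ≡ true → x ≤ y) → when b x ≤ y
  when-implies {true}  x y f = f refl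
  when-implies {false} x y f = z≤n

  when-mono : ∀ {a b} x → (a ≡ true → b ≡ true) → when a x ≤ when b x
  when-mono {false}        x f = z≤n
  when-mono {true}  {b}    x f rewrite f refl = ≤-refl

  ∑-positive : ∀ {k} (f : Fin k → ℕ) → 0 < ∑ (allFin k) f → ∃ λ i → 0 < f i
  ∑-positive {suc k} f pos with f zero ℕ.≟ 0
  ... | no f₀≢0 = zero , n≢0⇒n>0 f₀≢0
  ... | yes f₀≡0 with ∑-positive (λ i → f (suc i)) (subst (0 <_) (trans (∑-allFin-suc k f) (cong (_+ ∑ (allFin k) (λ i → f (suc i))) f₀≡0)) pos)
  ...   | i , p = suc i , p

  -- `W` is the weight of an edge at `v`, and `Y i` equals `W / k ^ d` for an edge at distance `d`.
  -- Since a level has at most `q` times as many edges as the one above, the estimates replace `k`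
  -- by the smaller `q`, and every level weighs at most `q * W`.
  module Level {m} (es : Edges m) (rep : Fin n → Fin n) (v : Fin n) (R : Rooted es rep v)
               (q k W : ℕ) (q>0 : 0 < q) (q≤k : q ≤ k)
               (deg≤ : ∀ x → degV es x ≤ suc q) (root-deg≤ : degV es v ≤ q)
               (Y : Fin m → ℕ)
               (Y-out : ∀ i → ¬ rep (Rooted.pn R i) ≡ rep v → Y i ≡ 0)
               (Y-in : ∀ i → rep (Rooted.pn R i) ≡ rep v → k ^ Rooted.dep R (Rooted.pn R i) * Y i ≡ W) where
    open Rooted R

    private
      is : List (Fin m)
      is = allFin m

    tree : Fin m → Bool
    tree i = rep (pn i) == rep v

    size : ℕ
    size = ∑ is (λ i → when (tree i) 1)

    atLevel atLeast : ℕ → Fin m → Bool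
    atLevel d i = tree i ∧ ⌊ dep (pn i) ℕ.≟ d ⌋
    atLeast d i = tree i ∧ ⌊ d ℕ.≤? dep (pn i) ⌋

    level : ℕ → ℕ
    level d = ∑ is (λ i → when (atLevel d i) 1)

    atLevel-true : ∀ {d i} → atLevel d i ≡ true → rep (pn i) ≡ rep v × dep (pn i) ≡ d
    atLevel-true {d} {i} e = let (p , r) = ∧-true {tree i} e in ==-true p , ⌊⌋-true (dep (pn i) ℕ.≟ d) r

    atLevel-intro : ∀ {d i} → rep (pn i) ≡ rep v → dep (pn i) ≡ d → atLevel d i ≡ true
    atLevel-intro {d} {i} p r = ∧-intro (==-complete p) (⌊⌋-intro (dep (pn i) ℕ.≟ d) r)

    atLeast-true : ∀ {d i} → atLeast d i ≡ true → rep (pn i) ≡ rep v × d ≤ dep (pn i)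
    atLeast-true {d} {i} e = let (p , r) = ∧-true {tree i} e in ==-true p , ⌊⌋-true (d ℕ.≤? dep (pn i)) r

    k>0 : 0 < k
    k>0 = ≤-trans q>0 q≤k

    Y-deep : ∀ d i → rep (pn i) ≡ rep v → d ≤ dep (pn i) → q ^ d * Y i ≤ W
    Y-deep d i r le = begin
      q ^ d * Y i          ≤⟨ *-monoˡ-≤ (Y i) (≤-trans (^-monoˡ-≤ d q≤k) (^-monoʳ-≤ k {{ℕ.>-nonZero k>0}} le)) ⟩
      k ^ dep (pn i) * Y i ≡⟨ Y-in i r ⟩
      W                    ∎
      where open ≤-Reasoning

    total≤size : ∑ is Y ≤ W * size
    total≤size = begin
      ∑ is Y                        ≤⟨ ∑-mono is bound ⟩
      ∑ is (λ i → when (tree i) W)  ≡⟨ ∑-const tree is W ⟩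
      size * W                      ≡⟨ *-comm size W ⟩
      W * size                      ∎
      where
      open ≤-Reasoning
      bound : ∀ i → Y i ≤ when (tree i) W
      bound i with rep (pn i) Fin.≟ rep v
      ... | yes r  = subst (_≤ W) (+-identityʳ (Y i)) (Y-deep 0 i r z≤n)
      ... | no ¬r = ≤-reflexive (Y-out i ¬r)

    top-level : ∀ i → atLevel 0 i ≡ true → incB es i v ≡ true
    top-level i e = let (r , d) = atLevel-true {0} {i} e in
      incB-complete es i v (subst (Inc es i) (top-unique (pn i) d r) (inc-pn i))

    level₀≤deg : level 0 ≤ degV es v
    level₀≤deg = ∑-mono is (λ i → when-mono {atLevel 0 i} 1 (top-level i))

    -- The edge `j` is itself one of the edges at `ce j`, which leaves at most `q` of them for the
    -- next level.
    children : ∀ j → suc (∑ is (λ i → when (ce j == pn i) 1)) ≤ degV es (ce j)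
    children j = begin
      1 + ∑ is (λ i → when (ce j == pn i) 1)
        ≡⟨ cong (λ b → when b 1 + ∑ is (λ i → when (ce j == pn i) 1)) (sym (==-refl (ce j))) ⟩
      when (ce j == ce j) 1 + ∑ is (λ i → when (ce j == pn i) 1)
        ≤⟨ +-monoˡ-≤ _ (∑-single j (λ i → when (ce j == ce i) 1)) ⟩
      ∑ is (λ i → when (ce j == ce i) 1) + ∑ is (λ i → when (ce j == pn i) 1)
        ≡⟨ sym (∑-⊕ is _ _) ⟩
      ∑ is (λ i → when (ce j == ce i) 1 + when (ce j == pn i) 1)
        ≤⟨ ∑-mono is disjoint ⟩
      degV es (ce j) ∎
      where
      open ≤-Reasoning
      disjoint : ∀ i → when (ce j == ce i) 1 + when (ce j == pn i) 1 ≤ when (incB es i (ce j)) 1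
      disjoint i with ce j Fin.≟ ce i | ce j Fin.≟ pn i
      ... | yes p | yes r = ⊥-elim (pn≢ce i (trans (sym r) p))
      ... | yes p | no _ rewrite incB-complete es i (ce j) (subst (Inc es i) (sym p) (inc-ce i)) = ≤-refl
      ... | no _ | yes r rewrite incB-complete es i (ce j) (subst (Inc es i) (sym r) (inc-pn i)) = ≤-refl
      ... | no _ | no _ = z≤n

    -- Double counting of the pairs of an edge on level `suc d` and its parent edge on level `d`.
    level-suc : ∀ d → level (suc d) ≤ q * level d
    level-suc d = begin
      level (suc d)
        ≤⟨ ∑-mono is (λ i → when-implies 1 _ (fromParent i)) ⟩
      ∑ is (λ i → ∑ is (λ j → when (atLevel d j) (when (ce j == pn i) 1)))
        ≡⟨ ∑-swap is is _ ⟩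
      ∑ is (λ j → ∑ is (λ i → when (atLevel d j) (when (ce j == pn i) 1)))
        ≡⟨ ∑-cong is (λ j → sym (∑-when (atLevel d j) is _)) ⟩
      ∑ is (λ j → when (atLevel d j) (∑ is (λ i → when (ce j == pn i) 1)))
        ≤⟨ ∑-mono is (λ j → when-≤ (atLevel d j) (λ _ → ≤-pred (≤-trans (children j) (deg≤ (ce j))))) ⟩
      ∑ is (λ j → when (atLevel d j) q)
        ≡⟨ ∑-const (atLevel d) is q ⟩
      level d * q
        ≡⟨ *-comm (level d) q ⟩
      q * level d ∎
      where
      open ≤-Reasoning
      fromParent : ∀ i → atLevel (suc d) i ≡ true → 1 ≤ ∑ is (λ j → when (atLevel d j) (when (ce j == pn i) 1))
      fromParent i e with atLevel-true {suc d} {i} e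
      ... | r , dp with parent (pn i) (λ z → 1+n≢0 (trans (sym dp) z))
      ... | j , p = ≤-trans (≤-reflexive (sym one)) (∑-single j (λ j → when (atLevel d j) (when (ce j == pn i) 1)))
        where
        one : when (atLevel d j) (when (ce j == pn i) 1) ≡ 1
        one rewrite atLevel-intro {d} {j} (trans (sym (rep-edge j)) (trans (cong rep p) r))
                      (suc-injective (trans (sym (depth j)) (trans (cong dep p) dp))) | ==-complete p = refl

    level≤ : ∀ d → level d ≤ q ^ suc d
    level≤ zero    = ≤-trans level₀≤deg (≤-trans root-deg≤ (≤-reflexive (sym (*-identityʳ q))))
    level≤ (suc d) = ≤-trans (level-suc d) (*-monoʳ-≤ q (level≤ d))

    levelSum deepSum : ℕ → ℕ
    levelSum d = ∑ is (λ i → when (atLevel d i) (Y i))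
    deepSum d  = ∑ is (λ i → when (atLeast d i) (Y i))

    scaled : ∀ d (P : Fin m → Bool) → (∀ i → P i ≡ true → rep (pn i) ≡ rep v × d ≤ dep (pn i)) →
             q ^ d * ∑ is (λ i → when (P i) (Y i)) ≤ ∑ is (λ i → when (P i) 1) * W
    scaled d P sub = begin
      q ^ d * ∑ is (λ i → when (P i) (Y i))       ≡⟨ ∑-*ˡ (q ^ d) is _ ⟩
      ∑ is (λ i → q ^ d * when (P i) (Y i))       ≡⟨ ∑-cong is (λ i → when-* (P i) (q ^ d) (Y i)) ⟩
      ∑ is (λ i → when (P i) (q ^ d * Y i))       ≤⟨ ∑-mono is (λ i → when-≤ (P i) (λ e → let (r , le) = sub i e in Y-deep d i r le)) ⟩
      ∑ is (λ i → when (P i) W)                   ≡⟨ ∑-const P is W ⟩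
      ∑ is (λ i → when (P i) 1) * W               ∎
      where open ≤-Reasoning

    cancel-power : ∀ d {x} c → q ^ d * x ≤ q ^ d * c → x ≤ c
    cancel-power d c = *-cancelˡ-≤ (q ^ d) {{m^n≢0 q d {{ℕ.>-nonZero q>0}}}}

    -- At most `q ^ suc d` edges, each of weight at most `W / q ^ d`.
    bounded-part : ∀ d (P : Fin m → Bool) → (∀ i → P i ≡ true → rep (pn i) ≡ rep v × d ≤ dep (pn i)) →
                   ∑ is (λ i → when (P i) 1) ≤ q ^ suc d → ∑ is (λ i → when (P i) (Y i)) ≤ q * W
    bounded-part d P sub few = cancel-power d (q * W) (begin
      q ^ d * ∑ is (λ i → when (P i) (Y i)) ≤⟨ scaled d P sub ⟩
      ∑ is (λ i → when (P i) 1) * W         ≤⟨ *-monoˡ-≤ W few ⟩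
      q * q ^ d * W                         ≡⟨ cong (_* W) (*-comm q (q ^ d)) ⟩
      q ^ d * q * W                         ≡⟨ *-assoc (q ^ d) q W ⟩
      q ^ d * (q * W)                       ∎)
      where open ≤-Reasoning

    levelSum≤ : ∀ d → levelSum d ≤ q * W
    levelSum≤ d = bounded-part d (atLevel d)
      (λ i e → let (r , dp) = atLevel-true {d} {i} e in r , ≤-reflexive (sym dp)) (level≤ d)

    deepSum-step : ∀ d → deepSum d ≤ levelSum d + deepSum (suc d)
    deepSum-step d = ≤-trans (∑-mono is split) (≤-reflexive (∑-⊕ is _ _))
      where
      split : ∀ i → when (atLeast d i) (Y i) ≤ when (atLevel d i) (Y i) + when (atLeast (suc d) i) (Y i)
      split i with tree i | d ℕ.≤? dep (pn i) | dep (pn i) ℕ.≟ d | suc d ℕ.≤? dep (pn i)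
      ... | false | _      | _      | _      = z≤n
      ... | true  | no _   | _      | _      = z≤n
      ... | true  | yes _  | yes _  | _      = m≤m+n (Y i) _
      ... | true  | yes _  | no _   | yes _  = ≤-refl
      ... | true  | yes le | no neq | no nlt = ⊥-elim (nlt (≤∧≢⇒< le (λ e → neq (sym e))))

    total≤deepSum : ∑ is Y ≤ deepSum 0
    total≤deepSum = ∑-mono is bound
      where
      bound : ∀ i → Y i ≤ when (atLeast 0 i) (Y i)
      bound i with rep (pn i) Fin.≟ rep v
      ... | yes _ = ≤-refl
      ... | no ¬r = ≤-reflexive (Y-out i ¬r)

    total≤levels : ∀ d → ∑ is Y ≤ d * (q * W) + deepSum d
    total≤levels zero    = total≤deepSum
    total≤levels (suc d) = begin
      ∑ is Y                                     ≤⟨ total≤levels d ⟩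
      d * (q * W) + deepSum d                    ≤⟨ +-monoʳ-≤ (d * (q * W)) (≤-trans (deepSum-step d) (+-monoˡ-≤ (deepSum (suc d)) (levelSum≤ d))) ⟩
      d * (q * W) + (q * W + deepSum (suc d))    ≡⟨ sym (+-assoc (d * (q * W)) (q * W) _) ⟩
      d * (q * W) + q * W + deepSum (suc d)      ≡⟨ cong (_+ deepSum (suc d)) (+-comm (d * (q * W)) (q * W)) ⟩
      suc d * (q * W) + deepSum (suc d)          ∎
      where open ≤-Reasoning

    deep-count : ∀ d → ∑ is (λ i → when (atLeast d i) 1) ≤ size
    deep-count d = ∑-mono is (λ i → when-mono {atLeast d i} 1 (λ e → proj₁ (∧-true {tree i} e)))

    -- The first `d` levels weigh at most `q * W` each. The edges below them are few enough, by the
    -- bound on `size`, to weigh at most `q * W` together.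
    total≤log : ∀ d → size ≤ q ^ suc d → ∑ is Y ≤ W * (q * suc d)
    total≤log d le = begin
      ∑ is Y                    ≤⟨ total≤levels d ⟩
      d * (q * W) + deepSum d   ≤⟨ +-monoʳ-≤ (d * (q * W)) (bounded-part d (atLeast d) (λ i → atLeast-true {d} {i}) (≤-trans (deep-count d) le)) ⟩
      d * (q * W) + q * W       ≡⟨ +-comm (d * (q * W)) (q * W) ⟩
      suc d * (q * W)           ≡⟨ trans (*-comm (suc d) (q * W)) (trans (cong (_* suc d) (*-comm q W)) (*-assoc W q (suc d))) ⟩
      W * (q * suc d)           ∎
      where open ≤-Reasoning

    level-zero : degV es v ≡ 0 → ∀ d → level d ≡ 0
    level-zero d0 zero    = n≤0⇒n≡0 (≤-trans level₀≤deg (≤-reflexive d0))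
    level-zero d0 (suc d) = n≤0⇒n≡0 (≤-trans (level-suc d) (≤-reflexive (trans (cong (q *_) (level-zero d0 d)) (*-zeroʳ q))))

    total-isolated : degV es v ≡ 0 → ∑ is Y ≡ 0
    total-isolated d0 = trans (∑-cong is vanish) (∑-𝟘 is)
      where
      vanish : ∀ i → Y i ≡ 0
      vanish i with rep (pn i) Fin.≟ rep v
      ... | no ¬r = Y-out i ¬r
      ... | yes r = ⊥-elim (1+n≰n (≤-trans
          (≤-trans (≤-reflexive (sym (cong (λ b → when b 1) (atLevel-intro {dep (pn i)} {i} r refl)))) (∑-single i (λ i′ → when (atLevel (dep (pn i)) i′) 1)))
          (≤-reflexive (level-zero d0 (dep (pn i))))))

    deg≤level₀ : degV es v ≤ level 0
    deg≤level₀ = ∑-mono is (λ i → when-mono {incB es i v} 1 (λ e → let p = inc-root (incB-sound es i v e) in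
      atLevel-intro {0} {i} (cong rep p) (trans (cong dep p) root)))

    -- An edge at `v` weighs `W`. If there is one, at most `q` edges remain further down, each of
    -- weight at most `W / q`, so they add one more `W`; if there is none, the tree has no edges.
    total≤deg : size ≤ suc q → ∑ is Y ≤ W * suc (degV es v)
    total≤deg le with degV es v ℕ.≟ 0
    ... | yes d0 = ≤-trans (≤-reflexive (total-isolated d0)) z≤n
    ... | no d≢0 = begin
      ∑ is Y                         ≤⟨ ≤-trans total≤deepSum (deepSum-step 0) ⟩
      levelSum 0 + deepSum 1         ≤⟨ +-mono-≤ top-part deep-part ⟩
      degV es v * W + W              ≡⟨ +-comm (degV es v * W) W ⟩
      suc (degV es v) * W            ≡⟨ *-comm (suc (degV es v)) W ⟩
      W * suc (degV es v)            ∎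
      where
      open ≤-Reasoning
      top-part : levelSum 0 ≤ degV es v * W
      top-part = ≤-trans (≤-trans (≤-reflexive (sym (+-identityʳ (levelSum 0))))
        (scaled 0 (atLevel 0) (λ i e → proj₁ (atLevel-true {0} {i} e) , z≤n))) (*-monoˡ-≤ W level₀≤deg)
      disjoint : ∀ i → when (atLevel 0 i) 1 + when (atLeast 1 i) 1 ≤ when (tree i) 1
      disjoint i with tree i | dep (pn i)
      ... | false | _     = z≤n
      ... | true  | zero  = ≤-refl
      ... | true  | suc _ = ≤-refl
      -- One of the at most `suc q` edges is incident to `v`.
      deep-few : ∑ is (λ i → when (atLeast 1 i) 1) ≤ q
      deep-few = ≤-pred (begin
        1 + ∑ is (λ i → when (atLeast 1 i) 1)        ≤⟨ +-monoˡ-≤ _ (≤-trans (n≢0⇒n>0 d≢0) deg≤level₀) ⟩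
        level 0 + ∑ is (λ i → when (atLeast 1 i) 1)  ≡⟨ sym (∑-⊕ is _ _) ⟩
        ∑ is (λ i → when (atLevel 0 i) 1 + when (atLeast 1 i) 1) ≤⟨ ∑-mono is disjoint ⟩
        size                                         ≤⟨ le ⟩
        suc q                                        ∎)
      deep-part : deepSum 1 ≤ W
      deep-part = cancel-power 1 W (begin
        q ^ 1 * deepSum 1                           ≤⟨ scaled 1 (atLeast 1) (λ i → atLeast-true {1} {i}) ⟩
        ∑ is (λ i → when (atLeast 1 i) 1) * W       ≤⟨ *-monoˡ-≤ W deep-few ⟩
        q * W                                       ≡⟨ cong (_* W) (sym (*-identityʳ q)) ⟩
        q ^ 1 * W                                   ∎)

    -- A single edge at `v` already has weight `W`.
    W≤total : 0 < degV es v → W ≤ ∑ is Y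
    W≤total pos with ∑-positive (λ i → when (incB es i v) 1) pos
    ... | i , p with incB es i v in e
    ...   | true = ≤-trans (≤-reflexive (sym (trans (sym (+-identityʳ (Y i))) (trans (cong (λ d → k ^ d * Y i) (sym (trans (cong dep r) root))) (Y-in i (cong rep r)))))) (∑-single i Y)
      where
      r : pn i ≡ v
      r = inc-root (incB-sound es i v e)

-- A superadditive potential of tree sizes

module Potential where

  open import Data.Nat
  open import Data.Nat.Properties
  open import Data.Nat.DivMod
  open import Data.Nat.Tactic.RingSolver using (solve-∀)
  open import Data.Empty using (⊥-elim)
  open import Relation.Nullary using (yes; no)
  open import Relation.Binary.PropositionalEquality

  module Weights (q : ℕ) (2≤q : 2 ≤ q) where

    instance
      q-nonZero : NonZero q
      q-nonZero = >-nonZero (≤-trans (s≤s z≤n) 2≤q)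

    -- lg counts the powers q ^ j ≤ s with j ≥ 1 and surplus is the sum of q * (s / q ^ j ∸ 1) over j ≥ 1;
    -- the first argument bounds j.
    lg surplus : ℕ → ℕ → ℕ
    lg zero    s = 0
    lg (suc M) s with s / q
    ... | zero      = 0
    ... | x@(suc _) = suc (lg M x)
    surplus zero    s = 0
    surplus (suc M) s = q * (s / q ∸ 1) + surplus M (s / q)

    quotient-< : ∀ s → s < q * suc (s / q)
    quotient-< s = ≤-trans (≤-reflexive (cong suc (m≡m%n+[m/n]*n s q)))
      (≤-trans (+-monoˡ-≤ (s / q * q) (m%n<n s q)) (≤-reflexive (trans (cong (q +_) (*-comm (s / q) q)) (sym (*-suc q (s / q))))))

    quotient-≤ : ∀ s → q * (s / q) ≤ s
    quotient-≤ s = ≤-trans (≤-reflexive (*-comm q (s / q))) (m/n*n≤m s q)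

    -- `suc (lg M s)` is the number of digits of `s` in base `q`, with one digit for `s = 0`;
    -- `s ≤ M` lets the recursion finish.
    lg-bound : ∀ M s → s ≤ M → s < q ^ suc (lg M s)
    lg-bound zero    zero    z≤n = ≤-trans (≤-trans (s≤s z≤n) 2≤q) (≤-reflexive (sym (*-identityʳ q)))
    lg-bound (suc M) s s≤M with s / q in eq
    ... | zero = ≤-trans (subst (λ x → s < q * suc x) eq (quotient-< s)) ≤-refl
    ... | suc x = ≤-trans (subst (λ x → s < q * suc x) eq (quotient-< s)) (*-monoʳ-≤ q (lg-bound M (suc x) smaller))
      where
      s≢0 : NonZero s
      s≢0 = ≢-nonZero (λ { refl → 0≢1+n (trans (sym (0/n≡0 q)) eq) })
      smaller : suc x ≤ M
      smaller = ≤-pred (≤-trans (subst (_< s) eq (m/n<m s q {{s≢0}} 2≤q)) s≤M)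

    surplus-mono : ∀ M {s t} → s ≤ t → surplus M s ≤ surplus M t
    surplus-mono zero    s≤t = z≤n
    surplus-mono (suc M) {s} {t} s≤t = +-mono-≤ (*-monoʳ-≤ q (∸-monoˡ-≤ 1 (/-monoˡ-≤ q s≤t))) (surplus-mono M (/-monoˡ-≤ q s≤t))

    quotient-+ : ∀ s t → s / q + t / q ≤ (s + t) / q
    quotient-+ s t = ≤-trans (≤-reflexive (sym (m*n/n≡m (s / q + t / q) q)))
      (/-monoˡ-≤ q (≤-trans (≤-reflexive (*-distribʳ-+ q (s / q) (t / q))) (+-mono-≤ (m/n*n≤m s q) (m/n*n≤m t q))))

    -- For every `j` with `1 ≤ j ≤ lg M s` both quotients by `q ^ j` are positive, so two subtracted
    -- units merge into one and `q` is gained. For larger `j` nothing is lost.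
    surplus-+ : ∀ M s t → s ≤ t → surplus M s + surplus M t + q * lg M s ≤ surplus M (s + t)
    surplus-+ zero    s t s≤t = ≤-reflexive (*-zeroʳ q)
    surplus-+ (suc M) s t s≤t with s / q in eqs | t / q in eqt
    ... | zero | y = begin
        q * 0 + surplus M 0 + (q * (y ∸ 1) + surplus M y) + q * 0   ≡⟨ lemma q (surplus M 0) (q * (y ∸ 1)) (surplus M y) ⟩
        q * (y ∸ 1) + (surplus M 0 + surplus M y)                   ≤⟨ +-monoʳ-≤ (q * (y ∸ 1)) (m+n≤o⇒m≤o _ (surplus-+ M 0 y z≤n)) ⟩
        q * (y ∸ 1) + surplus M y                                   ≤⟨ +-mono-≤ (*-monoʳ-≤ q (∸-monoˡ-≤ 1 y≤)) (surplus-mono M y≤) ⟩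
        q * ((s + t) / q ∸ 1) + surplus M ((s + t) / q)             ∎
      where
      open ≤-Reasoning
      lemma : ∀ q a b c → q * 0 + a + (b + c) + q * 0 ≡ b + (a + c)
      lemma = solve-∀
      y≤ : y ≤ (s + t) / q
      y≤ = ≤-trans (≤-reflexive (sym eqt)) (≤-trans (m≤n+m (t / q) (s / q)) (quotient-+ s t))
    ... | suc x | zero = ⊥-elim (1+n≰n {0} (≤-trans (s≤s z≤n) (≤-trans (≤-reflexive (sym eqs)) (≤-trans (/-monoˡ-≤ q s≤t) (≤-reflexive eqt)))))
    ... | suc x | suc y = begin
        q * x + surplus M (suc x) + (q * y + surplus M (suc y)) + q * suc (lg M (suc x))
          ≡⟨ lemma q x y (surplus M (suc x)) (surplus M (suc y)) (lg M (suc x)) ⟩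
        q * (x + suc y) + (surplus M (suc x) + surplus M (suc y) + q * lg M (suc x))
          ≤⟨ +-monoʳ-≤ (q * (x + suc y)) (surplus-+ M (suc x) (suc y) (≤-trans (≤-reflexive (sym eqs)) (≤-trans (/-monoˡ-≤ q s≤t) (≤-reflexive eqt)))) ⟩
        q * (x + suc y) + surplus M (suc x + suc y)
          ≤⟨ +-mono-≤ (*-monoʳ-≤ q (∸-monoˡ-≤ 1 xy≤)) (surplus-mono M xy≤) ⟩
        q * ((s + t) / q ∸ 1) + surplus M ((s + t) / q) ∎
      where
      open ≤-Reasoning
      lemma : ∀ q x y a b c → q * x + a + (q * y + b) + q * suc c ≡ q * (x + suc y) + (a + b + q * c)
      lemma = solve-∀
      xy≤ : suc x + suc y ≤ (s + t) / q
      xy≤ = ≤-trans (≤-reflexive (cong₂ _+_ (sym eqs) (sym eqt))) (quotient-+ s t)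

    -- A geometric series of ratio at most one half, because `2 ≤ q`.
    surplus-≤ : ∀ M s → surplus M s ≤ 2 * s
    surplus-≤ zero    s = z≤n
    surplus-≤ (suc M) s = begin
      q * (s / q ∸ 1) + surplus M (s / q) ≤⟨ +-mono-≤ (*-monoʳ-≤ q (m∸n≤m (s / q) 1)) (surplus-≤ M (s / q)) ⟩
      q * (s / q) + 2 * (s / q)           ≤⟨ +-mono-≤ (quotient-≤ s) (≤-trans (*-monoˡ-≤ (s / q) 2≤q) (quotient-≤ s)) ⟩
      s + s                               ≡⟨ cong (s +_) (sym (+-identityʳ s)) ⟩
      2 * s                               ∎
      where open ≤-Reasoning

    lg-pos : ∀ M s → q ≤ s → s ≤ M → 1 ≤ lg M s
    lg-pos zero    s q≤s s≤0 = ⊥-elim (1+n≰n {0} (≤-trans (≤-trans (s≤s z≤n) 2≤q) (≤-trans q≤s s≤0)))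
    lg-pos (suc M) s q≤s _ with s / q in eq
    ... | suc _ = s≤s z≤n
    ... | zero = ⊥-elim (1+n≰n (≤-trans (≤-trans (subst (λ x → s < q * suc x) eq (quotient-< s)) (≤-reflexive (*-identityʳ q))) q≤s))

    -- It vanishes up to `Δ = suc q` edges, where degrees pay. The linear term pays for a small tree
    -- that joins a large one. The factor `2` turns the gain `q * lg M s` into the price
    -- `q * suc (lg M s)` of joining two large trees.
    potential : ℕ → ℕ → ℕ
    potential M s with s ≤? suc q
    ... | yes _ = 0
    ... | no _  = s + 2 * surplus M s

    potential-small : ∀ M {s} → s ≤ suc q → potential M s ≡ 0
    potential-small M {s} le with s ≤? suc q
    ... | yes _ = refl
    ... | no gt = ⊥-elim (gt le)

    potential-large : ∀ M {s} → suc q < s → potential M s ≡ s + 2 * surplus M s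
    potential-large M {s} gt with s ≤? suc q
    ... | yes le = ⊥-elim (<⇒≱ gt le)
    ... | no _ = refl

    potential-≤ : ∀ M s → potential M s ≤ 5 * s
    potential-≤ M s with s ≤? suc q
    ... | yes _ = z≤n
    ... | no _ = ≤-trans (+-monoʳ-≤ s (*-monoʳ-≤ 2 (surplus-≤ M s))) (≤-reflexive (lemma s))
      where
      lemma : ∀ s → s + 2 * (2 * s) ≡ 5 * s
      lemma = solve-∀

    -- The small tree had potential `0`; after the merger its `s` edges count in the linear term,
    -- which is exactly the gain.
    merge-middle : ∀ M s t → s ≤ suc q → suc q < t → s + (potential M s + potential M t) ≤ potential M (suc (s + t))
    merge-middle M s t s≤ t> rewrite potential-small M s≤ | potential-large M t>
      | potential-large M (≤-trans t> (≤-trans (m≤n+m t s) (n≤1+n (s + t)))) = begin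
        s + (t + 2 * surplus M t)                       ≡⟨ sym (+-assoc s t _) ⟩
        s + t + 2 * surplus M t                         ≤⟨ +-mono-≤ (n≤1+n (s + t)) (*-monoʳ-≤ 2 (surplus-mono M (≤-trans (m≤n+m t s) (n≤1+n (s + t))))) ⟩
        suc (s + t) + 2 * surplus M (suc (s + t))       ∎
      where open ≤-Reasoning

    merge-large : ∀ M s t → suc q < s → s ≤ t → s ≤ M →
                  q * suc (lg M s) + (potential M s + potential M t) ≤ potential M (suc (s + t))
    merge-large M s t s> s≤t s≤M rewrite potential-large M s> | potential-large M (<-≤-trans s> s≤t)
      | potential-large M (≤-trans s> (≤-trans (m≤m+n s t) (n≤1+n (s + t)))) = begin
        -- As `s` exceeds `q`, `lg M s` is at least `1`, so `suc (lg M s)` is at most twice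
        -- `lg M s`.
        q * suc (lg M s) + (s + 2 * A + (t + 2 * B))          ≤⟨ +-monoˡ-≤ _ (*-monoʳ-≤ q (+-monoˡ-≤ (lg M s) (lg-pos M s (≤-trans (≤-trans (n≤1+n q) (n≤1+n (suc q))) s>) s≤M))) ⟩
        q * (lg M s + lg M s) + (s + 2 * A + (t + 2 * B))     ≡⟨ lemma q (lg M s) s t A B ⟩
        s + t + 2 * (A + B + q * lg M s)                      ≤⟨ +-mono-≤ (n≤1+n (s + t)) (*-monoʳ-≤ 2 (≤-trans (surplus-+ M s t s≤t) (surplus-mono M (n≤1+n (s + t))))) ⟩
        suc (s + t) + 2 * surplus M (suc (s + t))             ∎
      where
      open ≤-Reasoning
      A B : ℕ
      A = surplus M s
      B = surplus M t
      lemma : ∀ q x s t A B → q * (x + x) + (s + 2 * A + (t + 2 * B)) ≡ s + t + 2 * (A + B + q * x)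
      lemma = solve-∀

    merge-any : ∀ M s t → s ≤ t → s ≤ M → potential M s + potential M t ≤ potential M (suc (s + t))
    merge-any M s t s≤t s≤M with suc q <? s
    ... | yes s> = ≤-trans (m≤n+m _ (q * suc (lg M s))) (merge-large M s t s> s≤t s≤M)
    ... | no s≯ with suc q <? t
    ...   | yes t> = ≤-trans (m≤n+m _ s) (merge-middle M s t (≮⇒≥ s≯) t>)
    ...   | no t≯ rewrite potential-small M (≮⇒≥ s≯) | potential-small M (≮⇒≥ t≯) = z≤n

-- Amortisation over an insertion sequence

module Amortisation (n q c : ℕ) (2≤q : 2 ≤ q) where

  open FiniteSums
  open Expectation
  open import Data.Nat as ℕ using (suc; _<_; z≤n; s≤s; _+_; _*_)
  open import Data.Nat.Properties
  open import Data.Nat.Tactic.RingSolver using (solve-∀)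
  open import Data.Bool using (Bool; true; false; _∨_; _∧_; if_then_else_; T)
  open import Data.Bool.Properties using (∨-comm)
  import Data.Fin as Fin
  open import Data.List using ([]; _∷_; allFin)
  open import Data.List.Relation.Unary.Any using (here; there)
  open import Data.Vec using ([]; _∷_; lookup)
  open import Data.Product using (∃₂; proj₁; proj₂)
  open import Data.Sum using (_⊎_; inj₁; inj₂)
  open import Data.Empty using (⊥-elim)
  open import Data.Rational as ℚ using (ℚ; 0ℚ)
  import Data.Rational.Properties as ℚ
  import Data.Rational.Solver as ℚSolver
  open import Function using (_∘_)
  open import Relation.Nullary using (¬_; Dec; yes; no)
  open import Relation.Binary.PropositionalEquality

  Δ κ k : ℕ
  Δ = suc q
  κ = suc q + c
  k = q + c

  open Process n κ Δ
  open Potential.Weights q 2≤q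

  -- The induction step: `A₁` belongs to the recourse of the insertion and `A₂` to the remaining
  -- run, `Z` and `Z′` count the proper colourings before and after, `B` and `B′` are the respective
  -- bounds. All terms are multiplied by `Fv * Fu`, which is positive because both ends have a free
  -- colour, and the factor is cancelled at the end.
  module Combine (Fu Fv K A₁ A₂ h S′ Z Z′ B B′ : ℚ) .{{_ : ℚ.Positive (Fv ℚ.* Fu)}} .{{_ : ℚ.NonNegative K}}
                 (eq₁ : Fv ℚ.* (Fu ℚ.* A₁) ≡ h) (eq₂ : Fv ℚ.* (Fu ℚ.* A₂) ≡ K ℚ.* S′)
                 (eqZ : Fv ℚ.* (Fu ℚ.* Z) ≡ K ℚ.* Z′) where

    open ℚSolver.+-*-Solver

    P : ℚ
    P = Fv ℚ.* Fu

    lhs : P ℚ.* (K ℚ.* (A₁ ℚ.+ A₂)) ≡ K ℚ.* h ℚ.+ K ℚ.* (K ℚ.* S′)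
    lhs = trans (solve 5 (λ fv fu k a b → (fv :* fu) :* (k :* (a :+ b)) := k :* (fv :* (fu :* a)) :+ k :* (fv :* (fu :* b))) refl Fv Fu K A₁ A₂)
      (cong₂ (λ a b → K ℚ.* a ℚ.+ K ℚ.* b) eq₁ eq₂)

    rhs : P ℚ.* (Z ℚ.* (B ℚ.+ B′)) ≡ P ℚ.* (Z ℚ.* B) ℚ.+ K ℚ.* (Z′ ℚ.* B′)
    rhs = trans (solve 5 (λ fv fu z a b → (fv :* fu) :* (z :* (a :+ b)) := (fv :* fu) :* (z :* a) :+ (fv :* (fu :* z)) :* b) refl Fv Fu Z B B′)
      (cong (P ℚ.* (Z ℚ.* B) ℚ.+_) (trans (cong (ℚ._* B′) eqZ) (ℚ.*-assoc K Z′ B′)))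

    upper : K ℚ.* h ℚ.≤ P ℚ.* (Z ℚ.* B) → K ℚ.* S′ ℚ.≤ Z′ ℚ.* B′ → K ℚ.* (A₁ ℚ.+ A₂) ℚ.≤ Z ℚ.* (B ℚ.+ B′)
    upper h≤ S≤ = ℚ.*-cancelˡ-≤-pos P (subst₂ ℚ._≤_ (sym lhs) (sym rhs) (ℚ.+-mono-≤ h≤ (ℚ.*-monoˡ-≤-nonNeg K S≤)))

    lower : P ℚ.* (Z ℚ.* B) ℚ.≤ K ℚ.* h → Z′ ℚ.* B′ ℚ.≤ K ℚ.* S′ → Z ℚ.* (B ℚ.+ B′) ℚ.≤ K ℚ.* (A₁ ℚ.+ A₂)
    lower h≥ S≥ = ℚ.*-cancelˡ-≤-pos P (subst₂ ℚ._≤_ (sym rhs) (sym lhs) (ℚ.+-mono-≤ h≥ (ℚ.*-monoˡ-≤-nonNeg K S≥)))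

  module Step {m} (es : Edges m) (rep : Fin n → Fin n) (F : Forest es rep) (deg≤ : ∀ x → degV es x ≤ Δ)
              (x y : Fin n) (x≁y : ¬ rep x ≡ rep y) (dx : degV es x ≤ q) (dy : degV es y ≤ q) where

    orientV : Fin n × Fin n
    orientV =
      if (sizeV es rep x ℕ.≤ᵇ Δ) ∧ (sizeV es rep y ℕ.≤ᵇ Δ)
      then (if degV es y ℕ.≤ᵇ degV es x then (x , y) else (y , x))
      else (if sizeV es rep y ℕ.≤ᵇ sizeV es rep x then (x , y) else (y , x))

    orient-mk : ∀ χ → orient (mk es χ) x y ≡ orientV
    orient-mk χ rewrite treeSize-mk es rep F χ x | treeSize-mk es rep F χ y | deg-mk es χ x | deg-mk es χ y = refl

    -- In the second alternative the tree of `u` is large, being the larger of two trees of which at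
    -- least one has more than `Δ` edges.
    Ordered : Fin n → Fin n → Set
    Ordered u v = (sizeV es rep v ≤ Δ × degV es v ≤ degV es u) ⊎ (sizeV es rep v ≤ sizeV es rep u × Δ < sizeV es rep u)

    Oriented : Fin n → Fin n → Set
    Oriented u v = (u ≡ x × v ≡ y) ⊎ (u ≡ y × v ≡ x)

    oriented-elim : (P : Fin n → Fin n → Set) → P x y → P y x → ∀ {u v} → Oriented u v → P u v
    oriented-elim P p₁ p₂ (inj₁ (refl , refl)) = p₁
    oriented-elim P p₁ p₂ (inj₂ (refl , refl)) = p₂

    ≤ᵇ-true : ∀ a b → (a ℕ.≤ᵇ b) ≡ true → a ≤ b
    ≤ᵇ-true a b e = ≤ᵇ⇒≤ a b (subst T (sym e) _)

    ≤ᵇ-false : ∀ a b → (a ℕ.≤ᵇ b) ≡ false → b < a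
    ≤ᵇ-false a b e = ≰⇒> (λ le → subst T e (≤⇒≤ᵇ le))

    X Y : ℕ
    X = sizeV es rep x
    Y = sizeV es rep y

    orient-cases : ∃₂ λ u v → orientV ≡ (u , v) × Oriented u v × Ordered u v
    orient-cases with X ℕ.≤ᵇ Δ in sx | Y ℕ.≤ᵇ Δ in sy
    ... | true | true with degV es y ℕ.≤ᵇ degV es x in d
    ...   | true  = x , y , refl , inj₁ (refl , refl) , inj₁ (≤ᵇ-true Y Δ sy , ≤ᵇ-true (degV es y) (degV es x) d)
    ...   | false = y , x , refl , inj₂ (refl , refl) , inj₁ (≤ᵇ-true X Δ sx , <⇒≤ (≤ᵇ-false (degV es y) (degV es x) d))
    orient-cases | true | false with Y ℕ.≤ᵇ X in s
    ...   | true  = x , y , refl , inj₁ (refl , refl) , inj₂ (≤ᵇ-true Y X s , <-≤-trans (≤ᵇ-false Y Δ sy) (≤ᵇ-true Y X s))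
    ...   | false = y , x , refl , inj₂ (refl , refl) , inj₂ (<⇒≤ (≤ᵇ-false Y X s) , ≤ᵇ-false Y Δ sy)
    orient-cases | false | b with Y ℕ.≤ᵇ X in s
    ...   | true  = x , y , refl , inj₁ (refl , refl) , inj₂ (≤ᵇ-true Y X s , ≤ᵇ-false X Δ sx)
    ...   | false = y , x , refl , inj₂ (refl , refl) , inj₂ (<⇒≤ (≤ᵇ-false Y X s) , <-trans (≤ᵇ-false X Δ sx) (≤ᵇ-false Y X s))

    module Insert (u v : Fin n) (or : orientV ≡ (u , v)) (uv : Oriented u v) where

      u≁v : ¬ rep u ≡ rep v
      u≁v = oriented-elim (λ a b → ¬ rep a ≡ rep b) x≁y (λ e → x≁y (sym e)) uv

      du : degV es u ≤ q
      du = oriented-elim (λ a _ → degV es a ≤ q) dx dy uv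

      dv : degV es v ≤ q
      dv = oriented-elim (λ _ b → degV es b ≤ q) dy dx uv

      free-pos : ∀ {z} → degV es z ≤ q → 0 < free es z
      free-pos {z} le = m<n⇒0<n∸m (≤-<-trans le (s≤s (m≤m+n q c)))

      R : Rooted es rep v
      R = Forest.rooted F v

      open InsertTree es rep u v R u≁v public
      open CountTree es rep u v R u≁v public

      oriented : ∀ χ → orient (mk es χ) x y ≡ (u , v)
      oriented χ = trans (orient-mk χ) or

      avg : (Colouring m → St → ℚ) → ℚ
      avg = average x y oriented (free-pos du) (free-pos dv)

      Z W : ℕ
      Z = # (proper es)
      W = free es u * free es v * Z

      weight : Fin m → ℕ
      weight i = κ * hits i

      module L = Level es rep v R q k W (≤-trans (s≤s z≤n) 2≤q) (m≤m+n q c) deg≤ dv weight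
        (λ i r → trans (cong (κ *_) (hits-outside i r)) (*-zeroʳ κ)) (hits-weight k refl)

      size-agrees : L.size ≡ sizeV es rep v
      size-agrees = ∑-cong (allFin m) (λ i → cong (λ z → when (z == rep v) 1) (sym (Rooted.inc-rep R (_ , inj₁ refl))))

      cost : ℕ → Ordered u v → ℕ
      cost M (inj₁ _) = suc (degV es v)
      cost M (inj₂ _) with sizeV es rep v ℕ.≤? Δ
      ... | yes _ = sizeV es rep v
      ... | no _  = q * suc (lg M (sizeV es rep v))

      hits≤cost : ∀ M o → sizeV es rep v ≤ M → ∑ (allFin m) weight ≤ W * cost M o
      hits≤cost M (inj₁ (s≤Δ , _)) _ = L.total≤deg (≤-trans (≤-reflexive size-agrees) s≤Δ)
      hits≤cost M (inj₂ _) s≤M with sizeV es rep v ℕ.≤? Δ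
      ... | yes _ = subst (λ s → ∑ (allFin m) weight ≤ W * s) size-agrees L.total≤size
      ... | no _  = L.total≤log (lg M (sizeV es rep v)) (≤-trans (≤-reflexive size-agrees) (<⇒≤ (lg-bound M (sizeV es rep v) s≤M)))

      Fu Fv K : ℚ
      Fu = toℚ (free es u)
      Fv = toℚ (free es v)
      K  = toℚ κ

      scale : ∀ b → toℚ (W * b) ≡ Fv ℚ.* Fu ℚ.* (toℚ Z ℚ.* toℚ b)
      scale b = begin
        toℚ (free es u * free es v * Z * b)           ≡⟨ cong toℚ (trans (*-assoc (free es u * free es v) Z b) (cong (_* (Z * b)) (*-comm (free es u) (free es v)))) ⟩
        toℚ (free es v * free es u * (Z * b))         ≡⟨ trans (toℚ-* (free es v * free es u) (Z * b)) (cong₂ ℚ._*_ (toℚ-* (free es v) (free es u)) (toℚ-* Z b)) ⟩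
        Fv ℚ.* Fu ℚ.* (toℚ Z ℚ.* toℚ b)               ∎
        where open ≡-Reasoning

      hits-κ : K ℚ.* toℚ (∑ (allFin m) hits) ≡ toℚ (∑ (allFin m) weight)
      hits-κ = trans (sym (toℚ-* κ _)) (cong toℚ (∑-*ˡ κ (allFin m) hits))

      instance
        P-pos : ℚ.Positive (Fv ℚ.* Fu)
        P-pos = subst ℚ.Positive (toℚ-* (free es v) (free es u)) (toℚ-pos (free es v * free es u) {{ℕ.>-nonZero (*-mono-≤ (free-pos dv) (free-pos du))}})
        K-nonNeg : ℚ.NonNegative K
        K-nonNeg = toℚ-nonNeg κ

      -- `uniform` applied to the constant function `1`.
      count-next : Fv ℚ.* (Fu ℚ.* toℚ Z) ≡ K ℚ.* toℚ (# (proper es′))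
      count-next = begin
        Fv ℚ.* (Fu ℚ.* toℚ Z)
          ≡⟨ cong (λ z → Fv ℚ.* (Fu ℚ.* z)) (trans (toℚ-∑ (colourings m) _) (ℚ∑.∑-cong (colourings m) (λ χ →
               trans (toℚ-when (proper es χ) 1) (cong (whenℚ (proper es χ)) (sym (𝔼-const (insert (mk es χ) x y) (toℚ 1))))))) ⟩
        Fv ℚ.* (Fu ℚ.* avg (λ _ _ → toℚ 1))
          ≡⟨ uniform x y oriented (free-pos du) (free-pos dv) (λ _ → toℚ 1) (≤-trans (deg≤ v) (m≤m+n (suc q) c)) ⟩
        K ℚ.* ∑ℚ (colourings (suc m)) (λ ψ → whenℚ (proper es′ ψ) (toℚ 1))
          ≡⟨ cong (K ℚ.*_) (sym (trans (toℚ-∑ (colourings {κ} (suc m)) (λ ψ → when (proper es′ ψ) 1)) (ℚ∑.∑-cong (colourings (suc m)) (λ ψ → toℚ-when (proper es′ ψ) 1)))) ⟩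
        K ℚ.* toℚ (# (proper es′)) ∎
        where open ≡-Reasoning

      module _ (g : St → ℚ) where

        A₁ A₂ S′ : ℚ
        A₁ = avg (λ χ st → toℚ (recourse (mk es χ) st))
        A₂ = avg (λ _ → g)
        S′ = ∑ℚ (colourings (suc m)) (λ ψ → whenℚ (proper es′ ψ) (g (mk es′ ψ)))

        combined : ℚ
        combined = ∑ℚ (colourings m) (λ χ → whenℚ (proper es χ) (𝔼 (insert (mk es χ) x y) (λ st → toℚ (recourse (mk es χ) st) ℚ.+ g st)))

        combined-split : combined ≡ A₁ ℚ.+ A₂
        combined-split = trans (ℚ∑.∑-cong (colourings m) (λ χ → trans (cong (whenℚ (proper es χ)) (𝔼-+ (insert (mk es χ) x y) _ g)) (ℚ∑.when-⊕ (proper es χ) _ _)))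
          (ℚ∑.∑-⊕ (colourings m) _ _)

        module C (B B′ : ℕ) = Combine Fu Fv K A₁ A₂ (toℚ (∑ (allFin m) hits)) S′ (toℚ Z) (toℚ (# (proper es′))) (toℚ B) (toℚ B′)
          (expected-recourse x y oriented (free-pos du) (free-pos dv))
          (uniform x y oriented (free-pos du) (free-pos dv) g (≤-trans (deg≤ v) (m≤m+n (suc q) c))) count-next

        step-upper : ∀ B B′ → ∑ (allFin m) weight ≤ W * B → K ℚ.* S′ ℚ.≤ toℚ (# (proper es′)) ℚ.* toℚ B′ →
                     K ℚ.* combined ℚ.≤ toℚ Z ℚ.* toℚ (B + B′)
        step-upper B B′ h≤ S≤ = subst₂ ℚ._≤_ (cong (K ℚ.*_) (sym combined-split)) (cong (toℚ Z ℚ.*_) (sym (toℚ-+ B B′)))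
          (C.upper B B′ (subst₂ ℚ._≤_ (sym hits-κ) (scale B) (toℚ-mono h≤)) S≤)

        step-lower : ∀ B B′ → W * B ≤ ∑ (allFin m) weight → toℚ (# (proper es′)) ℚ.* toℚ B′ ℚ.≤ K ℚ.* S′ →
                     toℚ Z ℚ.* toℚ (B + B′) ℚ.≤ K ℚ.* combined
        step-lower B B′ h≥ S≥ = subst₂ ℚ._≤_ (cong (toℚ Z ℚ.*_) (sym (toℚ-+ B B′))) (cong (K ℚ.*_) (sym combined-split))
          (C.lower B B′ (subst₂ ℚ._≤_ (scale B) (sym hits-κ) (toℚ-mono h≥)) S≥)

  Reach-trans : ∀ {acc : List (Fin n × Fin n)} {x y z} → Reach acc x y → Reach acc y z → Reach acc x z
  Reach-trans here      s = s
  Reach-trans (fwd e r) s = fwd e (Reach-trans r s)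
  Reach-trans (bwd e r) s = bwd e (Reach-trans r s)

  Reach-sym : ∀ {acc : List (Fin n × Fin n)} {x y} → Reach acc x y → Reach acc y x
  Reach-sym here      = here
  Reach-sym (fwd e r) = Reach-trans (Reach-sym r) (bwd e here)
  Reach-sym (bwd e r) = Reach-trans (Reach-sym r) (fwd e here)

  Reach-mono : ∀ {acc : List (Fin n × Fin n)} {e x y} → Reach acc x y → Reach (e ∷ acc) x y
  Reach-mono here      = here
  Reach-mono (fwd e r) = fwd (there e) (Reach-mono r)
  Reach-mono (bwd e r) = bwd (there e) (Reach-mono r)

  degE-cons : ∀ a b (es : List (Fin n × Fin n)) x → degE ((a , b) ∷ es) x ≡ when ((a == x) ∨ (b == x)) 1 + degE es x
  degE-cons a b es x with (a == x) ∨ (b == x)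
  ... | true  = refl
  ... | false = refl

  degV-cons : ∀ {m} a b (es : Edges m) x → degV ((a , b) ∷ es) x ≡ when ((a == x) ∨ (b == x)) 1 + degV es x
  degV-cons {m} a b es x = ∑-allFin-suc m (λ i → when (incB ((a , b) ∷ es) i x) 1)

  sizeV≤ : ∀ {m} (es : Edges m) rep x → sizeV es rep x ≤ m
  sizeV≤ {m} es rep x = ≤-trans (∑-mono (allFin m) (λ i → when-implies {rep (proj₁ (lookup es i)) == rep x} 1 1 (λ _ → ≤-refl))) (≤-reflexive (∑-1-allFin m))

  overTrees : (Fin n → Fin n) → (Fin n → ℕ) → ℕ
  overTrees rep a = ∑ (allFin n) (λ z → when (rep z == z) (a z))

  -- Stated without subtraction: `l` stops being a representative, `w` exchanges the value `a w` for
  -- `b w`, and all other terms agree.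
  overTrees-link : ∀ {m} (es : Edges m) rep F l w u v wl u≁v →
    let open Link es rep F l w u v wl u≁v in
    ∀ (a b : Fin n → ℕ) → (∀ z → rep z ≡ z → ¬ z ≡ l → ¬ z ≡ w → b z ≡ a z) →
    overTrees rep′ b + (a l + a w) ≡ overTrees rep a + b w
  overTrees-link es rep F l w u v wl u≁v a b agree = begin
    overTrees rep′ b + (a l + a w)
      ≡⟨ cong (overTrees rep′ b +_) (cong₂ _+_ (sym (∑-δ l a)) (sym (∑-δ w a))) ⟩
    overTrees rep′ b + (∑ (allFin n) (λ z → when (l == z) (a z)) + ∑ (allFin n) (λ z → when (w == z) (a z)))
      ≡⟨ cong (overTrees rep′ b +_) (sym (∑-⊕ (allFin n) _ _)) ⟩
    overTrees rep′ b + ∑ (allFin n) (λ z → when (l == z) (a z) + when (w == z) (a z))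
      ≡⟨ sym (∑-⊕ (allFin n) _ _) ⟩
    ∑ (allFin n) (λ z → when (rep′ z == z) (b z) + (when (l == z) (a z) + when (w == z) (a z)))
      ≡⟨ ∑-cong (allFin n) pointwise ⟩
    ∑ (allFin n) (λ z → when (rep z == z) (a z) + when (w == z) (b z))
      ≡⟨ ∑-⊕ (allFin n) _ _ ⟩
    overTrees rep a + ∑ (allFin n) (λ z → when (w == z) (b z))
      ≡⟨ cong (overTrees rep a +_) (∑-δ w b) ⟩
    overTrees rep a + b w ∎
    where
    open ≡-Reasoning
    open Link es rep F l w u v wl u≁v
    fixed : ∀ z → ¬ z ≡ w → rep′ z ≡ z → rep z ≡ z
    fixed z z≢w eq with rep z Fin.≟ l
    ... | yes _ = ⊥-elim (z≢w (sym eq))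
    ... | no _  = eq
    pointwise : ∀ z → when (rep′ z == z) (b z) + (when (l == z) (a z) + when (w == z) (a z))
                      ≡ when (rep z == z) (a z) + when (w == z) (b z)
    pointwise z = cases (l Fin.≟ z) (w Fin.≟ z)
      where
      cases : Dec (l ≡ z) → Dec (w ≡ z) → when (rep′ z == z) (b z) + (when (l == z) (a z) + when (w == z) (a z))
                      ≡ when (rep z == z) (a z) + when (w == z) (b z)
      cases (yes refl) _ rewrite ==-false (λ e → w≢l (trans (sym rep′-l) e)) | ==-refl l | ==-false w≢l | ==-complete rep-l = refl
      cases (no l≢z) (yes refl) rewrite ==-complete rep′-w | ==-false l≢z | ==-refl w | ==-complete rep-w = +-comm (b w) (a w)
      cases (no l≢z) (no w≢z) rewrite ==-false l≢z | ==-false w≢z with rep z Fin.≟ z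
      ... | yes eq rewrite ==-complete (rep′-other z (λ e → l≢z (sym e)) eq) = cong (_+ 0) (agree z eq (λ e → l≢z (sym e)) (λ e → w≢z (sym e)))
      ... | no neq rewrite ==-false (λ e → neq (fixed z (λ e → w≢z (sym e)) e)) = refl

  module Budget (f : Fin n → ℕ) (M : ℕ) where

    -- Γ pays for joining two small trees, Ω for all other insertions.
    Γ : (Fin n → Fin n) → ℕ
    Γ rep = overTrees rep f

    Ω : ∀ {m} → Edges m → (Fin n → Fin n) → ℕ
    Ω es rep = overTrees rep (λ z → potential M (sizeV es rep z))

    -- The potential is at most `5` per edge of a tree, and every edge belongs to the tree of only
    -- one representative.
    Ω≤ : ∀ {m} (es : Edges m) rep → Ω es rep ≤ 5 * m
    Ω≤ {m} es rep = begin
      Ω es rep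
        ≤⟨ ∑-mono (allFin n) (λ z → when-≤ (rep z == z) (λ _ → potential-≤ M (sizeV es rep z))) ⟩
      ∑ (allFin n) (λ z → when (rep z == z) (5 * sizeV es rep z))
        ≡⟨ trans (∑-cong (allFin n) (λ z → sym (when-* (rep z == z) 5 _))) (sym (∑-*ˡ 5 (allFin n) _)) ⟩
      5 * ∑ (allFin n) (λ z → when (rep z == z) (sizeV es rep z))
        ≡⟨ cong (5 *_) (trans (∑-cong (allFin n) (λ z → ∑-when (rep z == z) (allFin m) _)) (∑-swap (allFin n) (allFin m) _)) ⟩
      5 * ∑ (allFin m) (λ i → ∑ (allFin n) (λ z → when (rep z == z) (when (rep (proj₁ (lookup es i)) == rep z) 1)))
        ≤⟨ *-monoʳ-≤ 5 (∑-mono (allFin m) (λ i → ≤-trans (∑-mono (allFin n) (λ z → bound (rep (proj₁ (lookup es i))) z)) (≤-reflexive (∑-δ (rep (proj₁ (lookup es i))) (λ _ → 1))))) ⟩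
      5 * ∑ (allFin m) (λ _ → 1)
        ≡⟨ cong (5 *_) (∑-1-allFin m) ⟩
      5 * m ∎
      where
      open ≤-Reasoning
      bound : ∀ y z → when (rep z == z) (when (y == rep z) 1) ≤ when (y == z) 1
      bound y z = when-implies {rep z == z} _ _ (λ e → ≤-reflexive (cong (λ t → when (y == t) 1) (==-true e)))

    module Merge {m} (es : Edges m) (rep : Fin n → Fin n) (F : Forest es rep) (deg≤ : ∀ x → degV es x ≤ Δ)
                 (x y : Fin n) (x≁y : ¬ rep x ≡ rep y) (dx : degV es x ≤ q) (dy : degV es y ≤ q)
                 (deg≤f : ∀ z → degV es z ≤ f (rep z)) (m≤M : m ≤ M) where
      open Step es rep F deg≤ x y x≁y dx dy public

      module _ (u v : Fin n) (or : orientV ≡ (u , v)) (uv : Oriented u v) (l w : Fin n) (wl : Swaps rep l w u v) where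
        open Insert u v or uv
        open Link es rep F l w u v wl u≁v

        s t : ℕ
        s = sizeV es rep v
        t = sizeV es rep u

        s≤M : s ≤ M
        s≤M = ≤-trans (sizeV≤ es rep v) m≤M

        Γ-link : Γ rep′ + f l ≡ Γ rep
        Γ-link = +-cancelʳ-≡ (f w) _ _ (trans (+-assoc (Γ rep′) (f l) (f w))
          (overTrees-link es rep F l w u v wl u≁v f f (λ _ _ _ _ → refl)))

        p : ℕ → ℕ
        p = potential M

        p-sizes : p (sizeV es rep l) + p (sizeV es rep w) ≡ p s + p t
        p-sizes = go wl
          where
          go : Swaps rep l w u v → p (sizeV es rep l) + p (sizeV es rep w) ≡ p s + p t
          go (inj₁ (refl , refl)) = cong₂ (λ a b → p a + p b) (sizeV-cong es rep (Forest.idem F v)) (sizeV-cong es rep (Forest.idem F u))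
          go (inj₂ (refl , refl)) = trans (cong₂ (λ a b → p a + p b) (sizeV-cong es rep (Forest.idem F u)) (sizeV-cong es rep (Forest.idem F v))) (+-comm (p t) (p s))

        p-merged : p (sizeV es′ rep′ w) ≡ p (suc (s + t))
        p-merged = cong p (trans size-w (cong suc (go wl)))
          where
          go : Swaps rep l w u v → sizeV es rep w + sizeV es rep l ≡ s + t
          go (inj₁ (refl , refl)) = trans (cong₂ _+_ (sizeV-cong es rep (Forest.idem F u)) (sizeV-cong es rep (Forest.idem F v))) (+-comm t s)
          go (inj₂ (refl , refl)) = cong₂ _+_ (sizeV-cong es rep (Forest.idem F v)) (sizeV-cong es rep (Forest.idem F u))

        Ω-link : Ω es′ rep′ + (p s + p t) ≡ Ω es rep + p (suc (s + t))
        Ω-link = trans (cong (Ω es′ rep′ +_) (sym p-sizes)) (trans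
          (overTrees-link es rep F l w u v wl u≁v (λ z → p (sizeV es rep z)) (λ z → p (sizeV es′ rep′ z)) (λ z eq z≢l z≢w → cong p (size-other z eq z≢l z≢w)))
          (cong (Ω es rep +_) p-merged))

        Ω-grows : ∀ b → b + (p s + p t) ≤ p (suc (s + t)) → b + Ω es rep ≤ Ω es′ rep′
        Ω-grows b le = +-cancelʳ-≤ (p s + p t) _ _ (begin
          b + Ω es rep + (p s + p t)       ≡⟨ trans (cong (_+ (p s + p t)) (+-comm b (Ω es rep))) (+-assoc (Ω es rep) b _) ⟩
          Ω es rep + (b + (p s + p t))     ≤⟨ +-monoʳ-≤ (Ω es rep) le ⟩
          Ω es rep + p (suc (s + t))       ≡⟨ sym Ω-link ⟩
          Ω es′ rep′ + (p s + p t)         ∎)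
          where open ≤-Reasoning

        -- Representatives maximise the final degree in their trees. If the loser represents the
        -- tree of `v`, this bounds the degree of `v` directly; otherwise it bounds that of `u`,
        -- which is at least as large.
        deg≤loser : degV es v ≤ degV es u → degV es v ≤ f l
        deg≤loser le = go wl
          where
          go : Swaps rep l w u v → degV es v ≤ f l
          go (inj₁ (_ , refl)) = deg≤f v
          go (inj₂ (_ , refl)) = ≤-trans le (deg≤f u)

        merge-sym : p s + p t ≤ p (suc (s + t))
        merge-sym with ≤-total s t
        ... | inj₁ s≤t = merge-any M s t s≤t s≤M
        ... | inj₂ t≤s = subst₂ _≤_ (+-comm (p t) (p s)) (cong (p ∘ suc) (+-comm t s)) (merge-any M t s t≤s (≤-trans (sizeV≤ es rep u) m≤M))

        -- The decrease `f l` of `Γ` is given away; the growth of `Ω` alone pays for `b`.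
        large-step : ∀ b → b + (p s + p t) ≤ p (suc (s + t)) → b + (Γ rep′ + Ω es rep) ≤ suc (Γ rep + Ω es′ rep′)
        large-step b le = begin
          b + (Γ rep′ + Ω es rep)   ≡⟨ rearrange b (Γ rep′) (Ω es rep) ⟩
          Γ rep′ + (b + Ω es rep)   ≤⟨ +-mono-≤ (≤-trans (m≤m+n (Γ rep′) (f l)) (≤-reflexive Γ-link)) (Ω-grows b le) ⟩
          Γ rep + Ω es′ rep′        ≤⟨ n≤1+n _ ⟩
          suc (Γ rep + Ω es′ rep′)  ∎
          where
          open ≤-Reasoning
          rearrange : ∀ a b c → a + (b + c) ≡ b + (a + c)
          rearrange = solve-∀

        -- With the degree rule, the decrease of `Γ` pays for the degree of `v` and the unit on the
        -- right for the additional `1` in `cost`, while `Ω` does not decrease. With the size rule,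
        -- the growth of `Ω` pays.
        amortised : ∀ o → cost M o + (Γ rep′ + Ω es rep) ≤ suc (Γ rep + Ω es′ rep′)
        amortised (inj₁ (_ , dv≤du)) = s≤s (begin
          degV es v + (Γ rep′ + Ω es rep)   ≤⟨ +-monoˡ-≤ (Γ rep′ + Ω es rep) (deg≤loser dv≤du) ⟩
          f l + (Γ rep′ + Ω es rep)         ≡⟨ trans (sym (+-assoc (f l) (Γ rep′) (Ω es rep))) (cong (_+ Ω es rep) (trans (+-comm (f l) (Γ rep′)) Γ-link)) ⟩
          Γ rep + Ω es rep                  ≤⟨ +-monoʳ-≤ (Γ rep) (Ω-grows 0 merge-sym) ⟩
          Γ rep + Ω es′ rep′                ∎)
          where open ≤-Reasoning
        amortised (inj₂ (s≤t , Δ<t)) with s ℕ.≤? Δ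
        ... | yes s≤Δ = large-step s (merge-middle M s t s≤Δ Δ<t)
        ... | no s≰Δ  = large-step (q * suc (lg M s)) (merge-large M s t (≰⇒> s≰Δ) s≤t s≤M)

  tot : St × ℕ → ℚ
  tot p = toℚ (proj₂ p)

  run-step : ∀ st x y rest → 𝔼 (run st ((x , y) ∷ rest)) tot
             ≡ 𝔼 (insert st x y) (λ st′ → toℚ (recourse st st′) ℚ.+ 𝔼 (run st′ rest) tot)
  run-step st x y rest = trans (𝔼-bind (insert st x y) _ tot) (𝔼-cong (insert st x y) (λ st′ →
    trans (𝔼-bind (run st′ rest) _ tot) (trans (𝔼-cong (run st′ rest) (λ p → toℚ-+ (recourse st st′) (proj₂ p)))
      (trans (𝔼-+ (run st′ rest) (λ _ → toℚ (recourse st st′)) tot) (cong (ℚ._+ 𝔼 (run st′ rest) tot) (𝔼-const (run st′ rest) (toℚ (recourse st st′))))))))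

  -- If neither end is isolated, the end that becomes the child has an edge of weight `W`, whatever
  -- the orientation.
  busy : List (Fin n × Fin n) → List (Fin n × Fin n) → ℕ
  busy acc []               = 0
  busy acc ((x , y) ∷ rest) = when ((1 ℕ.≤ᵇ degE acc x) ∧ (1 ℕ.≤ᵇ degE acc y)) 1 + busy ((x , y) ∷ acc) rest

  -- The expected recourse of the remaining run, summed over all proper colourings of the present
  -- forest and not yet divided by their number.
  summed : ∀ {m} → Edges m → List (Fin n × Fin n) → ℚ
  summed {m} es rest = ∑ℚ (colourings m) (λ χ → whenℚ (proper es χ) (𝔼 (run (mk es χ) rest) tot))

  module Bounds (f : Fin n → ℕ) (f≤Δ : ∀ x → f x ≤ Δ) (M : ℕ) where
    open Budget f M

    -- `f` is the final degree, split by `degs` into present and future edges. `f-max` gives every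
    -- tree a representative of largest final degree. `reach` translates equal representatives into
    -- the connectivity that `JoinsTrees` speaks about.
    record Invariant {m} (es : Edges m) (rep : Fin n → Fin n) (acc rest : List (Fin n × Fin n)) : Set where
      field
        forest : Forest es rep
        f-max  : ∀ x → f x ≤ f (rep x)
        degs   : ∀ x → degV es x + degE rest x ≡ f x
        accdeg : ∀ x → degE acc x ≡ degV es x
        reach  : ∀ x y → rep x ≡ rep y → Reach acc x y
        valid  : JoinsTrees acc rest
        m≤M    : m + length rest ≤ M

    -- In `budget` the term `5 * (m + length rest)` reserves the value that `Ω` can reach at the
    -- end, and `length rest` supplies one unit per insertion.
    record Bounded {m} (es : Edges m) (rep : Fin n → Fin n) (acc rest : List (Fin n × Fin n)) : Set where
      constructor mkBounded
      field
        B      : ℕ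
        upper  : toℚ κ ℚ.* summed es rest ℚ.≤ toℚ (# (proper es)) ℚ.* toℚ B
        budget : B + Ω es rep ≤ Γ rep + (length rest + 5 * (m + length rest))
        lower  : toℚ (# (proper es)) ℚ.* toℚ (busy acc rest) ℚ.≤ toℚ κ ℚ.* summed es rest

    bounds : ∀ {m} (es : Edges m) rep acc rest → Invariant es rep acc rest → Bounded es rep acc rest
    bounds {m} es rep acc [] inv = mkBounded 0 (ℚ.≤-reflexive (trans zero-sum (sym zero-bound))) Ω-small (ℚ.≤-reflexive (trans zero-bound (sym zero-sum)))
      where
      zero-sum : toℚ κ ℚ.* summed es [] ≡ 0ℚ
      zero-sum = trans (cong (toℚ κ ℚ.*_) (trans (ℚ∑.∑-cong (colourings m) (λ χ → vanish (proper es χ))) (ℚ∑.∑-𝟘 (colourings m)))) (ℚ.*-zeroʳ (toℚ κ))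
        where
        vanish : ∀ b → whenℚ b (toℚ 0) ≡ 0ℚ
        vanish true  = toℚ-0
        vanish false = refl
      zero-bound : toℚ (# (proper es)) ℚ.* toℚ 0 ≡ 0ℚ
      zero-bound = trans (cong (toℚ (# (proper es)) ℚ.*_) toℚ-0) (ℚ.*-zeroʳ (toℚ (# (proper es))))
      Ω-small : Ω es rep ≤ Γ rep + 5 * (m + 0)
      Ω-small = ≤-trans (Ω≤ es rep) (≤-trans (≤-reflexive (cong (5 *_) (sym (+-identityʳ m)))) (m≤n+m _ (Γ rep)))
    bounds {m} es rep acc ((x , y) ∷ rest) inv = conclude orient-cases
      where
      open Invariant inv
      x≁y : ¬ rep x ≡ rep y
      x≁y eq = proj₁ valid (reach x y eq)
      inc : Fin n → ℕ
      inc z = when ((x == z) ∨ (y == z)) 1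
      degs′ : ∀ z → degV es z + (inc z + degE rest z) ≡ f z
      degs′ z = trans (cong (degV es z +_) (sym (degE-cons x y rest z))) (degs z)
      deg≤f : ∀ z → degV es z ≤ f z
      deg≤f z = ≤-trans (m≤m+n _ _) (≤-reflexive (degs z))
      -- The edge about to be inserted counts in the final degree, so at most `Δ ∸ 1 = q` edges are
      -- present at its ends.
      end-deg : ∀ z → inc z ≡ 1 → degV es z ≤ q
      end-deg z e = ≤-pred (begin
        suc (degV es z)                        ≡⟨ +-comm 1 (degV es z) ⟩
        degV es z + 1                          ≤⟨ +-monoʳ-≤ (degV es z) (≤-trans (≤-reflexive (sym e)) (m≤m+n (inc z) (degE rest z))) ⟩
        degV es z + (inc z + degE rest z)      ≡⟨ degs′ z ⟩
        f z                                    ≤⟨ f≤Δ z ⟩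
        Δ                                      ∎)
        where open ≤-Reasoning
      inc-x : inc x ≡ 1
      inc-x rewrite ==-refl x = refl
      inc-y : inc y ≡ 1
      inc-y = cong (λ b → when b 1) (∨-introʳ (x == y) (==-refl y))
      open Merge es rep forest (λ z → ≤-trans (deg≤f z) (f≤Δ z)) x y x≁y (end-deg x inc-x) (end-deg y inc-y)
        (λ z → ≤-trans (deg≤f z) (f-max z)) (≤-trans (m≤m+n m _) m≤M)

      inc-uv : ∀ {u v} → Oriented u v → ∀ z → (u == z) ∨ (v == z) ≡ (x == z) ∨ (y == z)
      inc-uv uv z = oriented-elim (λ u v → (u == z) ∨ (v == z) ≡ (x == z) ∨ (y == z)) refl (∨-comm (y == z) (x == z)) uv

      reach-merged : ∀ {u v} → Oriented u v → ∀ l w → Swaps rep l w u v → ∀ a b → rep a ≡ l → rep b ≡ w → Reach ((x , y) ∷ acc) a b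
      reach-merged uv l w wl a b a~l b~w = go uv wl
        where
        forth : rep a ≡ rep x → rep b ≡ rep y → Reach ((x , y) ∷ acc) a b
        forth p r = Reach-trans (Reach-mono (reach a x p)) (fwd (here refl) (Reach-mono (reach y b (sym r))))
        back : rep a ≡ rep y → rep b ≡ rep x → Reach ((x , y) ∷ acc) a b
        back p r = Reach-trans (Reach-mono (reach a y p)) (bwd (here refl) (Reach-mono (reach x b (sym r))))
        go : ∀ {u v} → Oriented u v → Swaps rep l w u v → Reach ((x , y) ∷ acc) a b
        go (inj₁ (refl , refl)) (inj₁ (p , r)) = back (trans a~l r) (trans b~w p)
        go (inj₁ (refl , refl)) (inj₂ (p , r)) = forth (trans a~l r) (trans b~w p)
        go (inj₂ (refl , refl)) (inj₁ (p , r)) = forth (trans a~l r) (trans b~w p)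
        go (inj₂ (refl , refl)) (inj₂ (p , r)) = back (trans a~l r) (trans b~w p)

      -- The representative of smaller final degree disappears; this bounds the smaller of the two degrees from above.
      choose : ∀ u v → ∃₂ λ l w → Swaps rep l w u v × f l ≤ f w
      choose u v with ≤-total (f (rep u)) (f (rep v))
      ... | inj₁ le = rep u , rep v , inj₂ (refl , refl) , le
      ... | inj₂ le = rep v , rep u , inj₁ (refl , refl) , le

      conclude : (∃₂ λ u v → orientV ≡ (u , v) × Oriented u v × Ordered u v) → Bounded es rep acc ((x , y) ∷ rest)
      conclude (u , v , or , uv , o) with choose u v
      ... | l , w , wl , fl≤fw = mkBounded (cost M o + B′) upper budget lower
        where
        open Insert u v or uv
        open Link es rep forest l w u v wl u≁v

        next : Invariant es′ rep′ ((x , y) ∷ acc) rest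
        next = record
          { forest = linked
          ; f-max  = λ z → f-max′ z (rep z Fin.≟ l)
          ; degs   = λ z → trans (cong (_+ degE rest z) (degV-cons u v es z)) (trans (cong (λ b → when b 1 + degV es z + degE rest z) (inc-uv uv z)) (trans (shuffle (inc z) (degV es z) (degE rest z)) (degs′ z)))
          ; accdeg = λ z → trans (degE-cons x y acc z) (trans (cong₂ _+_ (cong (λ b → when b 1) (sym (inc-uv uv z))) (accdeg z)) (sym (degV-cons u v es z)))
          ; reach  = reach′
          ; valid  = proj₂ valid
          ; m≤M    = ≤-trans (≤-reflexive (sym (+-suc m (length rest)))) m≤M }
          where
          shuffle : ∀ a b c → a + b + c ≡ b + (a + c)
          shuffle = solve-∀
          f-max′ : ∀ z → Dec (rep z ≡ l) → f z ≤ f (rep′ z)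
          f-max′ z (yes eq) = ≤-trans (f-max z) (≤-trans (≤-reflexive (cong f eq)) (≤-trans fl≤fw (≤-reflexive (cong f (sym (trans (cong (redirect l w) eq) (redirect-l l w)))))))
          f-max′ z (no neq) = ≤-trans (f-max z) (≤-reflexive (cong f (sym (redirect-≢ l w (rep z) neq))))
          reach′ : ∀ a b → rep′ a ≡ rep′ b → Reach ((x , y) ∷ acc) a b
          reach′ a b eq with redirect-merges l w (rep a) (rep b) eq
          ... | inj₁ p              = Reach-mono (reach a b p)
          ... | inj₂ (inj₁ (p , r)) = reach-merged uv l w wl a b p r
          ... | inj₂ (inj₂ (p , r)) = Reach-sym (reach-merged uv l w wl b a r p)

        ih : Bounded es′ rep′ ((x , y) ∷ acc) rest
        ih = bounds es′ rep′ ((x , y) ∷ acc) rest next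

        B′ : ℕ
        B′ = Bounded.B ih

        g : St → ℚ
        g st = 𝔼 (run st rest) tot

        unfold : summed es ((x , y) ∷ rest) ≡ combined g
        unfold = ℚ∑.∑-cong (colourings m) (λ χ → cong (whenℚ (proper es χ)) (run-step (mk es χ) x y rest))

        upper : toℚ κ ℚ.* summed es ((x , y) ∷ rest) ℚ.≤ toℚ (# (proper es)) ℚ.* toℚ (cost M o + B′)
        upper = subst (λ z → toℚ κ ℚ.* z ℚ.≤ toℚ (# (proper es)) ℚ.* toℚ (cost M o + B′)) (sym unfold)
          (step-upper g (cost M o) B′ (hits≤cost M o (s≤M u v or uv l w wl)) (Bounded.upper ih))

        budget : cost M o + B′ + Ω es rep ≤ Γ rep + (suc (length rest) + 5 * (m + suc (length rest)))
        budget = +-cancelʳ-≤ (Γ rep′ + Ω es′ rep′) _ _ (begin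
          cost M o + B′ + Ω es rep + (Γ rep′ + Ω es′ rep′)
            ≡⟨ rearrange (cost M o) B′ (Ω es rep) (Γ rep′) (Ω es′ rep′) ⟩
          cost M o + (Γ rep′ + Ω es rep) + (B′ + Ω es′ rep′)
            ≤⟨ +-mono-≤ (amortised u v or uv l w wl o) (Bounded.budget ih) ⟩
          suc (Γ rep + Ω es′ rep′) + (Γ rep′ + (length rest + 5 * (suc m + length rest)))
            ≡⟨ rearrange₂ (Γ rep) (Ω es′ rep′) (Γ rep′) (length rest) m ⟩
          Γ rep + (suc (length rest) + 5 * (m + suc (length rest))) + (Γ rep′ + Ω es′ rep′) ∎)
          where
          open ≤-Reasoning
          rearrange : ∀ a b c d e → a + b + c + (d + e) ≡ a + (d + c) + (b + e)
          rearrange = solve-∀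
          rearrange₂ : ∀ a b c r m → suc (a + b) + (c + (r + 5 * (suc m + r))) ≡ a + (suc r + 5 * (m + suc r)) + (c + b)
          rearrange₂ = solve-∀

        here-busy : Bool
        here-busy = (1 ℕ.≤ᵇ degE acc x) ∧ (1 ℕ.≤ᵇ degE acc y)

        hits≥ : W * when here-busy 1 ≤ ∑ (allFin m) weight
        hits≥ with here-busy in eq
        ... | false = ≤-trans (≤-reflexive (*-zeroʳ W)) z≤n
        ... | true  = ≤-trans (≤-reflexive (*-identityʳ W)) (L.W≤total (oriented-elim (λ _ b → 0 < degV es b) pos-y pos-x uv))
          where
          pos-x : 0 < degV es x
          pos-x = subst (1 ≤_) (accdeg x) (≤ᵇ-true 1 (degE acc x) (proj₁ (∧-true eq)))
          pos-y : 0 < degV es y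
          pos-y = subst (1 ≤_) (accdeg y) (≤ᵇ-true 1 (degE acc y) (proj₂ (∧-true {1 ℕ.≤ᵇ degE acc x} eq)))

        lower : toℚ (# (proper es)) ℚ.* toℚ (when here-busy 1 + busy ((x , y) ∷ acc) rest) ℚ.≤ toℚ κ ℚ.* summed es ((x , y) ∷ rest)
        lower = subst (λ z → toℚ (# (proper es)) ℚ.* toℚ (when here-busy 1 + busy ((x , y) ∷ acc) rest) ℚ.≤ toℚ κ ℚ.* z) (sym unfold)
          (step-lower g (when here-busy 1) (busy ((x , y) ∷ acc) rest) hits≥ (Bounded.lower ih))

-- A path built from every other edge first

module PathSequence where

  open FiniteSums
  open Expectation
  open import Data.Nat as ℕ using (zero; suc; _<_; z≤n; s≤s; _+_)
  open import Data.Nat.Properties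
  open import Data.Bool using (true; false; _∨_)
  open import Data.Bool.Properties using (∨-zeroʳ)
  open import Data.Fin using (zero; suc; toℕ; fromℕ<; inject₁)
  import Data.Fin as Fin
  import Data.Fin.Properties as Fin
  open import Data.List using ([]; _∷_; _++_; allFin; map)
  open import Data.List.Properties using (length-map; length-++; length-tabulate)
  open import Data.List.Membership.Propositional using (_∈_)
  open import Data.List.Membership.Propositional.Properties using (∈-map⁻; ∈-map⁺; ∈-allFin)
  open import Data.List.Relation.Unary.Any using (here; there)
  open import Data.List.Relation.Unary.All as All using (All; []; _∷_)
  open import Data.List.Relation.Unary.AllPairs using ([]; _∷_)
  open import Data.List.Relation.Unary.Unique.Propositional using (Unique)
  import Data.List.Relation.Unary.Unique.Propositional.Properties as Unique
  open import Data.Product using (proj₁; proj₂)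
  open import Data.Unit using (tt)
  open import Function using (id)
  open import Relation.Nullary using (¬_; yes; no)
  open import Relation.Binary.PropositionalEquality

  module _ {k : ℕ} where

    link : Fin k → Fin (suc k) × Fin (suc k)
    link j = inject₁ j , suc j

    -- Both ends lie on the same side of the cut between the vertices `J` and `J + 1`.
    Uncut : ℕ → Fin (suc k) × Fin (suc k) → Set
    Uncut J (a , b) = (toℕ a ≤ J → toℕ b ≤ J) × (toℕ b ≤ J → toℕ a ≤ J)

    reach-uncut : ∀ {J acc} → (∀ e → e ∈ acc → Uncut J e) → ∀ {a b} → Reach acc a b → toℕ a ≤ J → toℕ b ≤ J
    reach-uncut unc Reach.here      le = le
    reach-uncut unc (fwd e r) le = reach-uncut unc r (proj₁ (unc _ e) le)
    reach-uncut unc (bwd e r) le = reach-uncut unc r (proj₂ (unc _ e) le)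

    link-uncut : ∀ j j′ → ¬ j ≡ j′ → Uncut (toℕ j) (link j′)
    link-uncut j j′ j≢j′ rewrite Fin.toℕ-inject₁ j′ =
      (λ le → ≤∧≢⇒< le (λ e → j≢j′ (Fin.toℕ-injective (sym e)))) , <⇒≤

    -- Any order without repetition is admissible: `link j` is the only link across the cut behind
    -- vertex `j`, so before its insertion nothing connects the two sides.
    joinsTrees : ∀ done js → Unique js → (∀ j → j ∈ js → ¬ j ∈ done) → JoinsTrees (map link done) (map link js)
    joinsTrees done []       _            _   = tt
    joinsTrees done (j ∷ js) (j∉js ∷ uniq) new = separated , joinsTrees (j ∷ done) js uniq new′
      where
      separated : ¬ Reach (map link done) (inject₁ j) (suc j)
      separated r = 1+n≰n (reach-uncut uncut r (≤-reflexive (Fin.toℕ-inject₁ j)))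
        where
        uncut : ∀ e → e ∈ map link done → Uncut (toℕ j) e
        uncut e e∈ with ∈-map⁻ link e∈
        ... | j′ , j′∈ , refl = link-uncut j j′ (λ { refl → new j (here refl) j′∈ })
      new′ : ∀ i → i ∈ js → ¬ i ∈ j ∷ done
      new′ i i∈ (here refl) = All.lookup j∉js i∈ refl
      new′ i i∈ (there i∈done) = new i (there i∈) i∈done

    count-injective : (g : Fin k → Fin (suc k)) → (∀ {i j} → g i ≡ g j → i ≡ j) → ∀ js → Unique js → ∀ x →
                      ∑ js (λ j → when (g j == x) 1) ≤ 1
    count-injective g inj []       _             x = z≤n
    count-injective g inj (j ∷ js) (j∉js ∷ uniq) x with g j Fin.≟ x
    ... | no _ = count-injective g inj js uniq x
    ... | yes refl = s≤s (≤-reflexive (none js j∉js))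
      where
      none : ∀ js → All (j ≢_) js → ∑ js (λ i → when (g i == g j) 1) ≡ 0
      none []       []        = refl
      none (i ∷ js) (p ∷ ps) rewrite ==-false (λ e → p (inj (sym e))) = none js ps

    -- A vertex is the left end of at most one link and the right end of at most one.
    link-degree : ∀ js → Unique js → ∀ x → degE (map link js) x ≤ 2
    link-degree js uniq x = begin
      degE (map link js) x
        ≡⟨ trans (countᵇ-∑ _ (map link js)) (∑-map link js _) ⟩
      ∑ js (λ j → when ((inject₁ j == x) ∨ (suc j == x)) 1)
        ≤⟨ ∑-mono js (λ j → either (inject₁ j == x) (suc j == x)) ⟩
      ∑ js (λ j → when (inject₁ j == x) 1 + when (suc j == x) 1)
        ≡⟨ ∑-⊕ js _ _ ⟩
      ∑ js (λ j → when (inject₁ j == x) 1) + ∑ js (λ j → when (suc j == x) 1)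
        ≤⟨ +-mono-≤ (count-injective inject₁ Fin.inject₁-injective js uniq x) (count-injective suc Fin.suc-injective js uniq x) ⟩
      2 ∎
      where
      open ≤-Reasoning
      either : ∀ a b → when (a ∨ b) 1 ≤ when a 1 + when b 1
      either true  b = m≤m+n 1 _
      either false b = ≤-refl

  touched : ∀ {n} (acc : List (Fin n × Fin n)) {a b} x → (a , b) ∈ acc → (a == x) ∨ (b == x) ≡ true → 1 ≤ degE acc x
  touched (e ∷ acc) x (here refl) inc rewrite inc = s≤s z≤n
  touched ((a , b) ∷ acc) x (there e∈) inc with (a == x) ∨ (b == x)
  ... | true  = s≤s z≤n
  ... | false = touched acc x e∈ inc

  module _ (M : ℕ) where

    size : ℕ
    size = suc (M + M)

    even< : (i : Fin (suc M)) → toℕ i + toℕ i < size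
    even< i = s≤s (+-mono-≤ (≤-pred (Fin.toℕ<n i)) (≤-pred (Fin.toℕ<n i)))

    odd< : (i : Fin M) → suc (toℕ i + toℕ i) < size
    odd< i = s≤s (+-mono-<-≤ (Fin.toℕ<n i) (<⇒≤ (Fin.toℕ<n i)))

    even : Fin (suc M) → Fin size
    even i = fromℕ< (even< i)

    odd : Fin M → Fin size
    odd i = fromℕ< (odd< i)

    toℕ-even : ∀ i → toℕ (even i) ≡ toℕ i + toℕ i
    toℕ-even i = Fin.toℕ-fromℕ< (even< i)

    toℕ-odd : ∀ i → toℕ (odd i) ≡ suc (toℕ i + toℕ i)
    toℕ-odd i = Fin.toℕ-fromℕ< (odd< i)

    double-injective : ∀ a b → a + a ≡ b + b → a ≡ b
    double-injective zero    zero    _  = refl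
    double-injective (suc a) (suc b) eq = cong suc (double-injective a b
      (suc-injective (trans (sym (+-suc a a)) (trans (suc-injective eq) (+-suc b b)))))

    double≢suc : ∀ a b → ¬ a + a ≡ suc (b + b)
    double≢suc (suc a) zero    eq rewrite +-suc a a with () ← eq
    double≢suc (suc a) (suc b) eq = double≢suc a b
      (suc-injective (trans (sym (+-suc a a)) (trans (suc-injective eq) (cong suc (+-suc b b)))))

    even-injective : ∀ {i j} → even i ≡ even j → i ≡ j
    even-injective {i} {j} eq = Fin.toℕ-injective (double-injective (toℕ i) (toℕ j)
      (trans (sym (toℕ-even i)) (trans (cong toℕ eq) (toℕ-even j))))

    odd-injective : ∀ {i j} → odd i ≡ odd j → i ≡ j
    odd-injective {i} {j} eq = Fin.toℕ-injective (double-injective (toℕ i) (toℕ j)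
      (suc-injective (trans (sym (toℕ-odd i)) (trans (cong toℕ eq) (toℕ-odd j)))))

    evens odds order : List (Fin size)
    evens = map even (allFin (suc M))
    odds  = map odd (allFin M)
    order = evens ++ odds

    order-unique : Unique order
    order-unique = Unique.++⁺ (Unique.map⁺ even-injective (Unique.allFin⁺ (suc M))) (Unique.map⁺ odd-injective (Unique.allFin⁺ M)) disjoint
      where
      disjoint : ∀ {j} → ¬ (j ∈ evens × j ∈ odds)
      disjoint (p , r) with ∈-map⁻ even {xs = allFin (suc M)} p | ∈-map⁻ odd {xs = allFin M} r
      ... | a , _ , eq | b , _ , eq′ =
        double≢suc (toℕ a) (toℕ b) (trans (sym (toℕ-even a)) (trans (cong toℕ (trans (sym eq) eq′)) (toℕ-odd b)))

    path : List (Fin (suc size) × Fin (suc size))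
    path = map link order

    path-valid : ∀ Δ → 3 ≤ Δ → Valid (suc size) Δ path
    path-valid Δ 3≤Δ = joinsTrees [] order order-unique (λ _ _ ())
      , λ x → ≤-trans (link-degree order order-unique x) (≤-trans (s≤s (s≤s z≤n)) 3≤Δ)

    length-path : length path ≡ size
    length-path = trans (length-map link order) (trans (length-++ evens) (cong₂ _+_
      (trans (length-map even (allFin (suc M))) (length-tabulate {n = suc M} id)) (trans (length-map odd (allFin M)) (length-tabulate {n = M} id))))

    -- Link `2 i + 1` joins the right end of link `2 i` to the left end of link `2 i + 2`, and both
    -- of these are even links.
    odd-ends : ∀ acc → (∀ j → j ∈ evens → link j ∈ acc) → ∀ i → 1 ≤ degE acc (inject₁ (odd i)) × 1 ≤ degE acc (suc (odd i))
    odd-ends acc sub i =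
      touched acc (inject₁ (odd i)) (sub _ (∈-map⁺ even (∈-allFin (inject₁ i)))) (trans (cong ((inject₁ (even (inject₁ i)) == inject₁ (odd i)) ∨_) (==-complete left)) (∨-zeroʳ _)) ,
      touched acc (suc (odd i)) (sub _ (∈-map⁺ even (∈-allFin (suc i)))) (cong (_∨ (suc (even (suc i)) == suc (odd i))) (==-complete right))
      where
      left : suc (even (inject₁ i)) ≡ inject₁ (odd i)
      left = Fin.toℕ-injective (trans (cong suc (trans (toℕ-even (inject₁ i)) (cong₂ _+_ (Fin.toℕ-inject₁ i) (Fin.toℕ-inject₁ i))))
        (sym (trans (Fin.toℕ-inject₁ (odd i)) (toℕ-odd i))))
      right : inject₁ (even (suc i)) ≡ suc (odd i)
      right = Fin.toℕ-injective (trans (trans (Fin.toℕ-inject₁ (even (suc i))) (toℕ-even (suc i)))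
        (sym (trans (cong suc (toℕ-odd i)) (cong suc (sym (+-suc (toℕ i) (toℕ i)))))))

  path-long : ∀ N → N ≤ length (path (suc N))
  path-long N = ≤-trans (≤-trans (n≤1+n N) (≤-trans (m≤m+n (suc N) (suc N)) (n≤1+n _))) (≤-reflexive (sym (length-path (suc N))))

-- The two bounds and their constants

module Conclusion where

  open FiniteSums
  open Expectation
  open PathSequence
  open import Data.Nat as ℕ using (suc; z≤n; s≤s; _+_)
  open import Data.Nat.Properties
  open import Data.Nat.Tactic.RingSolver using (solve-∀)
  open import Data.Integer using (+_)
  open import Data.Bool using (true; false; _∨_; _∧_)
  open import Data.List using ([]; _∷_; _++_; allFin; map)
  open import Data.List.Properties using (length-map; length-tabulate; map-++)
  open import Data.List.Membership.Propositional using (_∈_)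
  open import Data.List.Membership.Propositional.Properties using (∈-map⁻; ∈-map⁺)
  open import Data.List.Relation.Unary.Any using (here; there)
  open import Data.Vec using ([])
  open import Data.Product using (proj₁; proj₂)
  open import Data.Rational as ℚ using (ℚ; 0ℚ; _/_)
  import Data.Rational.Properties as ℚ
  open import Function using (id)
  open import Relation.Binary.PropositionalEquality

  module _ (n q c : ℕ) (2≤q : 2 ℕ.≤ q) where
    open Amortisation n q c 2≤q
    open Process n κ Δ using (run; empty)

    module _ (seq : List (Fin n × Fin n)) (valid : Valid n Δ seq) where
      open Bounds (degE seq) (proj₂ valid) (length seq)
      open Budget (degE seq) (length seq)

      result : Bounded [] id [] seq
      result = bounds [] id [] seq (record
        { forest = empty ; f-max = λ _ → ≤-refl ; degs = λ _ → refl ; accdeg = λ _ → refl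
        ; reach = λ { x .x refl → Reach.here } ; valid = proj₁ valid ; m≤M = ≤-refl })

      E : ℚ
      E = expTotalRecourse Δ c n seq

      -- Without edges there is only the empty colouring, so the sum has a single term.
      summed≡E : summed [] seq ≡ E
      summed≡E = trans (ℚ.+-identityʳ _) (𝔼-cong (run [] seq) (λ p → toℚ-def (proj₂ p)))

      unit : ∀ a → toℚ 1 ℚ.* toℚ a ≡ toℚ a
      unit a = trans (cong (ℚ._* toℚ a) toℚ-1) (ℚ.*-identityˡ (toℚ a))

      E-nonNeg : 0ℚ ℚ.≤ E
      E-nonNeg = 𝔼-nonNeg (run [] seq) _ (λ p → subst (0ℚ ℚ.≤_) (toℚ-def (proj₂ p)) (ℚ.nonNegative⁻¹ (toℚ (proj₂ p)) {{toℚ-nonNeg (proj₂ p)}}))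

      handshake : ∀ es → ∑ (allFin n) (degE es) ℕ.≤ 2 ℕ.* length es
      handshake []             = ≤-reflexive (∑-𝟘 (allFin n))
      handshake ((a , b) ∷ es) = begin
        ∑ (allFin n) (degE ((a , b) ∷ es))
          ≡⟨ ∑-cong (allFin n) (degE-cons a b es) ⟩
        ∑ (allFin n) (λ x → when ((a == x) ∨ (b == x)) 1 + degE es x)
          ≤⟨ ∑-mono (allFin n) (λ x → +-monoˡ-≤ (degE es x) (either (a == x) (b == x))) ⟩
        ∑ (allFin n) (λ x → when (a == x) 1 + when (b == x) 1 + degE es x)
          ≡⟨ trans (∑-⊕ (allFin n) _ _) (cong (_+ ∑ (allFin n) (degE es)) (trans (∑-⊕ (allFin n) _ _) (cong₂ _+_ (∑-δ a (λ _ → 1)) (∑-δ b (λ _ → 1))))) ⟩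
        2 + ∑ (allFin n) (degE es)
          ≤⟨ +-monoʳ-≤ 2 (handshake es) ⟩
        2 + 2 ℕ.* length es
          ≡⟨ sym (*-suc 2 (length es)) ⟩
        2 ℕ.* length ((a , b) ∷ es) ∎
        where
        open ≤-Reasoning
        either : ∀ a b → when (a ∨ b) 1 ℕ.≤ when a 1 + when b 1
        either true  b = m≤m+n 1 _
        either false b = ≤-refl

      -- Initially every vertex represents itself and `Γ` is the degree sum, at most `2` per edge;
      -- each insertion adds its unit and `Ω` accounts for `5` per edge.
      total : Bounded.B result ℕ.≤ 8 ℕ.* length seq
      total = begin
        B                                          ≤⟨ m≤m+n B (Ω [] id) ⟩
        B + Ω [] id                                ≤⟨ Bounded.budget result ⟩
        Γ id + (length seq + 5 ℕ.* length seq)     ≤⟨ +-monoˡ-≤ _ (≤-trans (≤-reflexive (∑-cong (allFin n) (λ x → cong (λ b → when b (degE seq x)) (==-refl x)))) (handshake seq)) ⟩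
        2 ℕ.* length seq + (length seq + 5 ℕ.* length seq) ≡⟨ lemma (length seq) ⟩
        8 ℕ.* length seq ∎
        where
        open ≤-Reasoning
        B : ℕ
        B = Bounded.B result
        lemma : ∀ s → 2 ℕ.* s + (s + 5 ℕ.* s) ≡ 8 ℕ.* s
        lemma = solve-∀

      κE≤ : toℚ κ ℚ.* E ℚ.≤ toℚ 8 ℚ.* toℚ (length seq)
      κE≤ = begin
        toℚ κ ℚ.* E                       ≡⟨ cong (toℚ κ ℚ.*_) (sym summed≡E) ⟩
        toℚ κ ℚ.* summed [] seq           ≤⟨ Bounded.upper result ⟩
        toℚ 1 ℚ.* toℚ (Bounded.B result)  ≡⟨ unit (Bounded.B result) ⟩
        toℚ (Bounded.B result)            ≤⟨ toℚ-mono total ⟩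
        toℚ (8 ℕ.* length seq)            ≡⟨ toℚ-* 8 (length seq) ⟩
        toℚ 8 ℚ.* toℚ (length seq)        ∎
        where open ℚ.≤-Reasoning

      busy≤κE : toℚ (busy [] seq) ℚ.≤ toℚ κ ℚ.* E
      busy≤κE = begin
        toℚ (busy [] seq)                 ≡⟨ sym (unit (busy [] seq)) ⟩
        toℚ 1 ℚ.* toℚ (busy [] seq)       ≤⟨ Bounded.lower result ⟩
        toℚ κ ℚ.* summed [] seq           ≡⟨ cong (toℚ κ ℚ.*_) summed≡E ⟩
        toℚ κ ℚ.* E                       ∎
        where open ℚ.≤-Reasoning

      -- The estimate is obtained with the factor `κ`, and `Δ ≤ κ`.
      scaled-upper : E ℚ.* toℚ Δ ℚ.≤ toℚ 8 ℚ.* toℚ (length seq)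
      scaled-upper = begin
        E ℚ.* toℚ Δ   ≤⟨ ℚ.*-monoˡ-≤-nonNeg E {{ℚ.nonNegative E-nonNeg}} (toℚ-mono (m≤m+n Δ c)) ⟩
        E ℚ.* toℚ κ   ≡⟨ ℚ.*-comm E (toℚ κ) ⟩
        toℚ κ ℚ.* E   ≤⟨ κE≤ ⟩
        toℚ 8 ℚ.* toℚ (length seq) ∎
        where open ℚ.≤-Reasoning

      busy≤2ΔE : κ ℕ.≤ 2 ℕ.* Δ → toℚ (busy [] seq) ℚ.≤ toℚ 2 ℚ.* (E ℚ.* toℚ Δ)
      busy≤2ΔE κ≤2Δ = begin
        toℚ (busy [] seq)            ≤⟨ busy≤κE ⟩
        toℚ κ ℚ.* E                  ≤⟨ ℚ.*-monoʳ-≤-nonNeg E {{ℚ.nonNegative E-nonNeg}} (toℚ-mono κ≤2Δ) ⟩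
        toℚ (2 ℕ.* Δ) ℚ.* E          ≡⟨ cong (ℚ._* E) (toℚ-* 2 Δ) ⟩
        toℚ 2 ℚ.* toℚ Δ ℚ.* E        ≡⟨ trans (ℚ.*-assoc (toℚ 2) (toℚ Δ) E) (cong (toℚ 2 ℚ.*_) (ℚ.*-comm (toℚ Δ) E)) ⟩
        toℚ 2 ℚ.* (E ℚ.* toℚ Δ)      ∎
        where open ℚ.≤-Reasoning

    degE-grows : ∀ e (acc : List (Fin n × Fin n)) x → degE acc x ℕ.≤ degE (e ∷ acc) x
    degE-grows (a , b) acc x = ≤-trans (m≤n+m _ _) (≤-reflexive (sym (degE-cons a b acc x)))

    both-busy : ∀ a b → 1 ℕ.≤ a → 1 ℕ.≤ b → (1 ℕ.≤ᵇ a) ∧ (1 ℕ.≤ᵇ b) ≡ true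
    both-busy (suc _) (suc _) _ _ = refl

    busy-all : ∀ acc s → (∀ e → e ∈ s → 1 ℕ.≤ degE acc (proj₁ e) × 1 ℕ.≤ degE acc (proj₂ e)) → length s ℕ.≤ busy acc s
    busy-all acc []            _   = z≤n
    busy-all acc ((x , y) ∷ s) ends
      rewrite both-busy (degE acc x) (degE acc y) (proj₁ (ends _ (here refl))) (proj₂ (ends _ (here refl))) =
      s≤s (busy-all ((x , y) ∷ acc) s (λ e e∈ → let (p , r) = ends e (there e∈) in
        ≤-trans p (degE-grows (x , y) acc (proj₁ e)) , ≤-trans r (degE-grows (x , y) acc (proj₂ e))))

    -- Of the prefix only the edges it leaves behind matter; the auxiliary `go` also records that
    -- accumulated edges are never lost.
    busy-++ : ∀ acc s s′ → (∀ acc′ → (∀ e → e ∈ s → e ∈ acc′) → length s′ ℕ.≤ busy acc′ s′) → length s′ ℕ.≤ busy acc (s ++ s′)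
    busy-++ acc s s′ later = go acc s (λ acc′ sub _ → later acc′ sub)
      where
      go : ∀ acc s → (∀ acc′ → (∀ e → e ∈ s → e ∈ acc′) → (∀ e → e ∈ acc → e ∈ acc′) → length s′ ℕ.≤ busy acc′ s′) → length s′ ℕ.≤ busy acc (s ++ s′)
      go acc []            later = later acc (λ _ ()) (λ _ p → p)
      go acc ((x , y) ∷ s) later = ≤-trans (go ((x , y) ∷ acc) s (λ acc′ sub old → later acc′
        (λ { e (here refl) → old _ (here refl) ; e (there p) → sub e p }) (λ e p → old e (there p)))) (m≤n+m _ _)

  module _ (M q c : ℕ) (2≤q : 2 ℕ.≤ q) where
    open Amortisation (suc (size M)) q c 2≤q using (busy)

    path-busy : M ℕ.≤ busy [] (path M)
    path-busy = begin
      M                                              ≡⟨ sym (trans (length-map link (odds M)) (trans (length-map (odd M) (allFin M)) (length-tabulate {n = M} id))) ⟩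
      length (map link (odds M))                     ≤⟨ busy-++ _ q c 2≤q [] (map link (evens M)) (map link (odds M)) later ⟩
      busy [] (map link (evens M) ++ map link (odds M)) ≡⟨ cong (busy []) (sym (map-++ link (evens M) (odds M))) ⟩
      busy [] (path M)                               ∎
      where
      open ≤-Reasoning
      later : ∀ acc → (∀ e → e ∈ map link (evens M) → e ∈ acc) → length (map link (odds M)) ℕ.≤ busy acc (map link (odds M))
      later acc sub = busy-all _ q c 2≤q acc (map link (odds M)) ends
        where
        ends : ∀ e → e ∈ map link (odds M) → 1 ℕ.≤ degE acc (proj₁ e) × 1 ℕ.≤ degE acc (proj₂ e)
        ends e e∈ with ∈-map⁻ link e∈
        ... | j , j∈ , refl with ∈-map⁻ (odd M) j∈
        ...   | i , _ , refl = odd-ends M acc (λ j p → sub _ (∈-map⁺ link p)) i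

  upper-bound : ∀ Δ c n → 3 ℕ.≤ Δ → ∀ seq → Valid n Δ seq → expTotalRecourse Δ c n seq ℚ.* ℕtoℚ Δ ℚ.≤ ℕtoℚ 8 ℚ.* ℕtoℚ (length seq)
  upper-bound (suc q) c n (s≤s 2≤q) seq valid =
    subst₂ ℚ._≤_ (cong (expTotalRecourse (suc q) c n seq ℚ.*_) (toℚ-def (suc q))) (cong₂ ℚ._*_ (toℚ-def 8) (toℚ-def (length seq)))
      (scaled-upper n q c 2≤q seq valid)

  -- Of the `2 N + 3` insertions at least `N + 1`, hence a third, join two non-isolated vertices.
  -- Replacing `κ` by `2 Δ`, which `c ≤ Δ ∸ 2` permits, costs the remaining factor `2`. The path is
  -- taken at `suc N` so that the third is reached even for `N = 0`.
  lower-bound : ∀ Δ c → 3 ℕ.≤ Δ → c ℕ.≤ Δ ∸ 2 → ∀ N →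
    ((+ 1) / 6) ℚ.* ℕtoℚ (length (path (suc N))) ℚ.≤ expTotalRecourse Δ c (suc (size (suc N))) (path (suc N)) ℚ.* ℕtoℚ Δ
  lower-bound (suc q) c (s≤s 2≤q) c≤ N = subst₂ ℚ._≤_ (cong (((+ 1) / 6) ℚ.*_) (toℚ-def (length s))) (cong (E′ ℚ.*_) (toℚ-def (suc q)))
    (ℚ.*-cancelˡ-≤-pos (toℚ 6) {{toℚ-pos 6}} (begin
      toℚ 6 ℚ.* (((+ 1) / 6) ℚ.* toℚ (length s))  ≡⟨ trans (sym (ℚ.*-assoc (toℚ 6) ((+ 1) / 6) _)) (trans (cong (ℚ._* toℚ (length s)) (toℚ-inverse 5)) (ℚ.*-identityˡ _)) ⟩
      toℚ (length s)                              ≤⟨ toℚ-mono short ⟩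
      toℚ (3 ℕ.* busy [] s)                       ≡⟨ toℚ-* 3 (busy [] s) ⟩
      toℚ 3 ℚ.* toℚ (busy [] s)                   ≤⟨ ℚ.*-monoˡ-≤-nonNeg (toℚ 3) {{toℚ-nonNeg 3}} (busy≤2ΔE _ q c 2≤q s (path-valid (suc N) (suc q) (s≤s 2≤q)) κ≤2Δ) ⟩
      toℚ 3 ℚ.* (toℚ 2 ℚ.* (E′ ℚ.* toℚ (suc q)))  ≡⟨ trans (sym (ℚ.*-assoc (toℚ 3) (toℚ 2) _)) (cong (ℚ._* (E′ ℚ.* toℚ (suc q))) (sym (toℚ-* 3 2))) ⟩
      toℚ 6 ℚ.* (E′ ℚ.* toℚ (suc q))              ∎))
    where
    open ℚ.≤-Reasoning
    open Amortisation (suc (size (suc N))) q c 2≤q using (busy)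
    s : List (Fin (suc (size (suc N))) × Fin (suc (size (suc N))))
    s = path (suc N)
    E′ : ℚ
    E′ = expTotalRecourse (suc q) c (suc (size (suc N))) s
    short : length s ℕ.≤ 3 ℕ.* busy [] s
    short = ≤-trans (≤-reflexive (length-path (suc N))) (≤-trans size≤ (*-monoʳ-≤ 3 (path-busy (suc N) q c 2≤q)))
      where
      size≤ : size (suc N) ℕ.≤ 3 ℕ.* suc N
      size≤ = ≤-trans (m≤m+n (size (suc N)) N) (≤-reflexive (lemma N))
        where
        lemma : ∀ N → suc (suc N + suc N) + N ≡ 3 ℕ.* suc N
        lemma = solve-∀
    κ≤2Δ : suc q + c ℕ.≤ 2 ℕ.* suc q
    κ≤2Δ = +-monoʳ-≤ (suc q) (≤-trans c≤ (≤-trans (m∸n≤m q 1) (≤-trans (n≤1+n q) (≤-reflexive (sym (+-identityʳ (suc q)))))))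

open import Data.Rational using (ℚ; 0ℚ; _*_; _<_) renaming (_≤_ to _≤ℚ_)

theorem2p10 : (Σ ℚ λ C → (0ℚ < C) ×
    ((Δ c n : ℕ) → 3 ≤ Δ → c ≤ Δ ∸ 2 → (seq : List (Fin n × Fin n)) → Valid n Δ seq →
    expTotalRecourse Δ c n seq * ℕtoℚ Δ ≤ℚ C * ℕtoℚ (length seq)))
    ×
    (Σ ℚ λ C → (0ℚ < C) ×
    ((Δ c : ℕ) → 3 ≤ Δ → c ≤ Δ ∸ 2 → (N : ℕ) →
    Σ ℕ λ n → Σ (List (Fin n × Fin n)) λ seq → Valid n Δ seq × N ≤ length seq ×
    C * ℕtoℚ (length seq) ≤ℚ expTotalRecourse Δ c n seq * ℕtoℚ Δ))
theorem2p10 =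
  (ℕtoℚ 8 , positive⁻¹ (ℕtoℚ 8) , λ Δ c n 3≤Δ _ → upper-bound Δ c n 3≤Δ) ,
  ((+ 1) / 6 , positive⁻¹ ((+ 1) / 6) , λ Δ c 3≤Δ c≤Δ-2 N →
    suc (size (suc N)) , path (suc N) , path-valid (suc N) Δ 3≤Δ , path-long N , lower-bound Δ c 3≤Δ c≤Δ-2 N)
  where
  open Conclusion
  open PathSequence
  open import Data.Nat using (suc)
  open import Data.Integer using (+_)
  open import Data.Rational using (_/_)
  open import Data.Rational.Properties using (positive⁻¹)
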